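{- For all integers $k\ge 3$ and $n\ge 1$ with $(k,n)\neq(3,1)$, the number $p_k(n)$ of $k$-coloured partitions satisfies the strict log-concavity inequality \[ p_k(n)^2>p_k(n-1)\,p_k(n+1). \]
   Context: For $k\in\mathbb{N}$, $p_k(n)$ denotes the number of $k$-coloured partitions of $n$ (partitions of $n$ in which each part is assigned one of $k$ colours), i.e. $\sum_{n\ge0}p_k(n)q^n=\prod_{m\ge1}(1-q^m)^{ -k}$, with $p_k(0)=1$. -}

module Defs where

open import Data.Nat using (ℕ; zero; suc; _+_; _*_; _∸_)
open import Data.Nat.DivMod using (_/_)

sumTo : ℕ → (ℕ → ℕ) → ℕ
sumTo zero    f = f 0
sumTo (suc n) f = sumTo n f + f (suc n)

-- partsLE m n = number of partitions of n into parts of size ≤ m,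
-- i.e. the coefficient of q^n in ∏_{j=1}^{m} (1 - q^j)^{-1}.
-- Recurrence: choose the multiplicity i of the part (m+1).
partsLE : ℕ → ℕ → ℕ
partsLE zero    zero    = 1
partsLE zero    (suc n) = 0
partsLE (suc m) n = sumTo (n / suc m) (λ i → partsLE m (n ∸ i * suc m))

-- p n = number of (ordinary) partitions of n, the coefficient of q^n in
-- ∏_{m≥1} (1 - q^m)^{-1}  (parts of a partition of n are ≤ n).
p : ℕ → ℕ
p n = partsLE n n

conv : (ℕ → ℕ) → (ℕ → ℕ) → ℕ → ℕ
conv f g n = sumTo n (λ i → f i * g (n ∸ i))

-- p_k n = coefficient of q^n in ∏_{m≥1} (1 - q^m)^{-k}
--       = (∏_{m≥1} (1 - q^m)^{-1})^k ; the k-th convolution power of p.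
pk : ℕ → ℕ → ℕ
pk zero    zero    = 1
pk zero    (suc n) = 0
pk (suc k) n = conv p (pk k) n

{-# OPTIONS --safe #-}

-- Fix k, write p for p_k and r_m = p(m) / p(m − 1), and recall n p(n) = k ∑_j σ(j) p(n − j). Suppose r_1 ≥ … ≥ r_n,
-- and put X_j = p(n − j) − r_n p(n − j − 1) ≥ 0. The recurrence for n − 1 and n gives k ∑_j σ(j) X_j = p(n), and for
-- n + 1 it turns r_{n+1} < r_n into k ∑_j σ(j + 1) X_j < r_n p(n), that is into ∑_j (r_n σ(j) − σ(j + 1)) X_j > 0.
-- Since X_j / p(n − j − 1) = r_{n−j} − r_n is nondecreasing in j, Abel summation reduces this to comparing the tails
-- ∑_{j ≥ i} σ(j + 1) p(n − j − 1) and r_n ∑_{j ≥ i} σ(j) p(n − j − 1) for i up to about 2n/15, the far terms being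
-- exponentially small. For i = O(√n) the comparison follows from k σ(i) p(n − i) ≥ 2 p(n); for larger i it follows from
-- r_n ≥ 1 + 1/g + 1/n and r_{n−j} ≤ 1 + 4/(3g) with g of order √n. These bounds on the ratios come out of the recurrence
-- itself, because p is convex and σ(j) is ζ(2) j on average. All constants work for k = 3, 4, 5 and n > 6500; smaller n
-- are left to computation, and k ≥ 6 is reached from k − 3 by convolution with p_3, which preserves log-concavity.

module Submission where

open import Defs
open import Data.Bool using (Bool; true; false; if_then_else_; T; _∧_)
open import Data.Empty using (⊥-elim)
open import Data.List using (List; []; _∷_)
open import Data.Nat
open import Data.Nat.Divisibility using (∣-refl; n∣m*n)
open import Data.Nat.DivMod
open import Data.Nat.Induction using (<-wellFounded)
open import Data.Nat.Properties
open import Data.Nat.Tactic.RingSolver using (solve-∀)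
open import Data.Product using (_×_; _,_; proj₁; proj₂; ∃-syntax)
open import Data.Sum using (_⊎_; inj₁; inj₂)
open import Data.Unit using (tt)
open import Induction.WellFounded using (Acc; acc)
open import Relation.Binary.PropositionalEquality
  using (_≡_; _≢_; refl; sym; trans; cong; cong₂; subst; subst₂; module ≡-Reasoning)
open import Relation.Nullary using (¬_; yes; no; contradiction)
open import Relation.Nullary.Decidable using (toWitness)

-- Finite sums

-- Why crude ratio bounds suffice: the tail with σ(j) is the tail with σ(j + 1) moved by one place,
-- plus the single extra term σ(i) P(n - i - 1). The move costs a factor of at most 1 + 4/(3g),
-- while r_n supplies at least 1 + 1/g. The deficit is 1/(3g) times a tail of size below 3 g σ(i)
-- P(n - i - 1), and the extra term pays for it. This needs i ≥ 2g; for smaller i the tail is of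
-- order g², and only the exact recurrences, with the tail written as total minus head, are sharp
-- enough. With n close to (5/4) k g² the true r_n - 1 is about 1.15/g, between the two bounds; they
-- lose by replacing ζ(2) by 33/20 from above and by its first eight terms, about 1.527, from below.
-- The comparison is proved with r_n - 1/n in place of r_n, and the 1/n absorbs the far terms and
-- gives strictness. Everything stays in ℕ: ratios are cross-multiplied, and `≤-cert` derives X ≤ Y
-- from a scaled and summed hypothesis A ≤ B by one ring identity with slack E.

≤-cert : ∀ {X Y A B} E → A ≤ B → X + B + E ≡ Y + A → X ≤ Y
≤-cert {X} {Y} {A} {B} E A≤B eq = +-cancelʳ-≤ B X Y
  (≤-trans (m≤m+n (X + B) E) (≤-trans (≤-reflexive eq) (+-monoʳ-≤ Y A≤B)))

≤-slack : ∀ {X Y} E → X + E ≡ Y → X ≤ Y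
≤-slack {X} E eq = ≤-trans (m≤m+n X E) (≤-reflexive eq)

-- ∑ n f = f 0 + … + f (n − 1)
∑ : ℕ → (ℕ → ℕ) → ℕ
∑ zero    f = 0
∑ (suc n) f = ∑ n f + f n

∑-cong< : ∀ n {f g : ℕ → ℕ} → (∀ i → i < n → f i ≡ g i) → ∑ n f ≡ ∑ n g
∑-cong< zero    h = refl
∑-cong< (suc n) h = cong₂ _+_ (∑-cong< n (λ i i<n → h i (m<n⇒m<1+n i<n))) (h n ≤-refl)

∑-cong : ∀ n {f g : ℕ → ℕ} → (∀ i → f i ≡ g i) → ∑ n f ≡ ∑ n g
∑-cong n h = ∑-cong< n (λ i _ → h i)

∑-mono< : ∀ n {f g : ℕ → ℕ} → (∀ i → i < n → f i ≤ g i) → ∑ n f ≤ ∑ n g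
∑-mono< zero    h = z≤n
∑-mono< (suc n) h = +-mono-≤ (∑-mono< n (λ i i<n → h i (m<n⇒m<1+n i<n))) (h n ≤-refl)

∑-mono : ∀ n {f g : ℕ → ℕ} → (∀ i → f i ≤ g i) → ∑ n f ≤ ∑ n g
∑-mono n h = ∑-mono< n (λ i _ → h i)

∑-0 : ∀ n → ∑ n (λ _ → 0) ≡ 0
∑-0 zero    = refl
∑-0 (suc n) = trans (+-identityʳ _) (∑-0 n)

∑-zero< : ∀ n {f : ℕ → ℕ} → (∀ i → i < n → f i ≡ 0) → ∑ n f ≡ 0
∑-zero< n h = trans (∑-cong< n h) (∑-0 n)

∑-const : ∀ n c → ∑ n (λ _ → c) ≡ n * c
∑-const zero    c = refl
∑-const (suc n) c = trans (+-comm _ c) (cong (c +_) (∑-const n c))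

∑-+ : ∀ n (f g : ℕ → ℕ) → ∑ n (λ i → f i + g i) ≡ ∑ n f + ∑ n g
∑-+ zero    f g = refl
∑-+ (suc n) f g = trans (cong (_+ (f n + g n)) (∑-+ n f g)) (lem (∑ n f) (∑ n g) (f n) (g n))
  where
  lem : ∀ a b c d → a + b + (c + d) ≡ a + c + (b + d)
  lem = solve-∀

∑-*ˡ : ∀ n c (f : ℕ → ℕ) → ∑ n (λ i → c * f i) ≡ c * ∑ n f
∑-*ˡ zero    c f = sym (*-zeroʳ c)
∑-*ˡ (suc n) c f = trans (cong (_+ c * f n) (∑-*ˡ n c f)) (sym (*-distribˡ-+ c (∑ n f) (f n)))

∑-*ʳ : ∀ n c (f : ℕ → ℕ) → ∑ n (λ i → f i * c) ≡ ∑ n f * c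
∑-*ʳ zero    c f = refl
∑-*ʳ (suc n) c f = trans (cong (_+ f n * c) (∑-*ʳ n c f)) (sym (*-distribʳ-+ c (∑ n f) (f n)))

∑-split : ∀ m n (f : ℕ → ℕ) → ∑ (m + n) f ≡ ∑ m f + ∑ n (λ i → f (m + i))
∑-split m zero    f = trans (cong (λ k → ∑ k f) (+-identityʳ m)) (sym (+-identityʳ _))
∑-split m (suc n) f rewrite +-suc m n =
  trans (cong (_+ f (m + n)) (∑-split m n f)) (+-assoc (∑ m f) _ _)

∑-head : ∀ n (f : ℕ → ℕ) → ∑ (suc n) f ≡ f 0 + ∑ n (λ i → f (suc i))
∑-head n f = ∑-split 1 n f

∑-swap : ∀ m n (f : ℕ → ℕ → ℕ) → ∑ m (λ i → ∑ n (f i)) ≡ ∑ n (λ j → ∑ m (λ i → f i j))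
∑-swap zero    n f = sym (∑-0 n)
∑-swap (suc m) n f = trans (cong (_+ ∑ n (f m)) (∑-swap m n f)) (sym (∑-+ n _ (f m)))

∑-extend : ∀ {m n} (f : ℕ → ℕ) → m ≤ n → (∀ i → m ≤ i → f i ≡ 0) → ∑ n f ≡ ∑ m f
∑-extend {m} f m≤n h with m≤n⇒∃[o]m+o≡n m≤n
... | o , refl = trans (∑-split m o f)
  (trans (cong (∑ m f +_) (∑-zero< o (λ i _ → h (m + i) (m≤m+n m i)))) (+-identityʳ _))

∑-prefix : ∀ {m n} (f : ℕ → ℕ) → m ≤ n → ∑ m f ≤ ∑ n f
∑-prefix {m} f m≤n with m≤n⇒∃[o]m+o≡n m≤n
... | o , refl = ≤-trans (m≤m+n _ _) (≤-reflexive (sym (∑-split m o f)))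

∑-pad : ∀ m n (f : ℕ → ℕ) → (∀ i → i < m → f i ≡ 0) → ∑ (m + n) f ≡ ∑ n (λ i → f (m + i))
∑-pad m n f h = trans (∑-split m n f) (cong (_+ ∑ n (λ i → f (m + i))) (∑-zero< m h))

∑-rev : ∀ n (f : ℕ → ℕ) → ∑ n f ≡ ∑ n (λ i → f (n ∸ suc i))
∑-rev zero    f = refl
∑-rev (suc n) f = trans (+-comm (∑ n f) (f n))
  (trans (cong (f n +_) (∑-rev n f)) (sym (∑-head n (λ i → f (n ∸ i)))))

∑-block : ∀ N e (h : ℕ → ℕ) → ∑ (N * e) h ≡ ∑ N (λ d → ∑ e (λ t → h (d * e + t)))
∑-block zero    e h = refl
∑-block (suc N) e h rewrite +-comm e (N * e) =
  trans (∑-split (N * e) e h) (cong (_+ ∑ e (λ t → h (N * e + t))) (∑-block N e h))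

term≤∑ : ∀ n i (f : ℕ → ℕ) → i < n → f i ≤ ∑ n f
term≤∑ (suc n) i f i<n with m<1+n⇒m<n∨m≡n i<n
... | inj₁ i<n′ = ≤-trans (term≤∑ n i f i<n′) (m≤m+n _ _)
... | inj₂ refl = m≤n+m _ _

sumTo≡∑ : ∀ n f → sumTo n f ≡ ∑ (suc n) f
sumTo≡∑ zero    f = refl
sumTo≡∑ (suc n) f = cong (_+ f (suc n)) (sumTo≡∑ n f)

-- rev f n j = f (n − j), read as 0 when j > n
rev : (ℕ → ℕ) → ℕ → ℕ → ℕ
rev f n       zero    = f n
rev f zero    (suc j) = 0
rev f (suc n) (suc j) = rev f n j

rev-> : ∀ f n j → n < j → rev f n j ≡ 0
rev-> f zero    (suc j) _         = refl
rev-> f (suc n) (suc j) (s≤s n<j) = rev-> f n j n<j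

rev-∸ : ∀ f n j → j ≤ n → rev f n j ≡ f (n ∸ j)
rev-∸ f n       zero    _         = refl
rev-∸ f (suc n) (suc j) (s≤s j≤n) = rev-∸ f n j j≤n

rev-+ : ∀ f j m → rev f (j + m) j ≡ f m
rev-+ f zero    m = refl
rev-+ f (suc j) m = rev-+ f j m

rev-shift : ∀ f i n j → rev f (i + n) (i + j) ≡ rev f n j
rev-shift f zero    n j = refl
rev-shift f (suc i) n j = rev-shift f i n j

rev-cong : ∀ {f g : ℕ → ℕ} n j → (∀ m → m ≤ n → f m ≡ g m) → rev f n j ≡ rev g n j
rev-cong n       zero    h = h n ≤-refl
rev-cong zero    (suc j) h = refl
rev-cong (suc n) (suc j) h = rev-cong n j (λ m m≤n → h m (m≤n⇒m≤1+n m≤n))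

-- The recurrence n p_k(n) = k ∑ σ(j) p_k(n − j)

conv-∑ : ∀ f g n → conv f g n ≡ ∑ (suc n) (λ i → f i * rev g n i)
conv-∑ f g n = trans (sumTo≡∑ n _)
  (∑-cong< (suc n) (λ i i<n → cong (f i *_) (sym (rev-∸ g n i (s≤s⁻¹ i<n)))))

conv-∑-ext : ∀ f g n {M} → n < M → conv f g n ≡ ∑ M (λ i → f i * rev g n i)
conv-∑-ext f g n n<M = trans (conv-∑ f g n) (sym (∑-extend _ n<M
  (λ i n<i → trans (cong (f i *_) (rev-> g n i n<i)) (*-zeroʳ (f i)))))

conv-cong : ∀ {f f′ g g′ : ℕ → ℕ} n → (∀ i → f i ≡ f′ i) → (∀ i → g i ≡ g′ i) →
  conv f g n ≡ conv f′ g′ n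
conv-cong {f} {f′} {g} {g′} n hf hg = trans (sumTo≡∑ n _)
  (trans (∑-cong (suc n) (λ i → cong₂ _*_ (hf i) (hg (n ∸ i)))) (sym (sumTo≡∑ n _)))

conv-comm : ∀ f g n → conv f g n ≡ conv g f n
conv-comm f g n = begin
  conv f g n  ≡⟨ sumTo≡∑ n _ ⟩
  ∑ (suc n) (λ i → f i * g (n ∸ i))  ≡⟨ ∑-rev (suc n) _ ⟩
  ∑ (suc n) (λ i → f (n ∸ i) * g (n ∸ (n ∸ i)))  ≡⟨ ∑-cong< (suc n) swap ⟩
  ∑ (suc n) (λ i → g i * f (n ∸ i))  ≡⟨ sumTo≡∑ n _ ⟨
  conv g f n  ∎
  where
  open ≡-Reasoning
  swap : ∀ i → i < suc n → f (n ∸ i) * g (n ∸ (n ∸ i)) ≡ g i * f (n ∸ i)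
  swap i i≤n = trans (cong (λ k → f (n ∸ i) * g k) (m∸[m∸n]≡n (s≤s⁻¹ i≤n))) (*-comm (f (n ∸ i)) (g i))

-- Zero padding by `rev` makes the range of j independent of i, so that a triple convolution becomes
-- a sum over a full square and can be transposed.
rev-conv : ∀ g h n i → rev (conv g h) n i ≡ ∑ (suc n) (λ j → g j * rev h n (i + j))
rev-conv g h n i with i ≤? n
... | yes i≤n with m≤n⇒∃[o]m+o≡n i≤n
...   | m , refl = begin
  rev (conv g h) (i + m) i  ≡⟨ rev-+ (conv g h) i m ⟩
  conv g h m  ≡⟨ conv-∑-ext g h m (s≤s (m≤n+m m i)) ⟩
  ∑ (suc (i + m)) (λ j → g j * rev h m j)  ≡⟨ ∑-cong (suc (i + m)) (λ j → cong (g j *_) (sym (rev-shift h i m j))) ⟩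
  ∑ (suc (i + m)) (λ j → g j * rev h (i + m) (i + j)) ∎
  where open ≡-Reasoning
rev-conv g h n i | no i≰n = trans (rev-> _ n i (≰⇒> i≰n)) (sym (∑-zero< (suc n) (λ j _ →
  trans (cong (g j *_) (rev-> h n (i + j) (≤-trans (≰⇒> i≰n) (m≤m+n i j)))) (*-zeroʳ (g j)))))

conv-left-comm : ∀ f g h n → conv f (conv g h) n ≡ conv g (conv f h) n
conv-left-comm f g h n = begin
  conv f (conv g h) n  ≡⟨ expand f g ⟩
  ∑ (suc n) (λ i → ∑ (suc n) (λ j → f i * (g j * rev h n (i + j)))) ≡⟨ ∑-swap (suc n) (suc n) _ ⟩
  ∑ (suc n) (λ j → ∑ (suc n) (λ i → f i * (g j * rev h n (i + j))))
    ≡⟨ ∑-cong (suc n) (λ j → ∑-cong (suc n) (λ i → trans (lem (f i) (g j) _) (cong (λ s → g j * (f i * rev h n s)) (+-comm i j)))) ⟩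
  ∑ (suc n) (λ j → ∑ (suc n) (λ i → g j * (f i * rev h n (j + i)))) ≡⟨ expand g f ⟨
  conv g (conv f h) n  ∎
  where
  open ≡-Reasoning
  lem : ∀ a b c → a * (b * c) ≡ b * (a * c)
  lem = solve-∀
  expand : ∀ f g → conv f (conv g h) n ≡ ∑ (suc n) (λ i → ∑ (suc n) (λ j → f i * (g j * rev h n (i + j))))
  expand f g = trans (conv-∑ f (conv g h) n) (∑-cong (suc n) (λ i →
    trans (cong (f i *_) (rev-conv g h n i)) (sym (∑-*ˡ (suc n) (f i) _))))

conv-assoc : ∀ f g h n → conv (conv f g) h n ≡ conv f (conv g h) n
conv-assoc f g h n = trans (conv-comm (conv f g) h n)
  (trans (conv-left-comm h f g n) (conv-cong {f} n (λ _ → refl) (conv-comm h g)))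

-- The operator q d/dq on coefficient sequences; `D-conv` is its Leibniz rule.
D : (ℕ → ℕ) → ℕ → ℕ
D f n = n * f n

D-conv : ∀ f g n → D (conv f g) n ≡ conv (D f) g n + conv f (D g) n
D-conv f g n = begin
  n * conv f g n  ≡⟨ cong (n *_) (sumTo≡∑ n _) ⟩
  n * ∑ (suc n) (λ i → f i * g (n ∸ i))  ≡⟨ ∑-*ˡ (suc n) n _ ⟨
  ∑ (suc n) (λ i → n * (f i * g (n ∸ i)))  ≡⟨ ∑-cong< (suc n) leibniz ⟩
  ∑ (suc n) (λ i → i * f i * g (n ∸ i) + f i * ((n ∸ i) * g (n ∸ i)))
                                                    ≡⟨ ∑-+ (suc n) _ _ ⟩
  ∑ (suc n) (λ i → D f i * g (n ∸ i)) + ∑ (suc n) (λ i → f i * D g (n ∸ i))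
                                                    ≡⟨ cong₂ _+_ (sumTo≡∑ n _) (sumTo≡∑ n _) ⟨
  conv (D f) g n + conv f (D g) n  ∎
  where
  open ≡-Reasoning
  lem : ∀ i r a b → (i + r) * (a * b) ≡ i * a * b + a * (r * b)
  lem = solve-∀
  leibniz : ∀ i → i < suc n → n * (f i * g (n ∸ i)) ≡ i * f i * g (n ∸ i) + f i * ((n ∸ i) * g (n ∸ i))
  leibniz i i≤n = trans (cong (_* (f i * g (n ∸ i))) (sym (m+[n∸m]≡n (s≤s⁻¹ i≤n)))) (lem i (n ∸ i) (f i) _)

-- The share of the divisor d + 1 in σ(j + 1). The shift by one keeps every modulus nonzero and puts
-- the multiples of d + 1 at the last places of blocks of length d + 1.
divTerm : ℕ → ℕ → ℕ
divTerm d j = if suc j % suc d ≡ᵇ 0 then suc d else 0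

σ : ℕ → ℕ
σ zero    = 0
σ (suc j) = ∑ (suc j) (λ d → divTerm d j)

divTerm-0 : ∀ d j {r} → suc j % suc d ≡ suc r → divTerm d j ≡ 0
divTerm-0 d j eq rewrite eq = refl

divTerm-big : ∀ d j → j < d → divTerm d j ≡ 0
divTerm-big d j j<d = divTerm-0 d j (m<n⇒m%n≡m (s≤s j<d))

divTerm-block : ∀ d q t → t < d → divTerm d (q * suc d + t) ≡ 0
divTerm-block d q t t<d = divTerm-0 d (q * suc d + t) (begin
  suc (q * suc d + t) % suc d  ≡⟨ cong (_% suc d) (lem q d t) ⟩
  (suc t + q * suc d) % suc d  ≡⟨ [m+kn]%n≡m%n (suc t) q (suc d) ⟩
  suc t % suc d  ≡⟨ m<n⇒m%n≡m (s≤s t<d) ⟩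
  suc t  ∎)
  where
  open ≡-Reasoning
  lem : ∀ q d t → suc (q * suc d + t) ≡ suc t + q * suc d
  lem = solve-∀

divTerm-multiple : ∀ d q → divTerm d (q * suc d + d) ≡ suc d
divTerm-multiple d q = lem (begin
  suc (q * suc d + d) % suc d  ≡⟨ cong (_% suc d) (arith q d) ⟩
  (suc q * suc d) % suc d  ≡⟨ m*n%n≡0 (suc q) (suc d) ⟩
  0  ∎)
  where
  open ≡-Reasoning
  arith : ∀ q d → suc (q * suc d + d) ≡ suc q * suc d
  arith = solve-∀
  lem : suc (q * suc d + d) % suc d ≡ 0 → divTerm d (q * suc d + d) ≡ suc d
  lem eq rewrite eq = refl

-- Since f vanishes beyond M, the range may be stretched to whole blocks; of each block only the
-- last place survives.
∑-divTerm : ∀ M d (f : ℕ → ℕ) → (∀ j → M < j → f j ≡ 0) →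
  ∑ M (λ j → divTerm d j * f (suc j)) ≡ ∑ M (λ e → suc d * f (suc d * suc e))
∑-divTerm M d f f0 = begin
  ∑ M h  ≡⟨ ∑-extend h (m≤m*n M (suc d)) tail ⟨
  ∑ (M * suc d) h  ≡⟨ ∑-block M (suc d) h ⟩
  ∑ M (λ q → ∑ d (λ t → h (q * suc d + t)) + h (q * suc d + d)) ≡⟨ ∑-cong M block ⟩
  ∑ M (λ e → suc d * f (suc d * suc e))  ∎
  where
  open ≡-Reasoning
  h : ℕ → ℕ
  h j = divTerm d j * f (suc j)
  tail : ∀ i → M ≤ i → h i ≡ 0
  tail i M≤i = trans (cong (divTerm d i *_) (f0 (suc i) (s≤s M≤i))) (*-zeroʳ (divTerm d i))
  arith : ∀ q d → suc (q * suc d + d) ≡ suc d * suc q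
  arith = solve-∀
  block : ∀ q → ∑ d (λ t → h (q * suc d + t)) + h (q * suc d + d) ≡ suc d * f (suc d * suc q)
  block q = trans
    (cong (_+ h (q * suc d + d)) (∑-zero< d (λ t t<d → cong (_* f (suc (q * suc d + t))) (divTerm-block d q t t<d))))
    (cong₂ _*_ (divTerm-multiple d q) (cong f (arith q d)))

σ-∑ : ∀ M j → j < M → σ (suc j) ≡ ∑ M (λ d → divTerm d j)
σ-∑ M j j<M = sym (∑-extend _ j<M (λ d j<d → divTerm-big d j j<d))

-- Writes j = d e. The square range costs nothing, since f kills products beyond M, and it leaves
-- both orders of summation open: d outside for the logarithmic derivative, e outside for the
-- estimates.
σ-∑∑ : ∀ M (f : ℕ → ℕ) → (∀ j → M < j → f j ≡ 0) →
  ∑ M (λ j → σ (suc j) * f (suc j)) ≡ ∑ M (λ d → ∑ M (λ e → suc d * f (suc d * suc e)))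
σ-∑∑ M f f0 = begin
  ∑ M (λ j → σ (suc j) * f (suc j))
    ≡⟨ ∑-cong< M (λ j j<M → trans (cong (_* f (suc j)) (σ-∑ M j j<M)) (sym (∑-*ʳ M (f (suc j)) _))) ⟩
  ∑ M (λ j → ∑ M (λ d → divTerm d j * f (suc j)))  ≡⟨ ∑-swap M M _ ⟩
  ∑ M (λ d → ∑ M (λ j → divTerm d j * f (suc j)))  ≡⟨ ∑-cong M (λ d → ∑-divTerm M d f f0) ⟩
  ∑ M (λ d → ∑ M (λ e → suc d * f (suc d * suc e)))  ∎
  where open ≡-Reasoning

sumTo-head : ∀ n f → sumTo (suc n) f ≡ f 0 + sumTo n (λ i → f (suc i))
sumTo-head n f = trans (sumTo≡∑ (suc n) f) (trans (∑-head (suc n) f) (cong (f 0 +_) (sym (sumTo≡∑ n _))))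

sumTo-cong : ∀ n {f g : ℕ → ℕ} → (∀ i → f i ≡ g i) → sumTo n f ≡ sumTo n g
sumTo-cong zero    h = h 0
sumTo-cong (suc n) h = cong₂ _+_ (sumTo-cong n h) (h (suc n))

partsLE-small : ∀ m n → n < suc m → partsLE (suc m) n ≡ partsLE m n
partsLE-small m n n<m rewrite m<n⇒m/n≡0 n<m = refl

-- Either no part m + 1 occurs, or one such part is removed.
partsLE-step : ∀ m n → partsLE (suc m) (suc m + n) ≡ partsLE m (suc m + n) + partsLE (suc m) n
partsLE-step m n = begin
  sumTo ((suc m + n) / suc m) f  ≡⟨ cong (λ q → sumTo q f) (trans (+-distrib-/-∣ˡ {suc m} n ∣-refl) (cong (_+ n / suc m) (n/n≡1 (suc m)))) ⟩
  sumTo (suc (n / suc m)) f  ≡⟨ sumTo-head (n / suc m) f ⟩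
  f 0 + sumTo (n / suc m) (λ i → f (suc i)) ≡⟨ cong (f 0 +_) (sumTo-cong (n / suc m) (λ i → cong (partsLE m) ([m+n]∸[m+o]≡n∸o (suc m) n (i * suc m)))) ⟩
  f 0 + partsLE (suc m) n  ∎
  where
  open ≡-Reasoning
  f : ℕ → ℕ
  f i = partsLE m (suc m + n ∸ i * suc m)

partsLE-stable : ∀ m n → n ≤ m → partsLE m n ≡ p n
partsLE-stable m n n≤m with m≤n⇒m<n∨m≡n n≤m
... | inj₂ refl = refl
partsLE-stable (suc m) n n≤m | inj₁ n<m = trans (partsLE-small m n n<m) (partsLE-stable m n (s≤s⁻¹ n<m))

-- The coefficient of q^n in f(q) q^c / (1 - q^c), with c = d + 1.
∑rev : ℕ → (ℕ → ℕ) → ℕ → ℕ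
∑rev d f n = ∑ n (λ e → rev f n (suc d * suc e))

-- The logarithmic derivative of ∏_{d ≤ m} (1 − q^d)⁻¹.
partsLE-log : ∀ m n → n * partsLE m n ≡ ∑ m (λ d → suc d * ∑rev d (partsLE m) n)
partsLE-log zero    zero    = refl
partsLE-log zero    (suc n) = *-zeroʳ n
partsLE-log (suc m) n = go n (<-wellFounded n)
  where
  open ≡-Reasoning
  Q R : ℕ → ℕ
  Q = partsLE (suc m)
  R = partsLE m
  c = suc m
  rev-step : ∀ n j → rev Q (c + n) j ≡ rev R (c + n) j + rev Q n j
  rev-step n j with j ≤? n
  ... | yes j≤n with m≤n⇒∃[o]m+o≡n j≤n
  ...   | o , refl = begin
    rev Q (c + (j + o)) j  ≡⟨ cong (λ k → rev Q k j) (lem c j o) ⟩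
    rev Q (j + (c + o)) j  ≡⟨ rev-+ Q j (c + o) ⟩
    Q (c + o)  ≡⟨ partsLE-step m o ⟩
    R (c + o) + Q o  ≡⟨ cong₂ _+_ (rev-+ R j (c + o)) (rev-+ Q j o) ⟨
    rev R (j + (c + o)) j + rev Q (j + o) j ≡⟨ cong (λ k → rev R k j + rev Q (j + o) j) (lem c j o) ⟨
    rev R (c + (j + o)) j + rev Q (j + o) j ∎
    where
    lem : ∀ c j o → c + (j + o) ≡ j + (c + o)
    lem = solve-∀
  rev-step n j | no j≰n with j ≤? c + n
  ... | no j≰ = trans (rev-> Q _ j (≰⇒> j≰)) (sym (cong₂ _+_ (rev-> R _ j (≰⇒> j≰)) (rev-> Q n j (≰⇒> j≰n))))
  -- For n < j ≤ c + n the argument is below c, where Q and R agree.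
  ... | yes j≤ = trans (rev-∸ Q (c + n) j j≤) (trans (partsLE-small m _ small)
    (sym (trans (cong₂ _+_ (rev-∸ R (c + n) j j≤) (rev-> Q n j (≰⇒> j≰n))) (+-identityʳ _))))
    where
    small : c + n ∸ j < c
    small = +-cancelʳ-< j (c + n ∸ j) c (subst (_< c + j) (sym (m∸n+n≡m j≤)) (+-monoʳ-< c (≰⇒> j≰n)))
  ext : ∀ d f n {M} → n ≤ M → ∑ M (λ e → rev f n (suc d * suc e)) ≡ ∑rev d f n
  ext d f n n≤M = ∑-extend _ n≤M (λ e n≤e → rev-> f n _ (≤-trans (s≤s n≤e) (m≤m+n (suc e) (d * suc e))))
  ∑rev-step : ∀ d n → ∑rev d Q (c + n) ≡ ∑rev d R (c + n) + ∑rev d Q n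
  ∑rev-step d n = trans (trans (∑-cong (c + n) (λ e → rev-step n (suc d * suc e))) (∑-+ (c + n) _ _))
    (cong (∑rev d R (c + n) +_) (ext d Q n (m≤n+m n c)))
  ∑rev-top : ∀ n → ∑rev m Q (c + n) ≡ Q n + ∑rev m Q n
  ∑rev-top n = begin
    ∑ (c + n) (λ e → rev Q (c + n) (c * suc e))  ≡⟨ ∑-head (m + n) _ ⟩
    rev Q (c + n) (c * 1) + ∑ (m + n) (λ e → rev Q (c + n) (c * suc (suc e)))
      ≡⟨ cong₂ _+_ (trans (cong (rev Q (c + n)) (*-identityʳ c)) (rev-+ Q c n))
         (∑-cong (m + n) (λ e → trans (cong (rev Q (c + n)) (*-suc c (suc e))) (rev-shift Q c n (c * suc e)))) ⟩
    Q n + ∑ (m + n) (λ e → rev Q n (c * suc e))  ≡⟨ cong (Q n +_) (ext m Q n (m≤n+m n m)) ⟩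
    Q n + ∑rev m Q n  ∎
  go : ∀ n → Acc _<_ n → n * Q n ≡ ∑ (suc m) (λ d → suc d * ∑rev d Q n)
  go n (acc rs) with c ≤? n
  ... | no c≰n = begin
    n * Q n  ≡⟨ cong (n *_) (partsLE-small m n n<c) ⟩
    n * R n  ≡⟨ partsLE-log m n ⟩
    ∑ m (λ d → suc d * ∑rev d R n)  ≡⟨ ∑-cong m (λ d → cong (suc d *_) (∑-cong n (λ e → rev-cong n (suc d * suc e) (λ k k≤n → partsLE-small m k (≤-<-trans k≤n n<c))))) ⟨
    ∑ m (λ d → suc d * ∑rev d Q n)  ≡⟨ +-identityʳ _ ⟨
    ∑ m (λ d → suc d * ∑rev d Q n) + 0  ≡⟨ cong (∑ m (λ d → suc d * ∑rev d Q n) +_) (trans (cong (c *_) none) (*-zeroʳ c)) ⟨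
    ∑ m (λ d → suc d * ∑rev d Q n) + c * ∑rev m Q n  ∎
    where
    n<c : n < c
    n<c = ≰⇒> c≰n
    none : ∑rev m Q n ≡ 0
    none = ∑-zero< n (λ e _ → rev-> Q n _ (<-≤-trans n<c (m≤m*n c (suc e))))
  -- One part c is removed. In (c + o) Q(o) the share o Q(o) is the induction hypothesis, and c Q(o)
  -- is the first term split off by `∑rev-top`.
  ... | yes c≤n with m≤n⇒∃[o]m+o≡n c≤n
  ...   | o , refl = begin
    (c + o) * Q (c + o)  ≡⟨ cong ((c + o) *_) (partsLE-step m o) ⟩
    (c + o) * (R (c + o) + Q o)  ≡⟨ lem₁ c o (R (c + o)) (Q o) ⟩
    (c + o) * R (c + o) + (c * Q o + o * Q o)  ≡⟨ cong₂ (λ a b → a + (c * Q o + b)) (partsLE-log m (c + o)) (go o (rs (m<n+m o (s≤s z≤n)))) ⟩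
    ∑ m (λ d → suc d * ∑rev d R (c + o)) + (c * Q o + (∑ m (λ d → suc d * ∑rev d Q o) + c * ∑rev m Q o))
      ≡⟨ lem₂ (∑ m (λ d → suc d * ∑rev d R (c + o))) c (Q o) (∑ m (λ d → suc d * ∑rev d Q o)) (∑rev m Q o) ⟩
    ∑ m (λ d → suc d * ∑rev d R (c + o)) + ∑ m (λ d → suc d * ∑rev d Q o) + c * (Q o + ∑rev m Q o)
      ≡⟨ cong₂ _+_ (sym (∑-+ m _ _)) (cong (c *_) (sym (∑rev-top o))) ⟩
    ∑ m (λ d → suc d * ∑rev d R (c + o) + suc d * ∑rev d Q o) + c * ∑rev m Q (c + o)
      ≡⟨ cong (_+ c * ∑rev m Q (c + o)) (∑-cong m (λ d → trans (sym (*-distribˡ-+ (suc d) (∑rev d R (c + o)) _)) (cong (suc d *_) (sym (∑rev-step d o))))) ⟩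
    ∑ m (λ d → suc d * ∑rev d Q (c + o)) + c * ∑rev m Q (c + o) ∎
    where
    lem₁ : ∀ c o r q → (c + o) * (r + q) ≡ (c + o) * r + (c * q + o * q)
    lem₁ = solve-∀
    lem₂ : ∀ a c q b w → a + (c * q + (b + c * w)) ≡ a + b + c * (q + w)
    lem₂ = solve-∀

conv-σ : ∀ f n → conv σ f n ≡ ∑ n (λ j → σ (suc j) * rev f n (suc j))
conv-σ f n = trans (conv-∑ σ f n) (∑-head n _)

p-log : ∀ n → D p n ≡ conv σ p n
p-log n = begin
  n * p n  ≡⟨ partsLE-log n n ⟩
  ∑ n (λ d → suc d * ∑rev d (partsLE n) n)
    ≡⟨ ∑-cong n (λ d → trans (cong (suc d *_) (∑-cong n (λ e → rev-cong n (suc d * suc e) (λ k k≤n → partsLE-stable n k k≤n)))) (sym (∑-*ˡ n (suc d) _))) ⟩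
  ∑ n (λ d → ∑ n (λ e → suc d * rev p n (suc d * suc e)))  ≡⟨ σ-∑∑ n (rev p n) (rev-> p n) ⟨
  ∑ n (λ j → σ (suc j) * rev p n (suc j))  ≡⟨ conv-σ p n ⟨
  conv σ p n  ∎
  where open ≡-Reasoning

-- The logarithmic derivative of a k-th power is k times that of the factor: `D` is a derivation,
-- and convolution is associative and commutative.
pk-log : ∀ k n → D (pk k) n ≡ k * conv σ (pk k) n
pk-log zero    zero    = refl
pk-log zero    (suc n) = *-zeroʳ n
pk-log (suc k) n = begin
  D (conv p (pk k)) n  ≡⟨ D-conv p (pk k) n ⟩
  conv (D p) (pk k) n + conv p (D (pk k)) n  ≡⟨ cong₂ _+_ left right ⟩
  conv σ (conv p (pk k)) n + k * conv σ (conv p (pk k)) n  ∎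
  where
  open ≡-Reasoning
  left : conv (D p) (pk k) n ≡ conv σ (conv p (pk k)) n
  left = trans (conv-cong {g = pk k} n p-log (λ _ → refl)) (conv-assoc σ p (pk k) n)
  scale : ∀ g → conv p (λ i → k * g i) n ≡ k * conv p g n
  scale g = trans (sumTo≡∑ n _) (trans (∑-cong (suc n) (λ i → lem (p i) k (g (n ∸ i))))
    (trans (∑-*ˡ (suc n) k _) (cong (k *_) (sym (sumTo≡∑ n _)))))
    where
    lem : ∀ a k b → a * (k * b) ≡ k * (a * b)
    lem = solve-∀
  right : conv p (D (pk k)) n ≡ k * conv σ (conv p (pk k)) n
  right = trans (conv-cong {p} n (λ _ → refl) (pk-log k))
    (trans (scale (conv σ (pk k))) (cong (k *_) (conv-left-comm p σ (pk k) n)))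

-- Convexity of p_k

partsLE-one : ∀ n → partsLE 1 n ≡ 1
partsLE-one zero    = refl
partsLE-one (suc n) = trans (partsLE-step 0 n) (partsLE-one n)

partsLE-mono : ∀ m n → partsLE (suc m) n ≤ partsLE (suc m) (suc n)
partsLE-mono zero    n = ≤-reflexive (trans (partsLE-one n) (sym (partsLE-one (suc n))))
partsLE-mono (suc m) n = go n (<-wellFounded n)
  where
  c = suc (suc m)
  go : ∀ n → Acc _<_ n → partsLE c n ≤ partsLE c (suc n)
  go n (acc rs) with c ≤? n
  ... | yes c≤n with m≤n⇒∃[o]m+o≡n c≤n
  ...   | o , refl = begin
    partsLE c (c + o)  ≡⟨ partsLE-step (suc m) o ⟩
    partsLE (suc m) (c + o) + partsLE c o  ≤⟨ +-mono-≤ (partsLE-mono m (c + o)) (go o (rs (m<n+m o (s≤s z≤n)))) ⟩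
    partsLE (suc m) (suc (c + o)) + partsLE c (suc o) ≡⟨ cong (λ k → partsLE (suc m) k + partsLE c (suc o)) (+-suc c o) ⟨
    partsLE (suc m) (c + suc o) + partsLE c (suc o) ≡⟨ partsLE-step (suc m) (suc o) ⟨
    partsLE c (c + suc o)  ≡⟨ cong (partsLE c) (+-suc c o) ⟩
    partsLE c (suc (c + o))  ∎
    where open ≤-Reasoning
  go n (acc rs) | no c≰n with suc n <? c
  ... | yes n<c = begin
    partsLE c n  ≡⟨ partsLE-small (suc m) n (≰⇒> c≰n) ⟩
    partsLE (suc m) n  ≤⟨ partsLE-mono m n ⟩
    partsLE (suc m) (suc n) ≡⟨ partsLE-small (suc m) (suc n) n<c ⟨
    partsLE c (suc n)  ∎
    where open ≤-Reasoning
  -- Here n + 1 = c: the larger argument gains the partition into a single part c.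
  ... | no n≮c = begin
    partsLE c n  ≡⟨ partsLE-small (suc m) n (≰⇒> c≰n) ⟩
    partsLE (suc m) n  ≤⟨ partsLE-mono m n ⟩
    partsLE (suc m) (suc n)  ≡⟨ cong (partsLE (suc m)) eq ⟩
    partsLE (suc m) (c + 0)  ≤⟨ m≤m+n _ _ ⟩
    partsLE (suc m) (c + 0) + partsLE c 0  ≡⟨ partsLE-step (suc m) 0 ⟨
    partsLE c (c + 0)  ≡⟨ cong (partsLE c) eq ⟨
    partsLE c (suc n)  ∎
    where
    open ≤-Reasoning
    eq : suc n ≡ c + 0
    eq = trans (≤-antisym (≰⇒> c≰n) (≮⇒≥ n≮c)) (sym (+-identityʳ c))

p-mono : ∀ n → p n ≤ p (suc n)
p-mono n = ≤-trans (≤-reflexive (sym (partsLE-stable (suc n) n (n≤1+n n)))) (partsLE-mono n n)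

-- Coefficients of (1 - q) times the generating function of p; they count partitions without parts
-- of size 1. The value at 0 reflects p(-1) = 0.
Δp : ℕ → ℕ
Δp zero    = 1
Δp (suc n) = p (suc n) ∸ p n

one : ℕ → ℕ
one _ = 1

conv-one : ∀ f n → conv one f n ≡ ∑ (suc n) f
conv-one f n = trans (conv-comm one f n) (trans (sumTo≡∑ n _) (∑-cong (suc n) (λ i → *-identityʳ (f i))))

p≡conv-one : ∀ n → p n ≡ conv one Δp n
p≡conv-one n = trans (sym (telescope n)) (sym (conv-one Δp n))
  where
  telescope : ∀ n → ∑ (suc n) Δp ≡ p n
  telescope zero    = refl
  telescope (suc n) = trans (cong (_+ Δp (suc n)) (telescope n)) (m+[n∸m]≡n (p-mono n))

Δ²pk : ℕ → ℕ → ℕ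
Δ²pk k = conv Δp (conv Δp (pk k))

Δpk : ℕ → ℕ → ℕ
Δpk k n = ∑ (suc n) (Δ²pk k)

-- Two of the k + 2 factors are written as 1/(1 - q) times the series of `Δp`. Hence (1 - q)² times
-- the generating function has nonnegative coefficients `Δ²pk`, which is convexity.
pk-∑ : ∀ k n → pk (2 + k) n ≡ ∑ (suc n) (Δpk k)
pk-∑ k n = begin
  conv p (conv p (pk k)) n  ≡⟨ conv-cong {p} n (λ _ → refl) (λ i → factor (pk k) i) ⟩
  conv p (conv one (conv Δp (pk k))) n  ≡⟨ conv-left-comm p one (conv Δp (pk k)) n ⟩
  conv one (conv p (conv Δp (pk k))) n  ≡⟨ conv-one _ n ⟩
  ∑ (suc n) (conv p (conv Δp (pk k)))  ≡⟨ ∑-cong (suc n) (λ i → trans (factor (conv Δp (pk k)) i) (conv-one _ i)) ⟩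
  ∑ (suc n) (Δpk k)  ∎
  where
  open ≡-Reasoning
  factor : ∀ g n → conv p g n ≡ conv one (conv Δp g) n
  factor g n = trans (conv-cong {g = g} n p≡conv-one (λ _ → refl)) (conv-assoc one Δp g n)

pk-0 : ∀ k → pk k 0 ≡ 1
pk-0 zero    = refl
pk-0 (suc k) = trans (+-identityʳ (pk k 0)) (pk-0 k)

-- Convexity includes the position 0, with P (−1) read as 0.
record Convex (P : ℕ → ℕ) : Set where
  field
    Δ       : ℕ → ℕ
    P-0     : P 0 ≡ Δ 0
    P-suc   : ∀ n → P (suc n) ≡ P n + Δ (suc n)
    Δ-mono  : ∀ n → Δ n ≤ Δ (suc n)

  rev-P : ∀ n j → rev P n j ≡ rev P n (suc j) + rev Δ n j
  rev-P zero    zero    = P-0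
  rev-P (suc n) zero    = P-suc n
  rev-P zero    (suc j) = refl
  rev-P (suc n) (suc j) = rev-P n j

  rev-Δ : ∀ n j → rev Δ n (suc j) ≤ rev Δ n j
  rev-Δ zero    zero    = z≤n
  rev-Δ zero    (suc j) = z≤n
  rev-Δ (suc n) zero    = Δ-mono n
  rev-Δ (suc n) (suc j) = rev-Δ n j

pk-convex : ∀ k → Convex (pk (2 + k))
pk-convex k = record
  { Δ      = Δpk k
  ; P-0    = pk-∑ k 0
  ; P-suc  = λ n → trans (pk-∑ k (suc n)) (cong (_+ Δpk k (suc n)) (sym (pk-∑ k n)))
  ; Δ-mono = λ n → m≤m+n _ _
  }

-- Sums weighted by σ

Antitone : (ℕ → ℕ) → Set
Antitone z = ∀ l → z (suc l) ≤ z l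

antitone : ∀ {z} → Antitone z → ∀ {l m} → l ≤ m → z m ≤ z l
antitone {z} h l≤m with m≤n⇒∃[o]m+o≡n l≤m
... | o , refl = go o
  where
  go : ∀ {l} o → z (l + o) ≤ z l
  go {l} zero    = ≤-reflexive (cong z (+-identityʳ l))
  go {l} (suc o) = ≤-trans (≤-reflexive (cong z (+-suc l o))) (≤-trans (h (l + o)) (go o))

-- A value s < B arises as d + l from s + 1 pairs.
∑-diag-tri : ∀ B (h : ℕ → ℕ) → ∑ B (λ d → ∑ (B ∸ d) (λ l → h (d + l))) ≡ ∑ B (λ s → suc s * h s)
∑-diag-tri zero    h = refl
∑-diag-tri (suc B) h = begin
  ∑ B (λ d → ∑ (suc B ∸ d) (λ l → h (d + l))) + ∑ (suc B ∸ B) (λ l → h (B + l))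
    ≡⟨ cong₂ _+_ (∑-cong< B row) corner ⟩
  ∑ B (λ d → ∑ (B ∸ d) (λ l → h (d + l)) + h B) + h B
    ≡⟨ cong (_+ h B) (trans (∑-+ B _ _) (cong₂ _+_ (∑-diag-tri B h) (∑-const B (h B)))) ⟩
  ∑ B (λ s → suc s * h s) + B * h B + h B  ≡⟨ +-assoc (∑ B (λ s → suc s * h s)) (B * h B) (h B) ⟩
  ∑ B (λ s → suc s * h s) + (B * h B + h B) ≡⟨ cong (∑ B (λ s → suc s * h s) +_) (+-comm (B * h B) (h B)) ⟩
  ∑ B (λ s → suc s * h s) + suc B * h B  ∎
  where
  open ≡-Reasoning
  row : ∀ d → d < B → ∑ (suc B ∸ d) (λ l → h (d + l)) ≡ ∑ (B ∸ d) (λ l → h (d + l)) + h B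
  row d d<B rewrite +-∸-assoc 1 (<⇒≤ d<B) = cong (λ k → ∑ (B ∸ d) (λ l → h (d + l)) + h k) (m+[n∸m]≡n (<⇒≤ d<B))
  corner : ∑ (suc B ∸ B) (λ l → h (B + l)) ≡ h B
  corner rewrite m+n∸n≡m 1 B = cong h (+-identityʳ B)

∑-diag : ∀ B (h : ℕ → ℕ) → (∀ s → B ≤ s → h s ≡ 0) →
  ∑ B (λ d → ∑ B (λ l → h (d + l))) ≡ ∑ B (λ s → suc s * h s)
∑-diag B h h0 = trans
  (∑-cong B (λ d → ∑-extend _ (m∸n≤m B d) (λ i B∸d≤i → h0 (d + i) (≤-trans (m≤n+m∸n B d) (+-monoʳ-≤ d B∸d≤i)))))
  (∑-diag-tri B h)

module ConvexSeq (f : ℕ → ℕ) (convex : ∀ j → 2 * f (suc j) ≤ f j + f (2 + j)) where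

  increments : ∀ x s → f (suc x) + f (x + s) ≤ f x + f (suc (x + s))
  increments x zero    = ≤-reflexive (trans (cong (λ k → f (suc x) + f k) (+-identityʳ x))
    (trans (+-comm (f (suc x)) (f x)) (cong (λ k → f x + f (suc k)) (sym (+-identityʳ x)))))
  increments x (suc s) rewrite +-suc x s =
    ≤-cert 0 (+-mono-≤ (increments x s) (convex (x + s)))
      (lem (f x) (f (suc x)) (f (x + s)) (f (suc (x + s))) (f (2 + (x + s))))
    where
    lem : ∀ a b c d e → b + d + (a + d + (c + e)) + 0 ≡ a + e + (b + c + 2 * d)
    lem = solve-∀

  midpoint : ∀ z s → 2 * f (z + s) ≤ f z + f (z + s + s)
  midpoint z zero    rewrite +-identityʳ z | +-identityʳ z = ≤-reflexive (cong (f z +_) (+-identityʳ (f z)))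
  midpoint z (suc s) = begin
    2 * f (z + suc s)  ≡⟨ cong (λ k → 2 * f k) (+-suc z s) ⟩
    2 * f (suc z + s)  ≤⟨ midpoint (suc z) s ⟩
    f (suc z) + f (suc z + s + s)  ≡⟨ cong (λ k → f (suc z) + f k) (lem₁ z s) ⟩
    f (suc z) + f (z + suc (s + s))  ≤⟨ increments z (suc (s + s)) ⟩
    f z + f (suc (z + suc (s + s)))  ≡⟨ cong (λ k → f z + f k) (lem₂ z s) ⟩
    f z + f (z + suc s + suc s)  ∎
    where
    open ≤-Reasoning
    lem₁ : ∀ z s → suc z + s + s ≡ z + suc (s + s)
    lem₁ = solve-∀
    lem₂ : ∀ z s → suc (z + suc (s + s)) ≡ z + suc s + suc s
    lem₂ = solve-∀

  -- Reversing one coordinate turns the arguments into y + t + (e - t′), and then a place of the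
  -- grid and its transpose have mean y + e. Midpoint convexity is summed over all such pairs, which
  -- counts every place twice.
  square : ∀ e y → e * e * f (y + e) ≤ ∑ e (λ t → ∑ e (λ t′ → f (suc (y + t + t′))))
  square e y = *-cancelˡ-≤ 2 (begin
    2 * (e * e * f (y + e))  ≡⟨ lem e (f (y + e)) ⟩
    e * (e * (2 * f (y + e)))  ≡⟨ trans (∑-cong e (λ _ → ∑-const e (2 * f (y + e)))) (∑-const e (e * (2 * f (y + e)))) ⟨
    ∑ e (λ _ → ∑ e (λ _ → 2 * f (y + e)))  ≤⟨ ∑-mono< e (λ t t<e → ∑-mono< e (λ t′ t′<e → pair t t′ t<e t′<e)) ⟩
    ∑ e (λ t → ∑ e (λ t′ → h t t′ + h t′ t))  ≡⟨ trans (∑-cong e (λ t → ∑-+ e (h t) _)) (∑-+ e _ _) ⟩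
    ∑ e (λ t → ∑ e (h t)) + ∑ e (λ t → ∑ e (λ t′ → h t′ t))  ≡⟨ cong (∑ e (λ t → ∑ e (h t)) +_) (∑-swap e e (λ t t′ → h t′ t)) ⟩
    ∑ e (λ t → ∑ e (h t)) + ∑ e (λ t → ∑ e (h t))  ≡⟨ cong (∑ e (λ t → ∑ e (h t)) +_) (+-identityʳ _) ⟨
    2 * ∑ e (λ t → ∑ e (h t))  ≡⟨ cong (2 *_) (∑-cong e row) ⟨
    2 * ∑ e (λ t → ∑ e (λ t′ → f (suc (y + t + t′))))  ∎)
    where
    open ≤-Reasoning
    h : ℕ → ℕ → ℕ
    h t t′ = f (y + t + (e ∸ t′))
    lem : ∀ e a → 2 * (e * e * a) ≡ e * (e * (2 * a))
    lem = solve-∀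
    row : ∀ t → ∑ e (λ t′ → f (suc (y + t + t′))) ≡ ∑ e (h t)
    row t = trans (∑-rev e _) (∑-cong< e (λ t′ t′<e → cong f
      (trans (sym (+-suc (y + t) (e ∸ suc t′))) (cong (y + t +_) (sym (+-∸-assoc 1 t′<e))))))
    ordered : ∀ t s r → e ≡ t + s + r → 2 * f (y + e) ≤ h t (t + s) + h (t + s) t
    ordered t s r refl = ≤-trans (≤-reflexive (cong (λ k → 2 * f k) (lem₁ y t s r)))
      (≤-trans (midpoint (y + t + r) s) (≤-reflexive (cong₂ (λ a b → f a + f b)
        (cong (y + t +_) (sym (m+n∸m≡n (t + s) r)))
        (trans (lem₂ y t s r) (cong (y + (t + s) +_) (sym (trans (cong (_∸ t) (+-assoc t s r)) (m+n∸m≡n t (s + r)))))))))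
      where
      lem₁ : ∀ y t s r → y + (t + s + r) ≡ y + t + r + s
      lem₁ = solve-∀
      lem₂ : ∀ y t s r → y + t + r + s + s ≡ y + (t + s) + (s + r)
      lem₂ = solve-∀
    pair : ∀ t t′ → t < e → t′ < e → 2 * f (y + e) ≤ h t t′ + h t′ t
    pair t t′ t<e t′<e with ≤-total t t′
    ... | inj₁ t≤t′ with m≤n⇒∃[o]m+o≡n t≤t′ | m≤n⇒∃[o]m+o≡n (<⇒≤ t′<e)
    ...   | s , refl | r , eq = ordered t s r (sym eq)
    pair t t′ t<e t′<e | inj₂ t′≤t with m≤n⇒∃[o]m+o≡n t′≤t | m≤n⇒∃[o]m+o≡n (<⇒≤ t<e)
    ...   | s , refl | r , eq = ≤-trans (ordered t′ s r (sym eq)) (≤-reflexive (+-comm (h t′ (t′ + s)) _))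

-- Sampling a convex sequence along multiples of c: by blocks of length c the right-hand side is a sum of
-- S (1 + t + t′ + d c) over t, t′ < c, whose arguments average to (d + 1) c.
convex-sample : ∀ (f : ℕ → ℕ) B c′ → let c = suc c′ in
  (∀ j → 2 * f (suc j) ≤ f j + f (2 + j)) → (∀ j → B < j → f j ≡ 0) →
  c * c * ∑ B (λ d → suc d * f (suc d * c)) ≤ ∑ B (λ d → suc d * f (suc d))
convex-sample f B c′ convex f0 = begin
  c * c * ∑ B (λ d → suc d * f (suc d * c))
    ≡⟨ cong (c * c *_) (∑-diag B (λ d → f (suc d * c)) (λ s B≤s → f0 _ (≤-trans (s≤s B≤s) (m≤m*n (suc s) c)))) ⟨
  c * c * ∑ B (λ d → ∑ B (λ l → f (suc (d + l) * c)))
    ≡⟨ cong (c * c *_) (∑-cong B (λ d → ∑-cong B (λ l → cong f (lem₁ d l c)))) ⟩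
  c * c * ∑ B (λ d → S (d * c + c))
    ≡⟨ ∑-*ˡ B (c * c) _ ⟨
  ∑ B (λ d → c * c * S (d * c + c))
    ≤⟨ ∑-mono B (λ d → ConvexSeq.square S S-convex c (d * c)) ⟩
  ∑ B (λ d → ∑ c (λ t → ∑ c (λ t′ → S (suc (d * c + t + t′)))))
    ≡⟨ ∑-cong B (λ d → ∑-cong c (λ t → Φ-blocks (suc (d * c + t)))) ⟨
  ∑ B (λ d → ∑ c (λ t → Φ (suc (d * c + t))))
    ≡⟨ ∑-block B c (λ x → Φ (suc x)) ⟨
  ∑ (B * c) (λ x → Φ (suc x))
    ≡⟨ ∑-diag (B * c) (λ d → f (suc d)) (λ s Bc≤s → f0 _ (s≤s (≤-trans (m≤m*n B c) Bc≤s))) ⟩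
  ∑ (B * c) (λ d → suc d * f (suc d))
    ≡⟨ ∑-extend _ (m≤m*n B c) (λ s B≤s → trans (cong (suc s *_) (f0 _ (s≤s B≤s))) (*-zeroʳ (suc s))) ⟩
  ∑ B (λ d → suc d * f (suc d)) ∎
  where
  open ≤-Reasoning
  c = suc c′
  S Φ : ℕ → ℕ
  S x = ∑ B (λ l → f (x + l * c))
  Φ y = ∑ (B * c) (λ j → f (y + j))
  lem₁ : ∀ d l c → suc (d + l) * c ≡ d * c + c + l * c
  lem₁ = solve-∀
  S-convex : ∀ j → 2 * S (suc j) ≤ S j + S (2 + j)
  S-convex j = ≤-trans (≤-reflexive (sym (∑-*ˡ B 2 _)))
    (≤-trans (∑-mono B (λ l → convex (j + l * c))) (≤-reflexive (∑-+ B _ _)))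
  Φ-blocks : ∀ y → Φ y ≡ ∑ c (λ t′ → S (y + t′))
  Φ-blocks y = trans (∑-block B c (λ j → f (y + j))) (trans (∑-swap B c _)
    (∑-cong c (λ t′ → ∑-cong B (λ l → cong f (lem₂ y l c t′)))))
    where
    lem₂ : ∀ y l c t → y + (l * c + t) ≡ y + t + l * c
    lem₂ = solve-∀

-- ∑ 1/e² ≤ 1 + 1/4 + ∑_{e ≥ 3} (1/(e − ½) − 1/(e + ½)) = 33/20
∑-inverse-squares : ∀ n (b : ℕ → ℕ) V → (∀ e → suc e * suc e * b e ≤ V) → 20 * ∑ n b ≤ 33 * V
∑-inverse-squares zero          b V h = z≤n
∑-inverse-squares (suc zero)    b V h = ≤-cert (13 * V) (*-monoʳ-≤ 20 (h 0)) (lem (b 0) V)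
  where
  lem : ∀ b V → 20 * (0 + b) + 20 * V + 13 * V ≡ 33 * V + 20 * (1 * 1 * b)
  lem = solve-∀
∑-inverse-squares (suc (suc n)) b V h = *-cancelˡ-≤ (5 + 2 * n) (≤-cert (40 * V) (claim n) (lem n (∑ (2 + n) b) V))
  where
  lem : ∀ n S V → (5 + 2 * n) * (20 * S) + 33 * (5 + 2 * n) * V + 40 * V ≡ (5 + 2 * n) * (33 * V) + (20 * (5 + 2 * n) * S + 40 * V)
  lem = solve-∀
  -- The invariant keeps the tail 1/(n + 5/2) of the telescoping series in reserve: the first n + 2
  -- terms are at most 33/20 - 2/(2n + 5) times V.
  claim : ∀ n → 20 * (5 + 2 * n) * ∑ (2 + n) b + 40 * V ≤ 33 * (5 + 2 * n) * V
  claim zero    = ≤-cert 0 (+-mono-≤ (*-monoʳ-≤ 100 (h 0)) (*-monoʳ-≤ 25 (h 1))) (lem₁ (b 0) (b 1) V)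
    where
    lem₁ : ∀ b b′ V → 20 * (5 + 2 * 0) * (0 + b + b′) + 40 * V + (100 * V + 25 * V) + 0 ≡
      33 * (5 + 2 * 0) * V + (100 * (1 * 1 * b) + 25 * (2 * 2 * b′))
    lem₁ = solve-∀
  claim (suc n) = *-cancelˡ-≤ (5 + 2 * n) (≤-cert (20 * b (2 + n))
    (+-mono-≤ (*-monoʳ-≤ (7 + 2 * n) (claim n)) (*-monoʳ-≤ 80 (h (2 + n)))) (lem₂ n (∑ (2 + n) b) (b (2 + n)) V))
    where
    lem₂ : ∀ n S b V →
      (5 + 2 * n) * (20 * (5 + 2 * (1 + n)) * (S + b) + 40 * V) +
        ((7 + 2 * n) * (33 * (5 + 2 * n) * V) + 80 * V) + 20 * b ≡
      (5 + 2 * n) * (33 * (5 + 2 * (1 + n)) * V) +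
        ((7 + 2 * n) * (20 * (5 + 2 * n) * S + 40 * V) + 80 * ((3 + n) * (3 + n) * b))
    lem₂ = solve-∀

-- The summatory divisor function, of order i log i.
∑quot : ℕ → ℕ
∑quot i = ∑ i (λ e → i / suc e)

-- 2^t - 1, by a recursion that fits the dyadic blocks of `∑quot-≤`.
mersenne : ℕ → ℕ
mersenne zero    = 0
mersenne (suc t) = mersenne t + suc (mersenne t)

-- The 2^t divisors from 2^t to 2^(t+1) - 1 have quotients at most i / 2^t, so every dyadic block
-- contributes at most i.
∑quot-≤ : ∀ t i → i ≤ mersenne t → ∑quot i ≤ t * i
∑quot-≤ t i i≤T = ≤-trans (∑-prefix _ i≤T) (go t)
  where
  open ≤-Reasoning
  go : ∀ t → ∑ (mersenne t) (λ e → i / suc e) ≤ t * i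
  go zero    = z≤n
  go (suc t) = begin
    ∑ (mersenne t + suc (mersenne t)) (λ e → i / suc e)  ≡⟨ ∑-split (mersenne t) (suc (mersenne t)) _ ⟩
    ∑ (mersenne t) (λ e → i / suc e) + ∑ (suc (mersenne t)) (λ l → i / suc (mersenne t + l))
      ≤⟨ +-mono-≤ (go t) (∑-mono (suc (mersenne t)) (λ l → /-monoʳ-≤ i (s≤s (m≤m+n (mersenne t) l)))) ⟩
    t * i + ∑ (suc (mersenne t)) (λ _ → i / suc (mersenne t)) ≡⟨ cong (t * i +_) (∑-const (suc (mersenne t)) _) ⟩
    t * i + suc (mersenne t) * (i / suc (mersenne t))  ≤⟨ +-monoʳ-≤ (t * i) (≤-trans (≤-reflexive (*-comm (suc (mersenne t)) _)) (m/n*n≤m i (suc (mersenne t)))) ⟩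
    t * i + i  ≡⟨ +-comm (t * i) i ⟩
    suc t * i  ∎

-- Write σ(j) as a sum over j = d e. For each e the first multiple of e beyond i is estimated separately, and the later
-- ones, with d = ⌊i/e⌋ + 1 + d′, are moved down to z (d′ e).
module ShiftedSigma (z : ℕ → ℕ) (z↓ : Antitone z) (M : ℕ) (z0 : ∀ l → M ≤ l → z l ≡ 0) (i′ : ℕ) where

  private
    i = suc i′
    B = suc i + M
    Z = ∑ M z

    -- z moved to start at i + 1, so that the shifted sum becomes a complete σ-weighted sum and
    -- splits over j = d e.
    f : ℕ → ℕ
    f j with suc i ≤? j
    ... | yes _ = z (j ∸ suc i)
    ... | no  _ = 0

    f-≤ : ∀ j l → suc i + l ≤ j → f j ≤ z l
    f-≤ j l h with suc i ≤? j
    ... | yes _ = antitone z↓ (≤-trans (≤-reflexive (sym (m+n∸m≡n (suc i) l))) (∸-monoˡ-≤ (suc i) h))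
    ... | no  _ = z≤n

    f-low : ∀ j → j ≤ i → f j ≡ 0
    f-low j j≤i with suc i ≤? j
    ... | yes i<j = contradiction i<j (≤⇒≯ j≤i)
    ... | no  _   = refl

    f-shift : ∀ l → f (suc (i + l)) ≡ z l
    f-shift l with suc i ≤? suc (i + l)
    ... | yes _ = cong z (m+n∸m≡n i l)
    ... | no  h = contradiction (s≤s (m≤m+n i l)) h

    f-high : ∀ j → B < j → f j ≡ 0
    f-high j B<j with suc i ≤? j
    ... | yes _ = z0 _ (≤-trans (≤-reflexive (sym (m+n∸m≡n (suc i) M))) (∸-monoˡ-≤ (suc i) (<⇒≤ B<j)))
    ... | no  _ = refl

    z-sum : ∀ N → M ≤ N → ∑ N z ≡ Z
    z-sum N M≤N = ∑-extend z M≤N z0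

    W : ℕ → ℕ
    W e = ∑ B (λ d → z (suc d * suc e))

    M≤B : M ≤ B
    M≤B = m≤n+m M (suc i)

    -- As z is antitone, a sample at the end of a block of length e + 1 is at most the mean over the
    -- block.
    W-≤ : ∀ e → suc e * W e ≤ Z
    W-≤ e = begin
      suc e * W e  ≡⟨ ∑-*ˡ B (suc e) _ ⟨
      ∑ B (λ d → suc e * z (suc d * suc e))  ≡⟨ ∑-cong B (λ d → ∑-const (suc e) _) ⟨
      ∑ B (λ d → ∑ (suc e) (λ _ → z (suc d * suc e)))  ≤⟨ ∑-mono B (λ d → ∑-mono< (suc e) (λ t t<e → antitone z↓ (arg d t t<e))) ⟩
      ∑ B (λ d → ∑ (suc e) (λ t → z (d * suc e + t)))  ≡⟨ ∑-block B (suc e) z ⟨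
      ∑ (B * suc e) z  ≡⟨ z-sum _ (≤-trans M≤B (m≤m*n B (suc e))) ⟩
      Z  ∎
      where
      open ≤-Reasoning
      arg : ∀ d t → t < suc e → d * suc e + t ≤ suc d * suc e
      arg d t t<e = ≤-trans (+-monoʳ-≤ (d * suc e) (<⇒≤ t<e)) (≤-reflexive (+-comm (d * suc e) (suc e)))

    q : ℕ → ℕ
    q e = i / suc e

    q-low : ∀ e → q e * suc e ≤ i
    q-low e = m/n*n≤m i (suc e)

    q-high : ∀ e → suc i ≤ suc (q e) * suc e
    q-high e = ≤-trans (s≤s (≤-reflexive (m≡m%n+[m/n]*n i (suc e)))) (+-monoˡ-≤ (q e * suc e) (m%n<n i (suc e)))

    head : ℕ → ℕ
    head e = suc (q e) * f (suc (q e) * suc e)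

    row-≤ : ∀ e → ∑ B (λ d → suc d * f (suc d * suc e)) ≤
      head e + (q e * W e + ∑ B (λ d → (2 + d) * z (suc d * suc e)))
    row-≤ e with m≤n⇒∃[o]m+o≡n (≤-trans (s≤s (m/n≤m i (suc e))) (m≤m+n (suc i) M))
    ... | r , eq = begin
      ∑ B g  ≡⟨ cong (λ N → ∑ N g) (trans (sym eq) (sym (+-suc (q e) r))) ⟩
      ∑ (q e + suc r) g  ≡⟨ ∑-pad (q e) (suc r) g (λ d d<q → trans (cong (suc d *_) (f-low _ (≤-trans (*-monoˡ-≤ (suc e) d<q) (q-low e)))) (*-zeroʳ (suc d))) ⟩
      ∑ (suc r) (λ d → g (q e + d))  ≡⟨ ∑-head r _ ⟩
      g (q e + 0) + ∑ r (λ d → g (q e + suc d))  ≤⟨ +-mono-≤ (≤-reflexive (cong g (+-identityʳ (q e)))) (∑-mono r later) ⟩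
      head e + ∑ r (λ d → q e * z (suc d * suc e) + (2 + d) * z (suc d * suc e)) ≤⟨ +-monoʳ-≤ (head e) (∑-prefix _ (≤-trans (m≤n+m r (suc (q e))) (≤-reflexive eq))) ⟩
      head e + ∑ B (λ d → q e * z (suc d * suc e) + (2 + d) * z (suc d * suc e)) ≡⟨ cong (head e +_) (trans (∑-+ B _ _) (cong (_+ ∑ B (λ d → (2 + d) * z (suc d * suc e))) (∑-*ˡ B (q e) _))) ⟩
      head e + (q e * W e + ∑ B (λ d → (2 + d) * z (suc d * suc e))) ∎
      where
      open ≤-Reasoning
      g : ℕ → ℕ
      g d = suc d * f (suc d * suc e)
      later : ∀ d → g (q e + suc d) ≤ q e * z (suc d * suc e) + (2 + d) * z (suc d * suc e)
      later d = ≤-trans (*-monoʳ-≤ (suc (q e + suc d)) (f-≤ _ (suc d * suc e) (begin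
        suc i + suc d * suc e  ≤⟨ +-monoˡ-≤ (suc d * suc e) (q-high e) ⟩
        suc (q e) * suc e + suc d * suc e  ≡⟨ *-distribʳ-+ (suc e) (suc (q e)) (suc d) ⟨
        suc (q e + suc d) * suc e  ∎)))
        (≤-reflexive (lem (q e) d (z (suc d * suc e))))
        where
        lem : ∀ q d a → suc (q + suc d) * a ≡ q * a + (2 + d) * a
        lem = solve-∀

    -- For a divisor up to i the value at its first multiple beyond i is only known to be at most z
    -- 0. A divisor above i is its own first multiple; these land on distinct places and total at
    -- most Z.
    heads-≤ : ∑ B head ≤ (∑quot i + i) * z 0 + Z
    heads-≤ = begin
      ∑ B head  ≡⟨ cong (λ N → ∑ N head) (sym (+-suc i M)) ⟩
      ∑ (i + suc M) head  ≡⟨ ∑-split i (suc M) head ⟩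
      ∑ i head + ∑ (suc M) (λ e → head (i + e))  ≤⟨ +-mono-≤ (∑-mono i near) (∑-mono (suc M) far) ⟩
      ∑ i (λ e → suc (q e) * z 0) + ∑ (suc M) z  ≡⟨ cong₂ _+_ (∑-*ʳ i (z 0) _) (z-sum (suc M) (n≤1+n M)) ⟩
      ∑ i (λ e → suc (q e)) * z 0 + Z  ≡⟨ cong (λ s → s * z 0 + Z) (trans (∑-+ i (λ _ → 1) q) (trans (cong (_+ ∑ i q) (trans (∑-const i 1) (*-identityʳ i))) (+-comm i _))) ⟩
      (∑quot i + i) * z 0 + Z  ∎
      where
      open ≤-Reasoning
      near : ∀ e → head e ≤ suc (q e) * z 0
      near e = *-monoʳ-≤ (suc (q e)) (f-≤ _ 0 (≤-trans (≤-reflexive (+-identityʳ (suc i))) (q-high e)))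
      far : ∀ e → head (i + e) ≤ z e
      far e rewrite m<n⇒m/n≡0 (s≤s (m≤m+n i e)) = ≤-trans (≤-reflexive (+-identityʳ _)) (f-≤ _ e (≤-reflexive (sym (+-identityʳ (suc (i + e))))))

    -- For the divisor e, ⌊i/e⌋ ≤ i/e and W ≤ Z/e, so the weights add up to ∑ 1/e²: here the mean
    -- order ζ(2) j of σ enters.
    quot-part : 20 * ∑ B (λ e → q e * W e) ≤ 33 * (i * Z)
    quot-part = ∑-inverse-squares B _ (i * Z) (λ e → ≤-trans (≤-reflexive (lem (suc e) (q e) (W e))) (*-mono-≤ (q-low e) (W-≤ e)))
      where
      lem : ∀ c q w → c * c * (q * w) ≡ q * c * (c * w)
      lem = solve-∀

    -- 3 (1 + d) ≤ 4 d for d ≥ 3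
    remainder-part : ∀ e → 3 * ∑ B (λ d → (2 + d) * z (suc d * suc e)) ≤
      4 * ∑ B (λ d → suc d * z (suc d * suc e)) + 6 * z (suc e)
    remainder-part e = begin
      3 * ∑ B (λ d → (2 + d) * g d)  ≡⟨ cong (3 *_) (split (λ d → (2 + d) * g d)) ⟩
      3 * (2 * g 0 + (3 * g 1 + ∑ (i′ + M) (λ d → (4 + d) * g (2 + d)))) ≤⟨ ≤-cert (3 * g 0) (+-mono-≤ rest (*-monoʳ-≤ 1 g1≤g0)) (lem (g 0) (g 1) (∑ (i′ + M) (λ d → (4 + d) * g (2 + d))) (∑ (i′ + M) (λ d → (3 + d) * g (2 + d)))) ⟩
      4 * (1 * g 0 + (2 * g 1 + ∑ (i′ + M) (λ d → (3 + d) * g (2 + d)))) + 6 * g 0 ≡⟨ cong₂ (λ a b → 4 * a + 6 * b) (sym (split (λ d → suc d * g d))) (cong z (+-identityʳ (suc e))) ⟩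
      4 * ∑ B (λ d → suc d * g d) + 6 * z (suc e)  ∎
      where
      open ≤-Reasoning
      g : ℕ → ℕ
      g d = z (suc d * suc e)
      split : ∀ (h : ℕ → ℕ) → ∑ B h ≡ h 0 + (h 1 + ∑ (i′ + M) (λ d → h (2 + d)))
      split h = trans (∑-head (suc (i′ + M)) h) (cong (h 0 +_) (∑-head (i′ + M) _))
      g1≤g0 : g 1 ≤ g 0
      g1≤g0 = antitone z↓ (*-monoˡ-≤ (suc e) {1} {2} (s≤s z≤n))
      rest : 3 * ∑ (i′ + M) (λ d → (4 + d) * g (2 + d)) ≤ 4 * ∑ (i′ + M) (λ d → (3 + d) * g (2 + d))
      rest = ≤-trans (≤-reflexive (sym (∑-*ˡ (i′ + M) 3 _))) (≤-trans (∑-mono (i′ + M) (λ d → ≤-slack (d * g (2 + d)) (lem₃ d (g (2 + d))))) (≤-reflexive (∑-*ˡ (i′ + M) 4 _)))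
        where
        lem₃ : ∀ d a → 3 * ((4 + d) * a) + d * a ≡ 4 * ((3 + d) * a)
        lem₃ = solve-∀
      lem : ∀ a b s t → 3 * (2 * a + (3 * b + s)) + (4 * t + 1 * a) + 3 * a ≡ 4 * (1 * a + (2 * b + t)) + 6 * a + (3 * s + 1 * b)
      lem = solve-∀

  -- The last sum runs over σ from 1 again, so a recurrence can evaluate it. In sixtieths, 99 is
  -- 33/20, 80 is the 4/3 of `remainder-part`, and 180 is 60 for the divisors above i plus 120 from
  -- the correction in `remainder-part`.
  shifted-σ-≤ : 60 * ∑ M (λ l → σ (suc (i + l)) * z l) ≤
    60 * ((∑quot i + i) * z 0) + 180 * Z + 99 * (i * Z) + 80 * ∑ M (λ l → σ (suc l) * z (suc l))
  shifted-σ-≤ = begin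
    60 * ∑ M (λ l → σ (suc (i + l)) * z l)  ≡⟨ cong (60 *_) unfold ⟩
    60 * ∑ B (λ e → ∑ B (λ d → suc d * f (suc d * suc e)))  ≤⟨ *-monoʳ-≤ 60 (∑-mono B row-≤) ⟩
    60 * ∑ B (λ e → head e + (q e * W e + R e))  ≡⟨ cong (60 *_) (trans (∑-+ B head _) (cong (∑ B head +_) (∑-+ B _ R))) ⟩
    60 * (∑ B head + (∑ B (λ e → q e * W e) + ∑ B R))
      ≤⟨ ≤-cert 0 (+-mono-≤ (+-mono-≤ (*-monoʳ-≤ 60 heads-≤) (*-monoʳ-≤ 3 quot-part)) (*-monoʳ-≤ 20 R-≤))
           (lem (∑ B head) (∑ B (λ e → q e * W e)) (∑ B R) ((∑quot i + i) * z 0) Z (i * Z) (∑ M (λ l → σ (suc l) * z (suc l)))) ⟩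
    60 * ((∑quot i + i) * z 0) + 180 * Z + 99 * (i * Z) + 80 * ∑ M (λ l → σ (suc l) * z (suc l)) ∎
    where
    open ≤-Reasoning
    R : ℕ → ℕ
    R e = ∑ B (λ d → (2 + d) * z (suc d * suc e))
    g : ℕ → ℕ
    g j = σ (suc j) * f (suc j)
    unfold : ∑ M (λ l → σ (suc (i + l)) * z l) ≡ ∑ B (λ e → ∑ B (λ d → suc d * f (suc d * suc e)))
    unfold = trans (∑-cong M (λ l → cong (σ (suc (i + l)) *_) (sym (f-shift l))))
      (trans (sym (∑-pad i M g (λ j j<i → trans (cong (σ (suc j) *_) (f-low (suc j) j<i)) (*-zeroʳ (σ (suc j))))))
      (trans (sym (∑-extend g (n≤1+n (i + M)) (λ j le → trans (cong (σ (suc j) *_) (f-top j le)) (*-zeroʳ (σ (suc j))))))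
      (trans (σ-∑∑ B f f-high) (∑-swap B B _))))
      where
      f-top : ∀ j → i + M ≤ j → f (suc j) ≡ 0
      f-top j le with m≤n⇒∃[o]m+o≡n (≤-trans (m≤m+n i M) le)
      ... | o , refl = trans (f-shift o) (z0 o (+-cancelˡ-≤ i M o le))
    R-≤ : 3 * ∑ B R ≤ 4 * ∑ M (λ l → σ (suc l) * z (suc l)) + 6 * Z
    R-≤ = begin
      3 * ∑ B R  ≡⟨ ∑-*ˡ B 3 R ⟨
      ∑ B (λ e → 3 * R e)  ≤⟨ ∑-mono B remainder-part ⟩
      ∑ B (λ e → 4 * ∑ B (λ d → suc d * z (suc d * suc e)) + 6 * z (suc e)) ≡⟨ trans (∑-+ B _ _) (cong₂ _+_ (∑-*ˡ B 4 _) (∑-*ˡ B 6 _)) ⟩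
      4 * ∑ B (λ e → ∑ B (λ d → suc d * z (suc d * suc e))) + 6 * ∑ B (λ e → z (suc e))
        ≤⟨ +-mono-≤ (*-monoʳ-≤ 4 (≤-reflexive σ-part)) (*-monoʳ-≤ 6 (≤-trans (m≤n+m _ (z 0)) (≤-reflexive (trans (sym (∑-head B z)) (z-sum (suc B) (≤-trans M≤B (n≤1+n B))))))) ⟩
      4 * ∑ M (λ l → σ (suc l) * z (suc l)) + 6 * Z  ∎
      where
      σ-part : ∑ B (λ e → ∑ B (λ d → suc d * z (suc d * suc e))) ≡ ∑ M (λ l → σ (suc l) * z (suc l))
      σ-part = trans (∑-swap B B _) (trans (sym (σ-∑∑ B z (λ j B<j → z0 j (≤-trans M≤B (<⇒≤ B<j)))))
        (∑-extend _ M≤B (λ l M≤l → trans (cong (σ (suc l) *_) (z0 (suc l) (≤-trans M≤l (n≤1+n l)))) (*-zeroʳ (σ (suc l))))))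
    lem : ∀ h w r n Z iz s → 60 * (h + (w + r)) + (60 * (n + Z) + 3 * (33 * iz) + 20 * (4 * s + 6 * Z)) + 0 ≡
      60 * n + 180 * Z + 99 * iz + 80 * s + (60 * h + 3 * (20 * w) + 20 * (3 * r))
    lem = solve-∀

-- Bounds on the ratios P n / P (n − 1)

-- A record rather than an abbreviation: conversion checking would unfold 705600 * suc n.
record Margin (k g n : ℕ) : Set where
  constructor margin
  private
    K = k * 1077749
    H = n * 705600 + g * (k * 839971 + 1411200)
  field
    holds : 33 * (k * (H * (H + K * g))) ≤ 20 * (n * (K * K * (g * g)))

-- With A / b ≥ √(n / 1.65 k) − O(1) and n y ≥ 1.527 k A − O(k b): y / b ≥ 1/g + 1/n as soon as 1/g is below
-- √(1.527² k / 1.65 n) by a margin.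
ratio-lower-arith : ∀ k g n A b y → 0 < k →
  20 * (n * (b * b)) ≤ 33 * (k * (A * A + b * A)) →
  k * A * 1077749 ≤ (n * y + b) * 705600 + k * b * 839971 →
  Margin k g n →
  g * b + n * b ≤ g * (n * y)
ratio-lower-arith k g n A b y k>0 A-lower y-lower (margin h) with g * b + n * b ≤? g * (n * y)
... | yes le = le
-- If the claim fails, `y-lower` caps A by K g A < H b; put into the quadratic lower bound on A,
-- this contradicts the margin.
... | no  nle = contradiction (begin-strict
  33 * (k * (H * (H + K * g))) * (b * b)  ≤⟨ *-monoˡ-≤ (b * b) h ⟩
  20 * (n * (K * K * (g * g))) * (b * b)  ≡⟨ lem₁ n K g b ⟩
  K * K * (g * g) * (20 * (n * (b * b)))  ≤⟨ *-monoʳ-≤ (K * K * (g * g)) A-lower ⟩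
  K * K * (g * g) * (33 * (k * (A * A + b * A)))  ≡⟨ lem₂ K g k A b ⟩
  33 * k * (K * g * A * (K * g * A + K * g * b))  <⟨ *-monoʳ-< (33 * k) {{m*n≢0 33 k {{_}} {{>-nonZero k>0}}}} (*-mono-< KgA< (+-monoˡ-< (K * g * b) KgA<)) ⟩
  33 * k * (H * b * (H * b + K * g * b))  ≡⟨ lem₃ k H K g b ⟩
  33 * (k * (H * (H + K * g))) * (b * b)  ∎) (<-irrefl refl)
  where
  open ≤-Reasoning
  K = k * 1077749
  H = n * 705600 + g * (k * 839971 + 1411200)
  lem₁ : ∀ n K g b → 20 * (n * (K * K * (g * g))) * (b * b) ≡ K * K * (g * g) * (20 * (n * (b * b)))
  lem₁ = solve-∀
  lem₂ : ∀ K g k A b → K * K * (g * g) * (33 * (k * (A * A + b * A))) ≡ 33 * k * (K * g * A * (K * g * A + K * g * b))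
  lem₂ = solve-∀
  lem₃ : ∀ k H K g b → 33 * k * (H * b * (H * b + K * g * b)) ≡ 33 * (k * (H * (H + K * g))) * (b * b)
  lem₃ = solve-∀
  KgA< : K * g * A < H * b
  KgA< = begin-strict
    K * g * A  ≡⟨ lem₄ k g A 1077749 ⟩
    g * (k * A * 1077749)  ≤⟨ *-monoʳ-≤ g y-lower ⟩
    g * ((n * y + b) * 705600 + k * b * 839971)  ≡⟨ lem₅ g (n * y) b k 705600 839971 ⟩
    g * (n * y) * 705600 + g * b * (k * 839971 + 705600)  <⟨ +-monoˡ-< (g * b * (k * 839971 + 705600)) (*-monoˡ-< 705600 (≰⇒> nle)) ⟩
    (g * b + n * b) * 705600 + g * b * (k * 839971 + 705600)  ≡⟨ lem₆ g b n k 705600 839971 ⟩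
    H * b  ∎
    where
    lem₄ : ∀ k g A u → k * u * g * A ≡ g * (k * A * u)
    lem₄ = solve-∀
    lem₅ : ∀ g nx b k u v → g * ((nx + b) * u + k * b * v) ≡ g * nx * u + g * b * (k * v + u)
    lem₅ = solve-∀
    lem₆ : ∀ g b n k u v → (g * b + n * b) * u + g * b * (k * v + u) ≡ (n * u + g * (k * v + (u + u))) * b
    lem₆ = solve-∀

module Ratio (P : ℕ → ℕ) (P>0 : ∀ m → 0 < P m) (n : ℕ)
  (logconcave : ∀ m → 2 + m ≤ n → P m * P (2 + m) ≤ P (suc m) * P (suc m)) where

  private
    a = rev P n

  ratio-P : ∀ l s → suc (l + s) ≤ n → P (suc (l + s)) * P l ≤ P (l + s) * P (suc l)
  ratio-P l zero    _ rewrite +-identityʳ l = ≤-reflexive (*-comm (P (suc l)) (P l))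
  ratio-P l (suc s) h rewrite +-suc l s = *-cancelˡ-≤ (P (l + s)) {{>-nonZero (P>0 (l + s))}} (begin
    P (l + s) * (P (2 + (l + s)) * P l)  ≡⟨ *-assoc (P (l + s)) _ _ ⟨
    P (l + s) * P (2 + (l + s)) * P l  ≤⟨ *-monoˡ-≤ (P l) (logconcave (l + s) h) ⟩
    P (suc (l + s)) * P (suc (l + s)) * P l  ≡⟨ *-assoc (P (suc (l + s))) _ _ ⟩
    P (suc (l + s)) * (P (suc (l + s)) * P l)  ≤⟨ *-monoʳ-≤ (P (suc (l + s))) (ratio-P l s (≤-trans (n≤1+n _) h)) ⟩
    P (suc (l + s)) * (P (l + s) * P (suc l))  ≡⟨ lem (P (suc (l + s))) (P (l + s)) (P (suc l)) ⟩
    P (l + s) * (P (suc (l + s)) * P (suc l))  ∎)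
    where
    open ≤-Reasoning
    lem : ∀ u v w → u * (v * w) ≡ v * (u * w)
    lem = solve-∀

  ratio : ∀ i s → a i * a (suc (i + s)) ≤ a (suc i) * a (i + s)
  ratio i s with suc (i + s) ≤? n
  ... | no  h = ≤-trans (≤-reflexive (trans (cong (a i *_) (rev-> P n _ (≰⇒> h))) (*-zeroʳ (a i)))) z≤n
  ... | yes h with m≤n⇒∃[o]m+o≡n h
  ...   | o , eq = begin
    a i * a (suc (i + s))  ≡⟨ cong₂ _*_ (at i (suc (o + s)) i+) (at (suc (i + s)) o eq) ⟩
    P (suc (o + s)) * P o  ≤⟨ ratio-P o s bound ⟩
    P (o + s) * P (suc o)  ≡⟨ cong₂ _*_ (at (suc i) (o + s) i++) (at (i + s) (suc o) is) ⟨
    a (suc i) * a (i + s)  ∎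
    where
    open ≤-Reasoning
    at : ∀ j m → j + m ≡ n → a j ≡ P m
    at j m e = trans (cong (λ q → rev P q j) (sym e)) (rev-+ P j m)
    i+ : i + suc (o + s) ≡ n
    i+ = trans (lem i s o) eq
      where
      lem : ∀ i s o → i + suc (o + s) ≡ suc (i + s) + o
      lem = solve-∀
    bound : suc (o + s) ≤ n
    bound = ≤-trans (m≤n+m _ i) (≤-reflexive i+)
    i++ : suc i + (o + s) ≡ n
    i++ = trans (sym (+-suc i (o + s))) i+
    is : i + s + suc o ≡ n
    is = trans (+-suc (i + s) o) eq

module Top (k : ℕ) (k>0 : 0 < k) (P : ℕ → ℕ) (convexP : Convex P) (P>0 : ∀ m → 0 < P m)
  (P-log : ∀ m → m * P m ≡ k * ∑ m (λ j → σ (suc j) * rev P m (suc j)))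
  (n′ : ℕ) (logconcave : ∀ m → 2 + m ≤ suc n′ → P m * P (2 + m) ≤ P (suc m) * P (suc m)) where

  private
    n = suc n′

  open Convex convexP
  open Ratio P P>0 n logconcave public

  N : ℕ
  N = suc n

  -- a j = P (n − j) and x j = a j − a (j + 1)
  a x : ℕ → ℕ
  a = rev P n
  x = rev Δ n

  a-split : ∀ j → a j ≡ a (suc j) + x j
  a-split = rev-P n

  a↓ : Antitone a
  a↓ j = ≤-trans (m≤m+n _ (x j)) (≤-reflexive (sym (a-split j)))

  x↓ : Antitone x
  x↓ = rev-Δ n

  a-0 : ∀ j → N ≤ j → a j ≡ 0
  a-0 j = rev-> P n j

  x-0 : ∀ j → N ≤ j → x j ≡ 0
  x-0 j = rev-> Δ n j

  a>0 : ∀ j → j ≤ n → 0 < a j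
  a>0 j j≤n = subst (0 <_) (sym (rev-∸ P n j j≤n)) (P>0 (n ∸ j))

  a-convex : ∀ j → 2 * a (suc j) ≤ a j + a (2 + j)
  a-convex j = ≤-cert 0 (x↓ j) (trans (cong (λ s → 2 * s + x j + 0) (a-split (suc j)))
    (trans (lem (a (2 + j)) (x (suc j)) (x j)) (cong (λ s → s + a (2 + j) + x (suc j)) (sym (trans (a-split j) (cong (_+ x j) (a-split (suc j))))))))
    where
    lem : ∀ b y z → 2 * (b + y) + z + 0 ≡ b + y + z + b + y
    lem = solve-∀

  telescope : ∀ d l → ∑ l (λ j → x (d + j)) + a (d + l) ≡ a d
  telescope d zero    = cong a (+-identityʳ d)
  telescope d (suc l) = trans (lem (∑ l (λ j → x (d + j))) (x (d + l)) (a (d + suc l))) (trans (cong (∑ l (λ j → x (d + j)) +_)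
    (trans (cong (_+ x (d + l)) (cong a (+-suc d l))) (sym (a-split (d + l))))) (telescope d l))
    where
    lem : ∀ s y b → s + y + b ≡ s + (b + y)
    lem = solve-∀

  ∑x : ∀ d l → N ≤ l → ∑ l (λ j → x (d + j)) ≡ a d
  ∑x d l N≤l = trans (sym (+-identityʳ _)) (trans (cong (∑ l (λ j → x (d + j)) +_) (sym (a-0 (d + l) (≤-trans N≤l (m≤n+m l d))))) (telescope d l))

  -- r_n ≤ r_{n-j} with 1 subtracted from both sides.
  x-ratio : ∀ j → x 0 * a (suc j) ≤ x j * a 1
  x-ratio j = ≤-cert 0 (ratio 0 j) (trans (cong (λ s → x 0 * a (suc j) + a 1 * s + 0) (a-split j))
    (trans (lem (x 0) (a (suc j)) (a 1) (x j)) (cong (λ s → x j * a 1 + s * a (suc j)) (sym (a-split 0)))))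
    where
    lem : ∀ y b c z → y * b + c * (b + z) + 0 ≡ z * c + (c + y) * b
    lem = solve-∀

  -- Log-concavity makes a_j / a_0 submultiplicative: one further step shrinks a by more, the deeper
  -- it starts.
  product : ∀ i j → a 0 * a (i + j) ≤ a i * a j
  product zero    j = ≤-refl
  product (suc i) j with i ≤? n
  ... | no  h = ≤-trans (≤-reflexive (trans (cong (a 0 *_) (a-0 _ (≤-trans (≰⇒> h) (≤-trans (m≤m+n i j) (n≤1+n _))))) (*-zeroʳ (a 0)))) z≤n
  ... | yes h = *-cancelˡ-≤ (a i) {{>-nonZero (a>0 i h)}} (begin
    a i * (a 0 * a (suc (i + j)))  ≡⟨ lem (a i) (a 0) _ ⟩
    a 0 * (a i * a (suc (i + j)))  ≤⟨ *-monoʳ-≤ (a 0) (ratio i j) ⟩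
    a 0 * (a (suc i) * a (i + j))  ≡⟨ lem (a 0) (a (suc i)) _ ⟩
    a (suc i) * (a 0 * a (i + j))  ≤⟨ *-monoʳ-≤ (a (suc i)) (product i j) ⟩
    a (suc i) * (a i * a j)  ≡⟨ lem (a (suc i)) (a i) (a j) ⟩
    a i * (a (suc i) * a j)  ∎)
    where
    open ≤-Reasoning
    lem : ∀ u v w → u * (v * w) ≡ v * (u * w)
    lem = solve-∀

  -- Zeroth and first moments of P (n - j), j ≥ 1. If P (n - j) were geometric of ratio 1/r, then A
  -- = P n / (r - 1) and V = r P n / (r - 1)², and n P n ≈ ζ(2) k V would determine r.
  A V : ℕ
  A = ∑ N (λ j → a (suc j))
  V = ∑ N (λ d → suc d * a (suc d))

  σ-ext : ∀ {M} (f : ℕ → ℕ) → M ≤ N → (∀ j → M ≤ j → f j ≡ 0) →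
    ∑ N (λ j → σ (suc j) * f j) ≡ ∑ M (λ j → σ (suc j) * f j)
  σ-ext f M≤N f0 = ∑-extend _ M≤N (λ j h → trans (cong (σ (suc j) *_) (f0 j h)) (*-zeroʳ (σ (suc j))))

  log₀ : n * a 0 ≡ k * ∑ N (λ j → σ (suc j) * a (suc j))
  log₀ = trans (P-log n) (cong (k *_) (sym (σ-ext (λ j → a (suc j)) (n≤1+n n) (λ j h → a-0 (suc j) (s≤s h)))))

  log₁ : n′ * a 1 ≡ k * ∑ N (λ j → σ (suc j) * a (2 + j))
  log₁ = trans (P-log n′) (cong (k *_) (sym (σ-ext (λ j → a (2 + j)) (≤-trans (n≤1+n n′) (n≤1+n n)) (λ j h → a-0 (2 + j) (s≤s (s≤s h))))))

  -- The difference of the recurrences for n and n - 1, as n a₀ - (n - 1) a₁ = n x₀ + a₁.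
  log-x : n * x 0 + a 1 ≡ k * ∑ N (λ j → σ (suc j) * x (suc j))
  log-x = +-cancelˡ-≡ (n′ * a 1) _ _ (begin
    n′ * a 1 + (n * x 0 + a 1)  ≡⟨ lem n′ (a 1) (x 0) ⟩
    n * (a 1 + x 0)  ≡⟨ cong (n *_) (a-split 0) ⟨
    n * a 0  ≡⟨ log₀ ⟩
    k * ∑ N (λ j → σ (suc j) * a (suc j))  ≡⟨ cong (k *_) (∑-cong N (λ j → trans (cong (σ (suc j) *_) (a-split (suc j))) (*-distribˡ-+ (σ (suc j)) _ _))) ⟩
    k * ∑ N (λ j → σ (suc j) * a (2 + j) + σ (suc j) * x (suc j)) ≡⟨ cong (k *_) (∑-+ N _ _) ⟩
    k * (∑ N (λ j → σ (suc j) * a (2 + j)) + ∑ N (λ j → σ (suc j) * x (suc j))) ≡⟨ *-distribˡ-+ k _ _ ⟩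
    k * ∑ N (λ j → σ (suc j) * a (2 + j)) + k * ∑ N (λ j → σ (suc j) * x (suc j)) ≡⟨ cong (_+ k * ∑ N (λ j → σ (suc j) * x (suc j))) log₁ ⟨
    n′ * a 1 + k * ∑ N (λ j → σ (suc j) * x (suc j))  ∎)
    where
    open ≡-Reasoning
    lem : ∀ m b y → m * b + (suc m * y + b) ≡ suc m * (b + y)
    lem = solve-∀

  -- For each e, `convex-sample` bounds ∑ d a(d e) by V / e²; summing over e replaces σ by its mean.
  n*a₀≤V : 20 * (n * a 0) ≤ 33 * (k * V)
  n*a₀≤V = begin
    20 * (n * a 0)  ≡⟨ cong (20 *_) log₀ ⟩
    20 * (k * ∑ N (λ j → σ (suc j) * a (suc j)))  ≡⟨ cong (λ s → 20 * (k * s)) (trans (σ-∑∑ N a (λ j h → a-0 j (<⇒≤ h))) (∑-swap N N _)) ⟩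
    20 * (k * ∑ N (λ e → ∑ N (λ d → suc d * a (suc d * suc e)))) ≡⟨ lem 20 k _ ⟩
    k * (20 * ∑ N (λ e → ∑ N (λ d → suc d * a (suc d * suc e)))) ≤⟨ *-monoʳ-≤ k (∑-inverse-squares N _ V (λ e → convex-sample a N e a-convex (λ j h → a-0 j (<⇒≤ h)))) ⟩
    k * (33 * V)  ≡⟨ lem 33 k V ⟨
    33 * (k * V)  ∎
    where
    open ≤-Reasoning
    lem : ∀ c k s → c * (k * s) ≡ k * (c * s)
    lem = solve-∀

  V-∑∑ : V ≡ ∑ N (λ d → ∑ N (λ l → a (suc (d + l))))
  V-∑∑ = sym (∑-diag N (λ s → a (suc s)) (λ s h → a-0 (suc s) (≤-trans h (n≤1+n s))))

  -- The row d = 0 of the double sum for V is A; every other entry factors by submultiplicativity,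
  -- so the rest is at most A².
  a₀V≤ : a 0 * V ≤ A * A + a 0 * A
  a₀V≤ = begin
    a 0 * V  ≡⟨ cong (a 0 *_) (trans V-∑∑ (∑-head n _)) ⟩
    a 0 * (A + ∑ n (λ d → ∑ N (λ l → a (2 + (d + l)))))  ≡⟨ *-distribˡ-+ (a 0) A _ ⟩
    a 0 * A + a 0 * ∑ n (λ d → ∑ N (λ l → a (2 + (d + l)))) ≡⟨ cong (a 0 * A +_) (trans (sym (∑-*ˡ n (a 0) _)) (∑-cong n (λ d → sym (∑-*ˡ N (a 0) _)))) ⟩
    a 0 * A + ∑ n (λ d → ∑ N (λ l → a 0 * a (2 + (d + l)))) ≤⟨ +-monoʳ-≤ (a 0 * A) (∑-mono n (λ d → ∑-mono N (λ l → ≤-trans (≤-reflexive (cong (λ s → a 0 * a (suc s)) (sym (+-suc d l)))) (product (suc d) (suc l))))) ⟩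
    a 0 * A + ∑ n (λ d → ∑ N (λ l → a (suc d) * a (suc l))) ≡⟨ cong (a 0 * A +_) (trans (∑-cong n (λ d → ∑-*ˡ N (a (suc d)) _)) (∑-*ʳ n A _)) ⟩
    a 0 * A + ∑ n (λ d → a (suc d)) * A  ≤⟨ +-monoʳ-≤ (a 0 * A) (*-monoˡ-≤ A (∑-prefix (λ d → a (suc d)) (n≤1+n n))) ⟩
    a 0 * A + A * A  ≡⟨ +-comm (a 0 * A) (A * A) ⟩
    A * A + a 0 * A  ∎
    where open ≤-Reasoning

  -- The x_j telescope to a₀, so summing `x-ratio` compares A with the geometric series of ratio
  -- 1/r_n.
  x₀A≤ : x 0 * A ≤ a 1 * a 0
  x₀A≤ = begin
    x 0 * A  ≡⟨ ∑-*ˡ N (x 0) _ ⟨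
    ∑ N (λ j → x 0 * a (suc j))  ≤⟨ ∑-mono N x-ratio ⟩
    ∑ N (λ j → x j * a 1)  ≡⟨ ∑-*ʳ N (a 1) x ⟩
    ∑ N x * a 1  ≡⟨ cong (_* a 1) (∑x 0 N ≤-refl) ⟩
    a 0 * a 1  ≡⟨ *-comm (a 0) (a 1) ⟩
    a 1 * a 0  ∎
    where open ≤-Reasoning

  x₀V≤ : x 0 * V ≤ a 1 * (a 0 + A)
  x₀V≤ = begin
    x 0 * V  ≡⟨ cong (x 0 *_) V-∑∑ ⟩
    x 0 * ∑ N (λ d → ∑ N (λ l → a (suc (d + l))))  ≡⟨ trans (sym (∑-*ˡ N (x 0) _)) (∑-cong N (λ d → sym (∑-*ˡ N (x 0) _))) ⟩
    ∑ N (λ d → ∑ N (λ l → x 0 * a (suc (d + l))))  ≤⟨ ∑-mono N (λ d → ∑-mono N (λ l → x-ratio (d + l))) ⟩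
    ∑ N (λ d → ∑ N (λ l → x (d + l) * a 1))  ≡⟨ ∑-cong N (λ d → trans (∑-*ʳ N (a 1) _) (cong (_* a 1) (∑x d N ≤-refl))) ⟩
    ∑ N (λ d → a d * a 1)  ≡⟨ ∑-*ʳ N (a 1) a ⟩
    ∑ N a * a 1  ≡⟨ *-comm (∑ N a) (a 1) ⟩
    a 1 * ∑ N a  ≤⟨ *-monoʳ-≤ (a 1) (≤-trans (≤-reflexive (∑-head n a)) (+-monoʳ-≤ (a 0) (m≤m+n _ _))) ⟩
    a 1 * (a 0 + A)  ∎
    where open ≤-Reasoning

  -- V is at most a₁ a₀² / x₀², its value for the geometric sequence of ratio 1/r_n. With `n*a₀≤V`
  -- this gives n (r_n - 1)² ≤ 1.65 k r_n.
  ratio-upper : 20 * (n * (x 0 * x 0)) ≤ 33 * (k * (a 1 * a 0))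
  ratio-upper = *-cancelˡ-≤ (a 0) {{>-nonZero (a>0 0 z≤n)}} (begin
    a 0 * (20 * (n * (x 0 * x 0)))  ≡⟨ lem₁ (a 0) n (x 0) ⟩
    x 0 * x 0 * (20 * (n * a 0))  ≤⟨ *-monoʳ-≤ (x 0 * x 0) n*a₀≤V ⟩
    x 0 * x 0 * (33 * (k * V))  ≡⟨ lem₂ (x 0) k V ⟩
    33 * (k * (x 0 * (x 0 * V)))  ≤⟨ *-monoʳ-≤ 33 (*-monoʳ-≤ k x²V) ⟩
    33 * (k * (a 1 * (a 0 * a 0)))  ≡⟨ lem₃ (a 0) (a 1) k ⟩
    a 0 * (33 * (k * (a 1 * a 0)))  ∎)
    where
    open ≤-Reasoning
    lem₁ : ∀ u n y → u * (20 * (n * (y * y))) ≡ y * y * (20 * (n * u))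
    lem₁ = solve-∀
    lem₂ : ∀ y k V → y * y * (33 * (k * V)) ≡ 33 * (k * (y * (y * V)))
    lem₂ = solve-∀
    lem₃ : ∀ u v k → 33 * (k * (v * (u * u))) ≡ u * (33 * (k * (v * u)))
    lem₃ = solve-∀
    x²V : x 0 * (x 0 * V) ≤ a 1 * (a 0 * a 0)
    x²V = begin
      x 0 * (x 0 * V)  ≤⟨ *-monoʳ-≤ (x 0) x₀V≤ ⟩
      x 0 * (a 1 * (a 0 + A))  ≡⟨ lem (x 0) (a 1) (a 0) A ⟩
      a 1 * (x 0 * a 0 + x 0 * A)  ≤⟨ *-monoʳ-≤ (a 1) (+-monoʳ-≤ (x 0 * a 0) x₀A≤) ⟩
      a 1 * (x 0 * a 0 + a 1 * a 0)  ≡⟨ cong (a 1 *_) (trans (sym (*-distribʳ-+ (a 0) (x 0) (a 1))) (cong (_* a 0) (trans (+-comm (x 0) (a 1)) (sym (a-split 0))))) ⟩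
      a 1 * (a 0 * a 0)  ∎
      where
      lem : ∀ y v u A → y * (v * (u + A)) ≡ v * (y * u + y * A)
      lem = solve-∀


  -- 3 g x₀ ≤ 4 a₁ says P n / P (n − 1) ≤ 1 + 4/(3g).
  ratio-upper-g : ∀ g → 99 * (k * (g * (3 * g + 4))) ≤ 320 * n → 3 * g * x 0 ≤ 4 * a 1
  ratio-upper-g g h with 3 * g * x 0 ≤? 4 * a 1
  ... | yes le = le
  ... | no  nle = contradiction (begin-strict
    16 * (33 * (k * (a 1 * a 0)))  ≡⟨ cong (λ s → 16 * (33 * (k * (a 1 * s)))) (a-split 0) ⟩
    16 * (33 * (k * (a 1 * (a 1 + x 0))))  ≡⟨ lem₁ k (a 1) (x 0) ⟩
    33 * k * (4 * a 1 * (4 * a 1 + 4 * x 0))  <⟨ *-monoʳ-< (33 * k) {{m*n≢0 33 k {{_}} {{>-nonZero k>0}}}} (*-mono-< (≰⇒> nle) (+-monoˡ-< (4 * x 0) (≰⇒> nle))) ⟩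
    33 * k * (3 * g * x 0 * (3 * g * x 0 + 4 * x 0))  ≡⟨ lem₂ k g (x 0) ⟩
    99 * (k * (g * (3 * g + 4))) * (x 0 * x 0)  ≤⟨ *-monoˡ-≤ (x 0 * x 0) h ⟩
    320 * n * (x 0 * x 0)  ≡⟨ lem₃ n (x 0) ⟩
    16 * (20 * (n * (x 0 * x 0)))  ≤⟨ *-monoʳ-≤ 16 ratio-upper ⟩
    16 * (33 * (k * (a 1 * a 0)))  ∎) (<-irrefl refl)
    where
    open ≤-Reasoning
    lem₁ : ∀ k b y → 16 * (33 * (k * (b * (b + y)))) ≡ 33 * k * (4 * b * (4 * b + 4 * y))
    lem₁ = solve-∀
    lem₂ : ∀ k g y → 33 * k * (3 * g * y * (3 * g * y + 4 * y)) ≡ 99 * (k * (g * (3 * g + 4))) * (y * y)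
    lem₂ = solve-∀
    lem₃ : ∀ n y → 320 * n * (y * y) ≡ 16 * (20 * (n * (y * y)))
    lem₃ = solve-∀

  row : ℕ → ℕ
  row e = ∑ N (λ d → suc d * x (suc d * suc e))

  -- Twice a decreasing sequence is bounded by c = e + 1 times its samples along multiples of c:
  -- first a, then x, which sums to a. The c - 1 terms before the first multiple cost at most a 1
  -- each.
  row-lower : ∀ e → A ≤ suc e * suc e * row e + e * a 1
  row-lower e = begin
    A  ≤⟨ ∑-prefix (λ j → a (suc j)) (m≤n+m N e) ⟩
    ∑ (e + N) (λ j → a (suc j))  ≡⟨ ∑-split e N _ ⟩
    ∑ e (λ j → a (suc j)) + ∑ N (λ j → a (c + j))  ≤⟨ +-mono-≤ (≤-trans (∑-mono e (λ j → antitone a↓ {1} {suc j} (s≤s z≤n))) (≤-reflexive (∑-const e (a 1)))) tail ⟩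
    e * a 1 + c * c * row e  ≡⟨ +-comm (e * a 1) _ ⟩
    c * c * row e + e * a 1  ∎
    where
    open ≤-Reasoning
    c = suc e
    blocks : ∀ f → Antitone f → ∑ (N * c) f ≤ c * ∑ N (λ d → f (d * c))
    blocks f f↓ = begin
      ∑ (N * c) f  ≡⟨ ∑-block N c f ⟩
      ∑ N (λ d → ∑ c (λ t → f (d * c + t)))  ≤⟨ ∑-mono N (λ d → ∑-mono c (λ t → antitone f↓ (m≤m+n (d * c) t))) ⟩
      ∑ N (λ d → ∑ c (λ _ → f (d * c)))  ≡⟨ ∑-cong N (λ d → ∑-const c _) ⟩
      ∑ N (λ d → c * f (d * c))  ≡⟨ ∑-*ˡ N c _ ⟩
      c * ∑ N (λ d → f (d * c))  ∎
    shift↓ : ∀ {f} → Antitone f → ∀ s → Antitone (λ j → f (s + j))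
    shift↓ {f} f↓ s j = antitone f↓ (+-monoʳ-≤ s (n≤1+n j))
    a≤ : ∀ d → a (suc d * c) ≤ c * ∑ N (λ l → x (suc (d + l) * c))
    a≤ d = begin
      a (suc d * c)  ≡⟨ ∑x (suc d * c) (N * c) (m≤m*n N c) ⟨
      ∑ (N * c) (λ j → x (suc d * c + j))  ≤⟨ blocks _ (shift↓ x↓ (suc d * c)) ⟩
      c * ∑ N (λ l → x (suc d * c + l * c))  ≡⟨ cong (c *_) (∑-cong N (λ l → cong x (sym (*-distribʳ-+ c (suc d) l)))) ⟩
      c * ∑ N (λ l → x (suc (d + l) * c))  ∎
    tail : ∑ N (λ j → a (c + j)) ≤ c * c * row e
    tail = begin
      ∑ N (λ j → a (c + j))  ≤⟨ ∑-prefix (λ j → a (c + j)) (m≤m*n N c) ⟩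
      ∑ (N * c) (λ j → a (c + j))  ≤⟨ blocks _ (shift↓ a↓ c) ⟩
      c * ∑ N (λ d → a (suc d * c))  ≤⟨ *-monoʳ-≤ c (∑-mono N a≤) ⟩
      c * ∑ N (λ d → c * ∑ N (λ l → x (suc (d + l) * c))) ≡⟨ cong (c *_) (∑-*ˡ N c _) ⟩
      c * (c * ∑ N (λ d → ∑ N (λ l → x (suc (d + l) * c)))) ≡⟨ *-assoc c c _ ⟨
      c * c * ∑ N (λ d → ∑ N (λ l → x (suc (d + l) * c))) ≡⟨ cong (c * c *_) (∑-diag N (λ s → x (suc s * c)) (λ s h → x-0 (suc s * c) (≤-trans h (≤-trans (n≤1+n s) (m≤m*n (suc s) c))))) ⟩
      c * c * row e  ∎

  -- 705600 = lcm(1², …, 8²), 1077749 = ∑_{c ≤ 8} 705600 / c², 839971 = ∑_{c ≤ 8} 705600 (c − 1) / c²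
  ratio-lower : 8 ≤ N → k * A * 1077749 ≤ (n * x 0 + a 1) * 705600 + k * a 1 * 839971
  ratio-lower 8≤N = begin
    k * A * 1077749  ≡⟨ *-assoc k A 1077749 ⟩
    k * (A * 1077749)  ≤⟨ *-monoʳ-≤ k rows ⟩
    k * (∑ 8 row * 705600 + a 1 * 839971)  ≤⟨ *-monoʳ-≤ k (+-monoˡ-≤ (a 1 * 839971) (*-monoˡ-≤ 705600 (∑-prefix row 8≤N))) ⟩
    k * (∑ N row * 705600 + a 1 * 839971)  ≡⟨ lem₂ k (∑ N row) (a 1) 705600 839971 ⟩
    k * ∑ N row * 705600 + k * a 1 * 839971  ≡⟨ cong (λ s → s * 705600 + k * a 1 * 839971) (trans (cong (k *_) rows≡) (sym log-x)) ⟩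
    (n * x 0 + a 1) * 705600 + k * a 1 * 839971  ∎
    where
    open ≤-Reasoning
    lem₂ : ∀ k r b u v → k * (r * u + b * v) ≡ k * r * u + k * b * v
    lem₂ = solve-∀
    rows≡ : ∑ N row ≡ ∑ N (λ j → σ (suc j) * x (suc j))
    rows≡ = sym (trans (σ-∑∑ N x (λ j h → x-0 j (<⇒≤ h))) (∑-swap N N _))
    scale : ∀ w e → A * w ≤ row e * (suc e * suc e * w) + a 1 * (e * w)
    scale w e = ≤-trans (*-monoˡ-≤ w (row-lower e)) (≤-reflexive (lem w (suc e) (row e) e (a 1)))
      where
      lem : ∀ w c r e b → (c * c * r + e * b) * w ≡ r * (c * c * w) + b * (e * w)
      lem = solve-∀
    plus : ∀ w₁ w₂ c r₁ r₂ m₁ m₂ → A * w₁ ≤ r₁ * c + a 1 * m₁ → A * w₂ ≤ r₂ * c + a 1 * m₂ →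
      A * (w₁ + w₂) ≤ (r₁ + r₂) * c + a 1 * (m₁ + m₂)
    plus w₁ w₂ c r₁ r₂ m₁ m₂ h₁ h₂ = ≤-cert 0 (+-mono-≤ h₁ h₂) (lem w₁ w₂ c r₁ r₂ m₁ m₂ A (a 1))
      where
      lem : ∀ w₁ w₂ c r₁ r₂ m₁ m₂ A b → A * (w₁ + w₂) + (r₁ * c + b * m₁ + (r₂ * c + b * m₂)) + 0 ≡
        (r₁ + r₂) * c + b * (m₁ + m₂) + (A * w₁ + A * w₂)
      lem = solve-∀
    rows : A * 1077749 ≤ ∑ 8 row * 705600 + a 1 * 839971
    rows =
      -- Row c enters with weight 705600 / c²; the larger literals are running sums.
      plus 1066724 11025 705600 (∑ 7 row) (row 7) 762796 77175
        (plus 1052324 14400 705600 (∑ 6 row) (row 6) 676396 86400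
          (plus 1032724 19600 705600 (∑ 5 row) (row 5) 578396 98000
            (plus 1004500 28224 705600 (∑ 4 row) (row 4) 465500 112896
              (plus 960400 44100 705600 (∑ 3 row) (row 3) 333200 132300
                (plus 882000 78400 705600 (∑ 2 row) (row 2) 176400 156800
                  (plus 705600 176400 705600 (∑ 1 row) (row 1) 0 176400
                    (scale 705600 0) (scale 176400 1))
                  (scale 78400 2))
                (scale 44100 3))
              (scale 28224 4))
            (scale 19600 5))
          (scale 14400 6))
        (scale 11025 7)

  -- n a₀ ≤ 1.65 k V and a₀ V ≤ A² + a₀ A bound A from below. Passing to a₁ measures everything
  -- against P (n - 1), as `ratio-lower-arith` expects.
  A-lower : 20 * (n * (a 1 * a 1)) ≤ 33 * (k * (A * A + a 1 * A))
  A-lower = ≤-trans (*-monoʳ-≤ 20 (*-monoʳ-≤ n (*-monoˡ-≤ (a 1) (a↓ 0)))) (*-cancelˡ-≤ (a 0) {{>-nonZero (a>0 0 z≤n)}} (begin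
    a 0 * (20 * (n * (a 0 * a 1)))  ≡⟨ lem₁ (a 0) n (a 1) ⟩
    a 0 * a 1 * (20 * (n * a 0))  ≤⟨ *-monoʳ-≤ (a 0 * a 1) n*a₀≤V ⟩
    a 0 * a 1 * (33 * (k * V))  ≡⟨ lem₂ (a 0) (a 1) k V ⟩
    33 * (k * (a 1 * (a 0 * V)))  ≤⟨ *-monoʳ-≤ 33 (*-monoʳ-≤ k (*-monoʳ-≤ (a 1) a₀V≤)) ⟩
    33 * (k * (a 1 * (A * A + a 0 * A)))  ≤⟨ *-monoʳ-≤ 33 (*-monoʳ-≤ k a₁≤a₀) ⟩
    33 * (k * (a 0 * (A * A + a 1 * A)))  ≡⟨ lem₃ k (a 0) (A * A + a 1 * A) ⟩
    a 0 * (33 * (k * (A * A + a 1 * A)))  ∎))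
    where
    open ≤-Reasoning
    lem₁ : ∀ u n v → u * (20 * (n * (u * v))) ≡ u * v * (20 * (n * u))
    lem₁ = solve-∀
    lem₂ : ∀ u v k V → u * v * (33 * (k * V)) ≡ 33 * (k * (v * (u * V)))
    lem₂ = solve-∀
    lem₃ : ∀ k u w → 33 * (k * (u * w)) ≡ u * (33 * (k * w))
    lem₃ = solve-∀
    a₁≤a₀ : a 1 * (A * A + a 0 * A) ≤ a 0 * (A * A + a 1 * A)
    a₁≤a₀ = ≤-cert 0 (*-monoˡ-≤ (A * A) (a↓ 0)) (lem (a 0) (a 1) A)
      where
      lem : ∀ u v A → v * (A * A + u * A) + u * (A * A) + 0 ≡ u * (A * A + v * A) + v * (A * A)
      lem = solve-∀

-- The induction step

σ≥ : ∀ j → 2 + j < σ (2 + j)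
σ≥ j = begin
  3 + j  ≡⟨ cong₂ _+_ first last ⟨
  divTerm 0 (suc j) + divTerm (suc j) (suc j)  ≤⟨ +-monoˡ-≤ _ (term≤∑ (suc j) 0 (λ d → divTerm d (suc j)) (s≤s z≤n)) ⟩
  σ (2 + j)  ∎
  where
  open ≤-Reasoning
  first : divTerm 0 (suc j) ≡ 1
  first = trans (cong (divTerm 0) (sym (trans (+-identityʳ _) (*-identityʳ (suc j))))) (divTerm-multiple 0 (suc j))
  last : divTerm (suc j) (suc j) ≡ 2 + j
  last = divTerm-multiple (suc j) 0

-- With T l = Y l / q l nondecreasing, ∑_{l ≤ I} b Y ≤ ∑ c Y follows from the same inequality between the tails of
-- ∑ b q and ∑ c q from l on, for every l ≤ I (T is capped at T I).
module Abel (b c q Y Tb Tc cY : ℕ → ℕ)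
  (Tb-suc : ∀ l → Tb l ≡ b l * q l + Tb (suc l))
  (Tc-suc : ∀ l → Tc l ≡ c l * q l + Tc (suc l))
  (cY-suc : ∀ l → cY l ≡ c l * Y l + cY (suc l))
  (mono   : ∀ l → Y l * q (suc l) ≤ Y (suc l) * q l)
  where

  -- Divided by q l, this is the claim for T - T l in place of T. Going from l + 1 to l raises these
  -- weights by T (1 + l) - T l ≥ 0, which gains that multiple of Tc (1 + l) - Tb (1 + l). The last
  -- hypothesis bounds cY beyond the cap from below by the capped T.
  capped : ∀ r l →
    (∀ s → s ≤ r → Tb (l + s) ≤ Tc (l + s)) → (∀ s → s ≤ r → 0 < q (l + s)) →
    Y (l + r) * Tc (suc (l + r)) ≤ q (l + r) * cY (suc (l + r)) →
    q l * ∑ (suc r) (λ s → b (l + s) * Y (l + s)) + Y l * Tc l ≤ q l * cY l + Y l * Tb l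
  capped zero l tails pos base rewrite +-identityʳ l | Tb-suc l | Tc-suc l | cY-suc l =
    ≤-cert (Y l * Tb (suc l)) base (lem (q l) (b l) (c l) (Y l) (Tc (suc l)) (cY (suc l)) (Tb (suc l)))
    where
    lem : ∀ q b c Y t z s → q * (b * Y) + Y * (c * q + t) + q * z + Y * s ≡ q * (c * Y + z) + Y * (b * q + s) + Y * t
    lem = solve-∀
  capped (suc r) l tails pos base = *-cancelˡ-≤ (q (suc l)) {{>-nonZero q′>0}} (begin
    q′ * (q l * ∑ (2 + r) (λ s → b (l + s) * Y (l + s)) + Y l * Tc l)
      ≡⟨ cong₂ (λ S t → q′ * (q l * S + Y l * t)) split (trans (Tc-suc l) (cong (c l * q l +_) Tc≡)) ⟩
    q′ * (q l * (b l * Y l + B) + Y l * (c l * q l + (Tb (suc l) + E)))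
      ≤⟨ ≤-cert 0 (+-mono-≤ (*-monoʳ-≤ (q l) ih′) (*-monoˡ-≤ E (mono l))) (lem (q l) q′ (b l) (c l) (Y l) (Y (suc l)) B E (cY (suc l)) (Tb (suc l))) ⟩
    q′ * (q l * (c l * Y l + cY (suc l)) + Y l * (b l * q l + Tb (suc l)))
      ≡⟨ cong₂ (λ S t → q′ * (q l * S + Y l * t)) (cY-suc l) (Tb-suc l) ⟨
    q′ * (q l * cY l + Y l * Tb l) ∎)
    where
    open ≤-Reasoning
    q′ = q (suc l)
    B = ∑ (suc r) (λ s → b (suc l + s) * Y (suc l + s))
    E = Tc (suc l) ∸ Tb (suc l)
    at1 : ∀ (f : ℕ → ℕ) → f (l + 1) ≡ f (suc l)
    at1 f = cong f (+-comm l 1)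
    q′>0 : 0 < q′
    q′>0 = subst (0 <_) (at1 q) (pos 1 (s≤s z≤n))
    Tc≡ : Tc (suc l) ≡ Tb (suc l) + E
    Tc≡ = sym (m+[n∸m]≡n (subst (λ i → Tb i ≤ Tc i) (+-comm l 1) (tails 1 (s≤s z≤n))))
    split : ∑ (2 + r) (λ s → b (l + s) * Y (l + s)) ≡ b l * Y l + B
    split = trans (∑-head (suc r) _) (cong₂ _+_ (cong (λ i → b i * Y i) (+-identityʳ l))
      (∑-cong (suc r) (λ s → cong (λ i → b i * Y i) (+-suc l s))))
    ih : q′ * B + Y (suc l) * Tc (suc l) ≤ q′ * cY (suc l) + Y (suc l) * Tb (suc l)
    ih = capped r (suc l) (λ s s≤r → subst (λ i → Tb i ≤ Tc i) (+-suc l s) (tails (suc s) (s≤s s≤r)))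
      (λ s s≤r → subst (λ i → 0 < q i) (+-suc l s) (pos (suc s) (s≤s s≤r)))
      (subst (λ i → Y i * Tc (suc i) ≤ q i * cY (suc i)) (+-suc l r) base)
    ih′ : q′ * B + Y (suc l) * E ≤ q′ * cY (suc l)
    ih′ = ≤-cert 0 ih (trans (lem₁ (q′ * B) (Y (suc l)) E (q′ * cY (suc l)) (Tb (suc l)))
      (cong (λ t → q′ * cY (suc l) + (q′ * B + Y (suc l) * t)) (sym Tc≡)))
      where
      lem₁ : ∀ p y e z t → p + y * e + (z + y * t) + 0 ≡ z + (p + y * (t + e))
      lem₁ = solve-∀
    lem : ∀ q q′ b c Y Y′ B E z t →
      q′ * (q * (b * Y + B) + Y * (c * q + (t + E))) + (q * (q′ * z) + Y′ * q * E) + 0 ≡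
      q′ * (q * (c * Y + z) + Y * (b * q + t)) + (q * (q′ * B + Y′ * E) + Y * q′ * E)
    lem = solve-∀

  conclusion : ∀ r → (∀ s → s ≤ r → Tb s ≤ Tc s) → (∀ s → s ≤ r → 0 < q s) →
    Y r * Tc (suc r) ≤ q r * cY (suc r) → ∑ (suc r) (λ s → b s * Y s) ≤ cY 0
  conclusion r tails pos base = *-cancelˡ-≤ (q 0) {{>-nonZero (pos 0 z≤n)}}
    (≤-cert 0 (+-mono-≤ (capped r 0 tails pos base) (*-monoʳ-≤ (Y 0) (tails 0 z≤n)))
      (lem (q 0 * ∑ (suc r) (λ s → b s * Y s)) (q 0 * cY 0) (Y 0) (Tb 0) (Tc 0)))
    where
    lem : ∀ m z y s t → m + (z + y * s + y * t) + 0 ≡ z + (m + y * t + y * s)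
    lem = solve-∀

growth-arith₀ : ∀ g c e → (2 * (g * g) + 2 * (g * 0) + 0 * 0) * c ≡ 2 * (g * g) * c + 0 * e
growth-arith₀ = solve-∀

growth-arith₁ : ∀ g t e c y d → d ≡ c + y → (g + t) * e ≤ g * c → c ≤ g * y → e ≤ c → (g + suc t) * e ≤ g * d
growth-arith₁ g t e c y _ refl h₁ h₂ h₃ = ≤-cert 0 (+-mono-≤ h₁ (+-mono-≤ h₂ h₃)) (lem g t e c y)
  where
  lem : ∀ g t e c y → (g + suc t) * e + (g * c + (g * y + c)) + 0 ≡ g * (c + y) + ((g + t) * e + (c + e))
  lem = solve-∀

growth-arith₂ : ∀ g t e c y d → d ≡ c + y → (2 * (g * g) + 2 * (g * t) + t * t) * e ≤ 2 * (g * g) * c + t * e →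
  (g + t) * e ≤ g * c → c ≤ g * y →
  (2 * (g * g) + 2 * (g * suc t) + suc t * suc t) * e ≤ 2 * (g * g) * d + suc t * e
growth-arith₂ g t e c y _ refl h₁ h₂ h₃ =
  ≤-cert 0 (+-mono-≤ h₁ (+-mono-≤ (*-monoʳ-≤ 2 h₂) (*-monoʳ-≤ (2 * g) h₃))) (lem g t e c y)
  where
  lem : ∀ g t e c y →
    (2 * (g * g) + 2 * (g * suc t) + suc t * suc t) * e + (2 * (g * g) * c + t * e + (2 * (g * c) + 2 * g * (g * y))) + 0 ≡
    2 * (g * g) * (c + y) + suc t * e + ((2 * (g * g) + 2 * (g * t) + t * t) * e + (2 * ((g + t) * e) + 2 * g * c))
  lem = solve-∀

growth-arith₃ : ∀ i c y d → d ≡ c + y → c ≤ i * y → suc i * c ≤ i * d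
growth-arith₃ i c y _ refl h = ≤-cert 0 h (lem i c y)
  where
  lem : ∀ i c y → suc i * c + i * y + 0 ≡ i * (c + y) + c
  lem = solve-∀

-- Shares in units of i w: 8/15 from the first multiples, 33/20 from ∑ 1/e², 1/9 from S because i ≥
-- 20 g, and at most 19/180 from the multiples of w alone; together 12/5.
tail-arith : ∀ k g i q X w S s n {{_ : NonZero k}} {{_ : NonZero g}} → 20 * g ≤ i → 42 ≤ i →
  60 * s ≤ 60 * (q * X) + 180 * w + 99 * (i * w) + 80 * S →
  k * S ≤ n * X + w → 3 * g * X ≤ 4 * w → 5 * q ≤ 2 * (g * i) → 4 * n ≤ 5 * (k * (g * g)) →
  5 * s ≤ 12 * (i * w)
tail-arith k g i q X w S s n 20g≤i 42≤i h₁ h₂ h₃ h₄ h₅ = *-cancelˡ-≤ 36 (begin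
  36 * (5 * s)  ≡⟨ *-assoc 36 5 s ⟨
  180 * s  ≡⟨ *-assoc 3 60 s ⟩
  3 * (60 * s)  ≤⟨ *-monoʳ-≤ 3 h₁ ⟩
  3 * (60 * (q * X) + 180 * w + 99 * (i * w) + 80 * S)  ≡⟨ l₁ (q * X) w (i * w) S ⟩
  12 * (15 * (q * X)) + 540 * w + 297 * (i * w) + 80 * (3 * S)  ≤⟨ +-mono-≤ (+-monoˡ-≤ (297 * (i * w)) (+-monoˡ-≤ (540 * w) (*-monoʳ-≤ 12 qX))) (*-monoʳ-≤ 80 S≤) ⟩
  12 * (8 * (i * w)) + 540 * w + 297 * (i * w) + 80 * (5 * (g * w) + 3 * w) ≡⟨ l₂ (i * w) w g ⟩
  393 * (i * w) + 20 * g * w * 20 + 780 * w  ≤⟨ +-mono-≤ (+-monoʳ-≤ (393 * (i * w)) (*-monoˡ-≤ 20 (*-monoˡ-≤ w 20g≤i))) 780w ⟩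
  393 * (i * w) + i * w * 20 + i * w * 19  ≡⟨ l₃ (i * w) ⟩
  36 * (12 * (i * w))  ∎)
  where
  open ≤-Reasoning
  l₁ : ∀ a w b S → 3 * (60 * a + 180 * w + 99 * b + 80 * S) ≡ 12 * (15 * a) + 540 * w + 297 * b + 80 * (3 * S)
  l₁ = solve-∀
  l₂ : ∀ b w g → 12 * (8 * b) + 540 * w + 297 * b + 80 * (5 * (g * w) + 3 * w) ≡ 393 * b + 20 * g * w * 20 + 780 * w
  l₂ = solve-∀
  l₃ : ∀ b → 393 * b + b * 20 + b * 19 ≡ 36 * (12 * b)
  l₃ = solve-∀
  780w : 780 * w ≤ i * w * 19
  780w = ≤-cert (18 * w) (*-monoˡ-≤ 19 (*-monoˡ-≤ w 42≤i)) (l (i * w) w)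
    where
    l : ∀ b w → 780 * w + b * 19 + 18 * w ≡ b * 19 + 42 * w * 19
    l = solve-∀
  qX : 15 * (q * X) ≤ 8 * (i * w)
  qX = *-cancelˡ-≤ g (≤-trans (≤-reflexive (l₄ g q X)) (≤-trans (*-mono-≤ h₄ h₃) (≤-reflexive (l₅ g i w))))
    where
    l₄ : ∀ g q X → g * (15 * (q * X)) ≡ 5 * q * (3 * g * X)
    l₄ = solve-∀
    l₅ : ∀ g i w → 2 * (g * i) * (4 * w) ≡ g * (8 * (i * w))
    l₅ = solve-∀
  nX : 3 * (n * X) ≤ 5 * (k * (g * w))
  nX = *-cancelˡ-≤ 4 (*-cancelˡ-≤ g (≤-trans (≤-reflexive (l₄ g n X)) (≤-trans (*-monoʳ-≤ (4 * n) h₃) (≤-trans (*-monoˡ-≤ (4 * w) h₅) (≤-reflexive (l₅ g k w))))))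
    where
    l₄ : ∀ g n X → g * (4 * (3 * (n * X))) ≡ 4 * n * (3 * g * X)
    l₄ = solve-∀
    l₅ : ∀ g k w → 5 * (k * (g * g)) * (4 * w) ≡ g * (4 * (5 * (k * (g * w))))
    l₅ = solve-∀
  S≤ : 3 * S ≤ 5 * (g * w) + 3 * w
  S≤ = *-cancelˡ-≤ k (begin
    k * (3 * S)  ≡⟨ l₄ k S ⟩
    3 * (k * S)  ≤⟨ *-monoʳ-≤ 3 h₂ ⟩
    3 * (n * X + w)  ≡⟨ *-distribˡ-+ 3 (n * X) w ⟩
    3 * (n * X) + 3 * w  ≤⟨ +-mono-≤ nX (m≤n*m (3 * w) k) ⟩
    5 * (k * (g * w)) + k * (3 * w)  ≡⟨ l₅ k (g * w) w ⟩
    k * (5 * (g * w) + 3 * w)  ∎)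
    where
    l₄ : ∀ k S → k * (3 * S) ≡ 3 * (k * S)
    l₄ = solve-∀
    l₅ : ∀ k b w → 5 * (k * b) + k * (3 * w) ≡ k * (5 * b + 3 * w)
    l₅ = solve-∀

∑-tail : ∀ N l (h : ℕ → ℕ) → (∀ j → N ≤ j → h j ≡ 0) → ∑ N h ≡ ∑ l h + ∑ N (λ s → h (l + s))
∑-tail N l h h0 = trans (sym (∑-extend h (m≤n+m N l) h0)) (∑-split l N h)

∑-tail-suc : ∀ N l (h : ℕ → ℕ) → (∀ j → N ≤ j → h j ≡ 0) →
  ∑ N (λ s → h (l + s)) ≡ h l + ∑ N (λ s → h (suc l + s))
∑-tail-suc N l h h0 = begin
  ∑ N (λ s → h (l + s))  ≡⟨ ∑-extend _ (n≤1+n N) (λ s N≤s → h0 (l + s) (≤-trans N≤s (m≤n+m s l))) ⟨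
  ∑ (suc N) (λ s → h (l + s))  ≡⟨ ∑-head N _ ⟩
  h (l + 0) + ∑ N (λ s → h (l + suc s))  ≡⟨ cong₂ _+_ (cong h (+-identityʳ l)) (∑-cong N (λ s → cong h (+-suc l s))) ⟩
  h l + ∑ N (λ s → h (suc l + s))  ∎
  where open ≡-Reasoning

-- Here p, q are heads, s is the term in between and R₀, R₁ are tails. With n = m + 1 and α/β = u/v
-- - 1/n, the totals give α R₁ - β R₀ ≥ n v s - n u v - m v². One u of 2 u ≤ s covers the drop from
-- n to m, the other the 1/n given up.
near-arith : ∀ m u v y p s q R₀ R₁ → u ≡ v + y → p + s + R₀ ≡ suc m * u → q + R₁ ≡ m * v →
  u * q ≤ v * p → 2 * u ≤ s → suc m * v * R₀ ≤ (m * v + suc m * y) * R₁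
near-arith m _ v y p s q R₀ R₁ refl eq₀ eq₁ h₁ h₂ = +-cancelʳ-≤ (β * (p + s) + α * q) _ _ (begin
  β * R₀ + (β * (p + s) + α * q)  ≡⟨ l₁ β R₀ (p + s) α q ⟩
  β * (p + s + R₀) + α * q  ≡⟨ cong (λ t → β * t + α * q) eq₀ ⟩
  β * (suc m * (v + y)) + α * q  ≤⟨ +-mono-≤ main αq≤ ⟩
  α * (m * v) + β * (2 * (v + y)) + β * p  ≤⟨ +-monoˡ-≤ (β * p) (+-monoʳ-≤ (α * (m * v)) (*-monoʳ-≤ β h₂)) ⟩
  α * (m * v) + β * s + β * p  ≡⟨ cong (λ t → α * t + β * s + β * p) eq₁ ⟨
  α * (q + R₁) + β * s + β * p  ≡⟨ l₂ β R₁ p s α q ⟩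
  α * R₁ + (β * (p + s) + α * q)  ∎)
  where
  open ≤-Reasoning
  α = m * v + suc m * y
  β = suc m * v
  l₁ : ∀ β R p α q → β * R + (β * p + α * q) ≡ β * (p + R) + α * q
  l₁ = solve-∀
  l₂ : ∀ β R p s α q → α * (q + R) + β * s + β * p ≡ α * R + (β * (p + s) + α * q)
  l₂ = solve-∀
  main : β * (suc m * (v + y)) ≤ α * (m * v) + β * (2 * (v + y))
  main = ≤-slack (v * v + suc m * (v * y)) (l m v y)
    where
    l : ∀ m v y → suc m * v * (suc m * (v + y)) + (v * v + suc m * (v * y)) ≡ (m * v + suc m * y) * (m * v) + suc m * v * (2 * (v + y))
    l = solve-∀
  αq≤ : α * q ≤ β * p
  αq≤ = begin
    α * q  ≤⟨ *-monoˡ-≤ q (≤-slack v (l₃ m v y)) ⟩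
    suc m * (v + y) * q  ≡⟨ *-assoc (suc m) (v + y) q ⟩
    suc m * ((v + y) * q)  ≤⟨ *-monoʳ-≤ (suc m) h₁ ⟩
    suc m * (v * p)  ≡⟨ *-assoc (suc m) v p ⟨
    suc m * v * p  ∎
    where
    l₃ : ∀ m v y → m * v + suc m * y + v ≡ suc m * (v + y)
    l₃ = solve-∀

-- 2985984 = 12^6, 15625 = 5^6 and 1741824 = 7 · 12^5; the point is (12/5) (9/7) (5/12)^6 < 1/60.
rest-arith : ∀ T I I₂ A₁ A₂ E → 5 * T ≤ 12 * (I₂ * A₂) → 7 * I₂ ≤ 9 * I → A₂ * 2985984 ≤ A₁ * 15625 →
  I * A₁ ≤ E → 60 * T ≤ E
rest-arith T I I₂ A₁ A₂ E h₁ h₂ h₃ h₄ = *-cancelʳ-≤ (60 * T) E 1741824 (begin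
  60 * T * 1741824  ≡⟨ l₀ T ⟩
  7 * (5 * T) * 2985984  ≤⟨ *-monoˡ-≤ 2985984 (*-monoʳ-≤ 7 h₁) ⟩
  7 * (12 * (I₂ * A₂)) * 2985984 ≡⟨ l₁ I₂ A₂ 2985984 ⟩
  12 * (7 * I₂ * (A₂ * 2985984)) ≤⟨ *-monoʳ-≤ 12 (*-mono-≤ h₂ h₃) ⟩
  12 * (9 * I * (A₁ * 15625))  ≡⟨ l₂ I A₁ ⟩
  I * A₁ * 1687500  ≤⟨ *-mono-≤ h₄ (m≤m+n 1687500 54324) ⟩
  E * 1741824  ∎)
  where
  open ≤-Reasoning
  l₀ : ∀ T → 60 * T * 1741824 ≡ 7 * (5 * T) * 2985984
  l₀ T = trans (trans (cong (_* 1741824) (*-comm 60 T)) (*-assoc T 60 1741824))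
    (sym (trans (cong (_* 2985984) (trans (sym (*-assoc 7 5 T)) (*-comm 35 T))) (*-assoc T 35 2985984)))
  l₁ : ∀ i a c → 7 * (12 * (i * a)) * c ≡ 12 * (7 * i * (a * c))
  l₁ = solve-∀
  l₂ : ∀ i a → 12 * (9 * i * (a * 15625)) ≡ i * a * 1687500
  l₂ i a = trans (l₃ i a 15625) (*-assoc (i * a) 108 15625)
    where
    l₃ : ∀ i a c → 12 * (9 * i * (a * c)) ≡ i * a * 108 * c
    l₃ = solve-∀

-- After cancelling S₁ with factor 1 + 1/g, what is needed is S₁ + 3 g T ≤ 3 (g + 1) s w. In
-- sixtieths of g i w the demand is 24 from q, 99 from ∑ 1/e², 50 from S₂ because i ≥ 2 g, and 3
-- from T, against 180 available; s ≥ i + 1 covers the remaining 180 g w.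
far-arith : ∀ k g i q n w s Z S₀ S₁ S₂ T {{_ : NonZero k}} →
  3 * g * S₀ ≤ (3 * g + 4) * S₁ + 3 * g * T → 60 * T ≤ i * w →
  60 * S₁ ≤ 60 * (q * w) + 180 * Z + 99 * (i * Z) + 80 * S₂ → Z ≤ g * w → k * S₂ ≤ n * w →
  4 * n ≤ 5 * (k * (g * g)) → 5 * q ≤ 2 * (g * i) → 2 * g ≤ i → suc i ≤ s →
  g * S₀ ≤ suc g * (s * w + S₁)
far-arith k g i q n w s Z S₀ S₁ S₂ T h₁ h₂ h₃ h₄ h₅ h₆ h₇ h₈ h₉ = *-cancelˡ-≤ 180 (begin
  180 * (g * S₀)  ≡⟨ l₁ g S₀ ⟩
  60 * (3 * g * S₀)  ≤⟨ *-monoʳ-≤ 60 h₁ ⟩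
  60 * ((3 * g + 4) * S₁ + 3 * g * T)  ≡⟨ l₂ g S₁ T ⟩
  180 * (suc g * S₁) + 60 * S₁ + 3 * g * (60 * T)  ≤⟨ +-mono-≤ (+-monoʳ-≤ (180 * (suc g * S₁)) S₁≤) (*-monoʳ-≤ (3 * g) h₂) ⟩
  180 * (suc g * S₁) + (173 * (g * (i * w)) + 180 * (g * w)) + 3 * g * (i * w) ≤⟨ ≤-slack (4 * (g * (i * w)) + 180 * (i * w) + 180 * w) (l₃ g i w (suc g * S₁)) ⟩
  180 * (suc g * S₁) + 180 * (suc g * (suc i * w))  ≤⟨ +-monoʳ-≤ (180 * (suc g * S₁)) (*-monoʳ-≤ 180 (*-monoʳ-≤ (suc g) (*-monoˡ-≤ w h₉))) ⟩
  180 * (suc g * S₁) + 180 * (suc g * (s * w))  ≡⟨ l₄ g S₁ (s * w) ⟩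
  180 * (suc g * (s * w + S₁))  ∎)
  where
  open ≤-Reasoning
  l₁ : ∀ g S → 180 * (g * S) ≡ 60 * (3 * g * S)
  l₁ = solve-∀
  l₂ : ∀ g S T → 60 * ((3 * g + 4) * S + 3 * g * T) ≡ 180 * (suc g * S) + 60 * S + 3 * g * (60 * T)
  l₂ = solve-∀
  l₃ : ∀ g i w R → 180 * R + (173 * (g * (i * w)) + 180 * (g * w)) + 3 * g * (i * w) + (4 * (g * (i * w)) + 180 * (i * w) + 180 * w) ≡
    180 * R + 180 * (suc g * (suc i * w))
  l₃ = solve-∀
  l₄ : ∀ g S R → 180 * (suc g * S) + 180 * (suc g * R) ≡ 180 * (suc g * (R + S))
  l₄ = solve-∀
  S₂≤ : 4 * S₂ ≤ 5 * (g * g * w)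
  S₂≤ = *-cancelˡ-≤ k (begin
    k * (4 * S₂)  ≡⟨ l₅ k S₂ ⟩
    4 * (k * S₂)  ≤⟨ *-monoʳ-≤ 4 h₅ ⟩
    4 * (n * w)  ≡⟨ *-assoc 4 n w ⟨
    4 * n * w  ≤⟨ *-monoˡ-≤ w h₆ ⟩
    5 * (k * (g * g)) * w  ≡⟨ l₆ k g w ⟩
    k * (5 * (g * g * w))  ∎)
    where
    l₅ : ∀ k S → k * (4 * S) ≡ 4 * (k * S)
    l₅ = solve-∀
    l₆ : ∀ k g w → 5 * (k * (g * g)) * w ≡ k * (5 * (g * g * w))
    l₆ = solve-∀
  S₁≤ : 60 * S₁ ≤ 173 * (g * (i * w)) + 180 * (g * w)
  S₁≤ = begin
    60 * S₁  ≤⟨ h₃ ⟩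
    60 * (q * w) + 180 * Z + 99 * (i * Z) + 80 * S₂  ≡⟨ l₇ q w Z i S₂ ⟩
    12 * (5 * q * w) + 180 * Z + 99 * (i * Z) + 20 * (4 * S₂)  ≤⟨ +-mono-≤ (+-mono-≤ (+-mono-≤ (*-monoʳ-≤ 12 (*-monoˡ-≤ w h₇)) (*-monoʳ-≤ 180 h₄)) (*-monoʳ-≤ 99 (*-monoʳ-≤ i h₄))) (*-monoʳ-≤ 20 S₂≤) ⟩
    12 * (2 * (g * i) * w) + 180 * (g * w) + 99 * (i * (g * w)) + 20 * (5 * (g * g * w)) ≡⟨ l₈ g i w ⟩
    123 * (g * (i * w)) + 180 * (g * w) + 50 * (2 * g * (g * w))  ≤⟨ +-monoʳ-≤ (123 * (g * (i * w)) + 180 * (g * w)) (*-monoʳ-≤ 50 (*-monoˡ-≤ (g * w) h₈)) ⟩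
    123 * (g * (i * w)) + 180 * (g * w) + 50 * (i * (g * w))  ≡⟨ l₉ g i w ⟩
    173 * (g * (i * w)) + 180 * (g * w)  ∎
    where
    l₇ : ∀ q w Z i S → 60 * (q * w) + 180 * Z + 99 * (i * Z) + 80 * S ≡ 12 * (5 * q * w) + 180 * Z + 99 * (i * Z) + 20 * (4 * S)
    l₇ = solve-∀
    l₈ : ∀ g i w → 12 * (2 * (g * i) * w) + 180 * (g * w) + 99 * (i * (g * w)) + 20 * (5 * (g * g * w)) ≡
      123 * (g * (i * w)) + 180 * (g * w) + 50 * (2 * g * (g * w))
    l₈ = solve-∀
    l₉ : ∀ g i w → 123 * (g * (i * w)) + 180 * (g * w) + 50 * (i * (g * w)) ≡ 173 * (g * (i * w)) + 180 * (g * w)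
    l₉ = solve-∀

-- With n = m + 1, the hypotheses say G ≤ u² - u v / n and F < u v / n.
final-arith : ∀ m u v y G F Q {{_ : NonZero v}} → u ≡ v + y →
  suc m * v * G ≤ (m * v + suc m * y) * (u * v) → suc m * F < u * v →
  v * (suc (suc m) * Q) ≡ suc m * (u * u) + (G + F) → v * Q < u * u
final-arith m _ v y G F Q refl h₁ h₂ eq = *-cancelˡ-< (suc (suc m)) _ _ (begin-strict
  suc (suc m) * (v * Q)  ≡⟨ l₁ (suc (suc m)) v Q ⟩
  v * (suc (suc m) * Q)  ≡⟨ eq ⟩
  suc m * (u * u) + (G + F)  <⟨ +-monoʳ-< (suc m * (u * u)) (*-cancelˡ-< (suc m) _ _ GF<) ⟩
  suc m * (u * u) + u * u  ≡⟨ +-comm (suc m * (u * u)) (u * u) ⟩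
  suc (suc m) * (u * u)  ∎)
  where
  open ≤-Reasoning
  u = v + y
  l₁ : ∀ a b c → a * (b * c) ≡ b * (a * c)
  l₁ = solve-∀
  G≤ : suc m * G ≤ (m * v + suc m * y) * u
  G≤ = *-cancelˡ-≤ v (≤-trans (≤-reflexive (l₂ v (suc m) G)) (≤-trans h₁ (≤-reflexive (l₃ (m * v + suc m * y) u v))))
    where
    l₂ : ∀ v n G → v * (n * G) ≡ n * v * G
    l₂ = solve-∀
    l₃ : ∀ α u v → α * (u * v) ≡ v * (α * u)
    l₃ = solve-∀
  GF< : suc m * (G + F) < suc m * (u * u)
  GF< = begin-strict
    suc m * (G + F)  ≡⟨ *-distribˡ-+ (suc m) G F ⟩
    suc m * G + suc m * F  <⟨ +-mono-≤-< G≤ h₂ ⟩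
    (m * v + suc m * y) * u + u * v  ≡⟨ l₄ m v y ⟩
    suc m * (u * u)  ∎
    where
    l₄ : ∀ m v y → (m * v + suc m * y) * (v + y) + (v + y) * v ≡ suc m * ((v + y) * (v + y))
    l₄ = solve-∀

quarter-arith : ∀ g b y c d s → s + d ≡ c → s ≤ b * y → 3 * g * y ≤ 4 * c → 16 * b ≤ 3 * g → 3 * c ≤ 4 * d
quarter-arith g b y c d s eq h₁ h₂ h₃ = +-cancelˡ-≤ c (3 * c) (4 * d) (begin
  4 * c  ≡⟨ cong (4 *_) eq ⟨
  4 * (s + d)  ≡⟨ *-distribˡ-+ 4 s d ⟩
  4 * s + 4 * d  ≤⟨ +-monoˡ-≤ (4 * d) 4s≤c ⟩
  c + 4 * d  ∎)
  where
  open ≤-Reasoning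
  lem : ∀ b y → 4 * (4 * (b * y)) ≡ 16 * b * y
  lem = solve-∀
  4s≤c : 4 * s ≤ c
  4s≤c = *-cancelˡ-≤ 4 (begin
    4 * (4 * s)  ≤⟨ *-monoʳ-≤ 4 (*-monoʳ-≤ 4 h₁) ⟩
    4 * (4 * (b * y))  ≡⟨ lem b y ⟩
    16 * b * y  ≤⟨ *-monoˡ-≤ y h₃ ⟩
    3 * g * y  ≤⟨ h₂ ⟩
    4 * c  ∎)

-- For σ ≥ 1 + 6q and k ≥ 3, the weight k σ makes up for the loss (3/4)^(q+1); q = 0 is the tightest
-- of the thirteen cases.
powers : ∀ q → q < 13 → 2 * 4 ^ suc q ≤ 3 ^ suc q * (3 * suc (6 * q))
powers q q<13 = toWitness {a? = allUpTo? (λ q → 2 * 4 ^ suc q ≤? 3 ^ suc q * (3 * suc (6 * q))) 13} _ q<13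

σ-low : ∀ l q → 6 * q ≤ suc l → suc (6 * q) ≤ σ (suc l)
σ-low zero    zero    _ = s≤s z≤n
σ-low zero    (suc q) h with ≤-trans (m≤m*n 6 (suc q)) h
... | s≤s ()
σ-low (suc l) q       h = ≤-trans (s≤s h) (σ≥ l)

split-arith : ∀ g c d y z → d ≡ c + y → y ≤ z ⊎ 3 * g * y ≤ 4 * c → 3 * g * d ≤ (3 * g + 4) * c + 3 * g * z
split-arith g c _ y z refl (inj₁ y≤z) = ≤-cert (4 * c) (*-monoʳ-≤ (3 * g) y≤z) (lem g c y z)
  where
  lem : ∀ g c y z → 3 * g * (c + y) + 3 * g * z + 4 * c ≡ (3 * g + 4) * c + 3 * g * z + 3 * g * y
  lem = solve-∀
split-arith g c _ y z refl (inj₂ h) = ≤-cert (3 * g * z) h (lem g c y z)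
  where
  lem : ∀ g c y z → 3 * g * (c + y) + 4 * c + 3 * g * z ≡ (3 * g + 4) * c + 3 * g * z + 3 * g * y
  lem = solve-∀

-- α/β = r_n - 1/n ≥ 1 + 1/g: the 1/n in the lower bound on r_n is what α gives up.
αβ-arith : ∀ g m v y → g * v + suc m * v ≤ g * (suc m * y) → suc g * (suc m * v) ≤ g * (m * v + suc m * y)
αβ-arith g m v y h = ≤-cert 0 h (lem g m v y)
  where
  lem : ∀ g m v y → suc g * (suc m * v) + g * (suc m * y) + 0 ≡ g * (m * v + suc m * y) + (g * v + suc m * v)
  lem = solve-∀

I₂-arith : ∀ g I → 21 * g ≤ I → 7 * (I + 6 * g) ≤ 9 * I
I₂-arith g I h = ≤-cert 0 (*-monoʳ-≤ 2 h) (lem g I)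
  where
  lem : ∀ g I → 7 * (I + 6 * g) + 2 * I + 0 ≡ 9 * I + 2 * (21 * g)
  lem = solve-∀

-- The bounds on ratios are P n / P (n − 1) ≥ 1 + 1/g + 1/n and P (n − j) / P (n − j − 1) ≤ 1 + 4/(3g) for j ≤ J. The
-- terms with j > I are negligible against P n, and those with j > I₂ against P (n − I).
module Step (k : ℕ) (k≥3 : 3 ≤ k) (P : ℕ → ℕ) (convexP : Convex P) (P>0 : ∀ m → 0 < P m)
  (P-log : ∀ m → m * P m ≡ k * ∑ m (λ j → σ (suc j) * rev P m (suc j)))
  (n′ : ℕ) (logconcave : ∀ m → 2 + m ≤ suc n′ → P m * P (2 + m) ≤ P (suc m) * P (suc m))
  (g L b : ℕ) (L≥21 : 21 ≤ L) (g≥8 : 8 ≤ g)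
  (n-upper : 4 * suc n′ ≤ 5 * (k * (g * g)))
  (J<n : suc (L * g + 6 * g) < suc n′)
  (upper-ok : 99 * (k * (g * (3 * g + 4))) + 320 * suc (L * g + 6 * g) ≤ 320 * suc n′)
  (lower-ok : Margin k g (suc n′))
  (quot-ok : ∀ i → i ≤ suc (L * g + 6 * g) → 5 * (∑quot i + i) ≤ 2 * (g * i))
  (b-upper : 16 * b ≤ 3 * g) (b≥6 : 6 ≤ b) (b-lower : 2 * g < 13 * b)
  (far-ok : suc n′ * k * (12 * suc (L * g)) * 5 ^ L < 5 * 12 ^ L)
  where

  n I I₂ J : ℕ
  n = suc n′
  I = L * g
  I₂ = I + 6 * g
  J = suc I₂

  k>0 : 0 < k
  k>0 = ≤-trans (s≤s z≤n) k≥3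

  open Top k k>0 P convexP P>0 P-log n′ logconcave
  open Convex convexP using (Δ)

  instance
    k≢0 : NonZero k
    k≢0 = >-nonZero k>0
    g≢0 : NonZero g
    g≢0 = >-nonZero (≤-trans (s≤s z≤n) g≥8)

  u v : ℕ
  u = a 0
  v = a 1

  v>0 : 0 < v
  v>0 = a>0 1 (s≤s z≤n)

  instance
    v≢0 : NonZero v
    v≢0 = >-nonZero v>0
    u≢0 : NonZero u
    u≢0 = >-nonZero (a>0 0 z≤n)

  -- `Top` at n - M₀ instead of n. Its sequences are those of n shifted by M₀, so its ratio bound
  -- and recurrences serve the tails that start at M₀.
  module At (M₀ : ℕ) (M₀≤J : M₀ ≤ J) where

    private
      split : ∃[ o ] M₀ + suc o ≡ n
      split with m≤n⇒∃[o]m+o≡n (≤-trans M₀≤J (s≤s⁻¹ J<n))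
      ... | o , eq = o , trans (+-suc M₀ o) (cong suc eq)
      o = proj₁ split
      eq = proj₂ split
      o<n : suc o ≤ n
      o<n = ≤-trans (m≤n+m (suc o) M₀) (≤-reflexive eq)
      module S = Top k k>0 P convexP P>0 P-log o (λ m h → logconcave m (≤-trans h o<n))

      a≡ : ∀ j → S.a j ≡ a (M₀ + j)
      a≡ j = trans (sym (rev-shift P M₀ (suc o) j)) (cong (λ t → rev P t (M₀ + j)) eq)
      x≡ : ∀ j → S.x j ≡ x (M₀ + j)
      x≡ j = trans (sym (rev-shift Δ M₀ (suc o) j)) (cong (λ t → rev Δ t (M₀ + j)) eq)
      a≡₀ : S.a 0 ≡ a M₀
      a≡₀ = trans (a≡ 0) (cong a (+-identityʳ M₀))
      a≡₁ : S.a 1 ≡ a (suc M₀)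
      a≡₁ = trans (a≡ 1) (cong a (+-comm M₀ 1))
      x≡₀ : S.x 0 ≡ x M₀
      x≡₀ = trans (x≡ 0) (cong x (+-identityʳ M₀))

    x≤ : 3 * g * x M₀ ≤ 4 * a (suc M₀)
    x≤ = subst (λ t → 3 * g * t ≤ 4 * a (suc M₀)) x≡₀ (subst (λ t → 3 * g * S.x 0 ≤ 4 * t) a≡₁ (S.ratio-upper-g g enough))
      where
      enough : 99 * (k * (g * (3 * g + 4))) ≤ 320 * suc o
      enough = ≤-cert 0 (+-mono-≤ upper-ok (*-monoʳ-≤ 320 M₀≤J)) (trans (cong (λ t → 99 * (k * (g * (3 * g + 4))) + (320 * t + 320 * J) + 0) (sym eq))
        (lem (99 * (k * (g * (3 * g + 4)))) M₀ (suc o) J))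
        where
        lem : ∀ c m o j → c + (320 * (m + o) + 320 * j) + 0 ≡ 320 * o + (c + 320 * j + 320 * m)
        lem = solve-∀

    ∑σa≤ : k * ∑ N (λ l → σ (suc l) * a (M₀ + suc l)) ≤ n * a M₀
    ∑σa≤ = begin
      k * ∑ N (λ l → σ (suc l) * a (M₀ + suc l))  ≡⟨ cong (k *_) (trans (σ-ext (λ l → a (M₀ + suc l)) (s≤s o<n) beyond) (∑-cong S.N (λ l → cong (σ (suc l) *_) (sym (a≡ (suc l)))))) ⟩
      k * ∑ S.N (λ l → σ (suc l) * S.a (suc l))  ≡⟨ S.log₀ ⟨
      suc o * S.a 0  ≤⟨ *-mono-≤ o<n (≤-reflexive a≡₀) ⟩
      n * a M₀  ∎
      where
      open ≤-Reasoning
      beyond : ∀ l → S.N ≤ l → a (M₀ + suc l) ≡ 0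
      beyond l h = trans (sym (a≡ (suc l))) (S.a-0 (suc l) (≤-trans h (n≤1+n l)))

    ∑σx≤ : k * ∑ N (λ l → σ (suc l) * x (M₀ + suc l)) ≤ n * x M₀ + a M₀
    ∑σx≤ = begin
      k * ∑ N (λ l → σ (suc l) * x (M₀ + suc l))  ≡⟨ cong (k *_) (trans (σ-ext (λ l → x (M₀ + suc l)) (s≤s o<n) beyond) (∑-cong S.N (λ l → cong (σ (suc l) *_) (sym (x≡ (suc l)))))) ⟩
      k * ∑ S.N (λ l → σ (suc l) * S.x (suc l))  ≡⟨ S.log-x ⟨
      suc o * S.x 0 + S.a 1  ≤⟨ +-mono-≤ (*-mono-≤ o<n (≤-reflexive x≡₀)) (≤-trans (≤-reflexive a≡₁) (a↓ M₀)) ⟩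
      n * x M₀ + a M₀  ∎
      where
      open ≤-Reasoning
      beyond : ∀ l → S.N ≤ l → x (M₀ + suc l) ≡ 0
      beyond l h = trans (sym (x≡ (suc l))) (S.x-0 (suc l) (≤-trans h (n≤1+n l)))

  n≥8 : 8 ≤ N
  n≥8 = ≤-trans (≤-trans (≤-trans g≥8 (m≤n*m g 6)) (≤-trans (m≤n+m (6 * g) I) (n≤1+n I₂))) (≤-trans (<⇒≤ J<n) (n≤1+n n))

  x₀-lower : g * v + n * v ≤ g * (n * x 0)
  x₀-lower = ratio-lower-arith k g n A v (x 0) k>0 A-lower (ratio-lower n≥8) lower-ok

  v≤gx₀ : v ≤ g * x 0
  v≤gx₀ = *-cancelˡ-≤ n (≤-trans (≤-trans (m≤n+m (n * v) (g * v)) x₀-lower) (≤-reflexive (lem g n (x 0))))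
    where
    lem : ∀ g n y → g * (n * y) ≡ n * (g * y)
    lem = solve-∀

  -- `x-ratio` carries r_n - 1 ≥ 1/g from n to all smaller indices.
  a≤gx : ∀ j → a (suc j) ≤ g * x j
  a≤gx j = *-cancelˡ-≤ v (begin
    v * a (suc j)  ≤⟨ *-monoˡ-≤ (a (suc j)) v≤gx₀ ⟩
    g * x 0 * a (suc j)  ≡⟨ *-assoc g (x 0) _ ⟩
    g * (x 0 * a (suc j))  ≤⟨ *-monoʳ-≤ g (x-ratio j) ⟩
    g * (x j * v)  ≡⟨ lem g (x j) v ⟩
    v * (g * x j)  ∎)
    where
    open ≤-Reasoning
    lem : ∀ g y v → g * (y * v) ≡ v * (g * y)
    lem = solve-∀

  growth₁ : ∀ t j → (g + t) * a (j + t) ≤ g * a j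
  growth₁ zero    j = ≤-reflexive (cong₂ _*_ (+-identityʳ g) (cong a (+-identityʳ j)))
  growth₁ (suc t) j = subst (λ i → (g + suc t) * a i ≤ g * a j) (sym (+-suc j t))
    (growth-arith₁ g t (a (suc (j + t))) (a (suc j)) (x j) (a j) (a-split j)
      (growth₁ t (suc j)) (a≤gx j) (antitone a↓ (s≤s (m≤m+n j t))))

  -- Summing the linear bound `growth₁` over the increments x ≥ a/g produces the quadratic Taylor
  -- term of exp(t/g), up to the correction on the right.
  growth₂ : ∀ t j → (2 * (g * g) + 2 * (g * t) + t * t) * a (j + t) ≤ 2 * (g * g) * a j + t * a (j + t)
  growth₂ zero    j = ≤-reflexive (trans (cong (λ i → (2 * (g * g) + 2 * (g * 0) + 0 * 0) * a i) (+-identityʳ j)) (growth-arith₀ g (a j) (a j)))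
  growth₂ (suc t) j = subst (λ i → (2 * (g * g) + 2 * (g * suc t) + suc t * suc t) * a i ≤ 2 * (g * g) * a j + suc t * a i) (sym (+-suc j t))
    (growth-arith₂ g t (a (suc (j + t))) (a (suc j)) (x j) (a j) (a-split j)
      (growth₂ t (suc j)) (growth₁ t (suc j)) (a≤gx j))

  -- At t = g the quadratic bound gives the factor 5/2 - 1/(2g), which is at least 12/5 once g ≥ 5.
  decay : ∀ j → a (j + g) * 12 ≤ a j * 5
  decay j = *-cancelˡ-≤ (2 * g) {{m*n≢0 2 g}} (*-cancelˡ-≤ g
    (≤-cert 0 (+-mono-≤ (*-monoʳ-≤ 5 (growth₂ g j)) (*-monoˡ-≤ (g * e) (≤-trans (s≤s (s≤s (s≤s (s≤s (s≤s z≤n))))) g≥8))) (lem g e (a j))))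
    where
    e = a (j + g)
    lem : ∀ g e c → g * (2 * g * (e * 12)) + (5 * (2 * (g * g) * c + g * e) + g * (g * e)) + 0 ≡
      g * (2 * g * (c * 5)) + (5 * ((2 * (g * g) + 2 * (g * g) + g * g) * e) + 5 * (g * e))
    lem = solve-∀

  decay^ : ∀ r j → a (j + r * g) * 12 ^ r ≤ a j * 5 ^ r
  decay^ zero    j = ≤-reflexive (cong (λ t → a t * 1) (+-identityʳ j))
  decay^ (suc r) j = begin
    a (j + (g + r * g)) * (12 * 12 ^ r)  ≡⟨ trans (cong (λ t → a t * (12 * 12 ^ r)) (lem₁ j g (r * g))) (lem₂ (a (j + r * g + g)) 12 (12 ^ r)) ⟩
    a (j + r * g + g) * 12 * 12 ^ r  ≤⟨ *-monoˡ-≤ (12 ^ r) (decay (j + r * g)) ⟩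
    a (j + r * g) * 5 * 12 ^ r  ≡⟨ lem₃ (a (j + r * g)) 5 (12 ^ r) ⟩
    a (j + r * g) * 12 ^ r * 5  ≤⟨ *-monoˡ-≤ 5 (decay^ r j) ⟩
    a j * 5 ^ r * 5  ≡⟨ trans (*-assoc (a j) (5 ^ r) 5) (cong (a j *_) (*-comm (5 ^ r) 5)) ⟩
    a j * (5 * 5 ^ r)  ∎
    where
    open ≤-Reasoning
    lem₁ : ∀ j g m → j + (g + m) ≡ j + m + g
    lem₁ = solve-∀
    lem₂ : ∀ e c m → e * (c * m) ≡ e * c * m
    lem₂ = solve-∀
    lem₃ : ∀ e c m → e * c * m ≡ e * m * c
    lem₃ = solve-∀

  -- Beyond g each step divides a by at least 1 + 1/g ≥ 1 + 1/i, which outweighs the growth of i.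
  i*a↑ : ∀ r i → g ≤ i → (i + r) * a (suc (i + r)) ≤ i * a (suc i)
  i*a↑ zero    i g≤i = ≤-reflexive (cong (λ m → m * a (suc m)) (+-identityʳ i))
  i*a↑ (suc r) i g≤i = subst (λ m → m * a (suc m) ≤ i * a (suc i)) (sym (+-suc i r))
    (≤-trans (i*a↑ r (suc i) (≤-trans g≤i (n≤1+n i)))
      (growth-arith₃ i (a (2 + i)) (x (suc i)) (a (suc i)) (a-split (suc i)) (≤-trans (a≤gx (suc i)) (*-monoˡ-≤ (x (suc i)) g≤i))))

  L*g≥21g : 21 * g ≤ I
  L*g≥21g = *-monoˡ-≤ g L≥21

  -- `ShiftedSigma` applies to x from M₀ on: it is antitone by convexity and sums to a M₀, and its
  -- unshifted σ-sum comes from the recurrence at n - M₀.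
  tail-≤ : ∀ i′ M₀ → M₀ ≤ J → suc i′ ≤ J → 20 * g ≤ suc i′ →
    5 * ∑ N (λ l → σ (suc (suc i′ + l)) * x (M₀ + l)) ≤ 12 * (suc i′ * a M₀)
  tail-≤ i′ M₀ M₀≤J i≤J 20g≤i = tail-arith k g i (∑quot i + i) (x M₀) (a M₀) (∑ N (λ l → σ (suc l) * x (M₀ + suc l))) (∑ N (λ l → σ (suc (i + l)) * x (M₀ + l))) n 20g≤i 42≤i
    (subst (λ t → 60 * ∑ N (λ l → σ (suc (i + l)) * x (M₀ + l)) ≤ 60 * ((∑quot i + i) * x M₀) + 180 * t + 99 * (i * t) + 80 * ∑ N (λ l → σ (suc l) * x (M₀ + suc l)))
      (∑x M₀ N ≤-refl)
      (subst (λ t → 60 * ∑ N (λ l → σ (suc (i + l)) * x (M₀ + l)) ≤ 60 * ((∑quot i + i) * x t) + 180 * Z + 99 * (i * Z) + 80 * ∑ N (λ l → σ (suc l) * x (M₀ + suc l)))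
        (+-identityʳ M₀) shifted-σ-≤))
    (At.∑σx≤ M₀ M₀≤J) (≤-trans (At.x≤ M₀ M₀≤J) (*-monoʳ-≤ 4 (a↓ M₀))) (quot-ok i i≤J) n-upper
    where
    i = suc i′
    Z = ∑ N (λ l → x (M₀ + l))
    open ShiftedSigma (λ l → x (M₀ + l)) (λ l → antitone x↓ (+-monoʳ-≤ M₀ (n≤1+n l))) N
      (λ l h → x-0 (M₀ + l) (≤-trans h (m≤n+m l M₀))) i′
    42≤i : 42 ≤ i
    42≤i = ≤-trans (≤-trans (m≤m+n 42 118) (*-monoʳ-≤ 20 g≥8)) 20g≤i

  -- α/β = r_n - 1/n. Proving the tail comparison with this smaller factor reserves u v / n for the
  -- terms beyond I.
  α β : ℕ
  α = n′ * v + n * x 0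
  β = n * v

  -- P (n - 1) times X_{l+1}; the subtraction is exact by log-concavity.
  Y : ℕ → ℕ
  Y l = v * a (suc l) ∸ u * a (2 + l)

  Y-+ : ∀ l → v * a (suc l) ≡ u * a (2 + l) + Y l
  Y-+ l = sym (m+[n∸m]≡n (ratio 0 (suc l)))

  -- Y l / a (l + 2) = v (r_{n-l-1} - r_n), and the ratios grow as the index falls.
  Y-ratio : ∀ r s → Y r * a (2 + (r + s)) ≤ Y (r + s) * a (2 + r)
  Y-ratio r s = arith u v (a (suc r)) (a (2 + r)) (a (suc (r + s))) (a (2 + (r + s))) (Y r) (Y (r + s)) (Y-+ r) (Y-+ (r + s)) (ratio (suc r) s)
    where
    arith : ∀ u v b c d e y z → v * b ≡ u * c + y → v * d ≡ u * e + z → b * e ≤ c * d → y * e ≤ z * c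
    arith u v b c d e y z h₁ h₂ h = +-cancelˡ-≤ (u * c * e) _ _ (begin
      u * c * e + y * e  ≡⟨ *-distribʳ-+ e (u * c) y ⟨
      (u * c + y) * e  ≡⟨ cong (_* e) h₁ ⟨
      v * b * e  ≡⟨ *-assoc v b e ⟩
      v * (b * e)  ≤⟨ *-monoʳ-≤ v h ⟩
      v * (c * d)  ≡⟨ trans (cong (v *_) (*-comm c d)) (sym (*-assoc v d c)) ⟩
      v * d * c  ≡⟨ cong (_* c) h₂ ⟩
      (u * e + z) * c  ≡⟨ *-distribʳ-+ c (u * e) z ⟩
      u * e * c + z * c  ≡⟨ cong (_+ z * c) (trans (*-assoc u e c) (trans (cong (u *_) (*-comm e c)) (sym (*-assoc u c e)))) ⟩
      u * c * e + z * c  ∎)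
      where open ≤-Reasoning

  f₀ f₁ fY : ℕ → ℕ
  f₀ j = σ (suc j) * a (suc j)
  f₁ j = σ (suc j) * a (2 + j)
  fY j = σ (suc j) * Y j

  σ*0 : ∀ j {m} → m ≡ 0 → σ (suc j) * m ≡ 0
  σ*0 j refl = *-zeroʳ (σ (suc j))

  f₀-0 : ∀ j → N ≤ j → f₀ j ≡ 0
  f₀-0 j h = σ*0 j (a-0 (suc j) (≤-trans h (n≤1+n j)))

  f₁-0 : ∀ j → N ≤ j → f₁ j ≡ 0
  f₁-0 j h = σ*0 j (a-0 (2 + j) (≤-trans h (≤-trans (n≤1+n j) (n≤1+n (suc j)))))

  fY-0 : ∀ j → N ≤ j → fY j ≡ 0
  fY-0 j h = σ*0 j (trans (cong (_∸ u * a (2 + j)) (trans (cong (v *_) (a-0 (suc j) (≤-trans h (n≤1+n j)))) (*-zeroʳ v))) (0∸n≡0 (u * a (2 + j))))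

  -- Over j ≥ l these sum σ(j + 2) a (j + 2), σ(j + 1) a (j + 2) and σ(j + 1) Y j. The first starts
  -- one place later in f₀ because Y j has coefficient σ(j + 2) in the recurrence for n + 1.
  Tail₀ Tail₁ TailY : ℕ → ℕ
  Tail₀ l = ∑ N (λ s → f₀ (suc l + s))
  Tail₁ l = ∑ N (λ s → f₁ (l + s))
  TailY l = ∑ N (λ s → fY (l + s))

  near : ∀ l → 2 * u ≤ k * f₀ l → β * Tail₀ l ≤ α * Tail₁ l
  near l h = *-cancelˡ-≤ k (≤-trans (≤-reflexive (swap k β (Tail₀ l))) (≤-trans
    (near-arith n′ u v (x 0) (k * ∑ l f₀) (k * f₀ l) (k * ∑ l f₁) (k * Tail₀ l) (k * Tail₁ l) (a-split 0)
      eq₀ eq₁ prefix h) (≤-reflexive (swap α k (Tail₁ l)))))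
    where
    swap : ∀ a b c → a * (b * c) ≡ b * (a * c)
    swap a b c = trans (sym (*-assoc a b c)) (trans (cong (_* c) (*-comm a b)) (*-assoc b a c))
    open ≡-Reasoning
    eq₀ : k * ∑ l f₀ + k * f₀ l + k * Tail₀ l ≡ n * u
    eq₀ = begin
      k * ∑ l f₀ + k * f₀ l + k * Tail₀ l  ≡⟨ cong (_+ k * Tail₀ l) (*-distribˡ-+ k (∑ l f₀) (f₀ l)) ⟨
      k * ∑ (suc l) f₀ + k * Tail₀ l  ≡⟨ *-distribˡ-+ k (∑ (suc l) f₀) (Tail₀ l) ⟨
      k * (∑ (suc l) f₀ + Tail₀ l)  ≡⟨ cong (k *_) (∑-tail N (suc l) f₀ f₀-0) ⟨
      k * ∑ N f₀  ≡⟨ log₀ ⟨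
      n * u  ∎
    eq₁ : k * ∑ l f₁ + k * Tail₁ l ≡ n′ * v
    eq₁ = trans (sym (*-distribˡ-+ k (∑ l f₁) (Tail₁ l))) (trans (cong (k *_) (sym (∑-tail N l f₁ f₁-0))) (sym log₁))
    prefix : u * (k * ∑ l f₁) ≤ v * (k * ∑ l f₀)
    prefix = ≤-trans (≤-reflexive (swap u k (∑ l f₁))) (≤-trans (*-monoʳ-≤ k
      (≤-trans (≤-reflexive (sym (∑-*ˡ l u f₁))) (≤-trans (∑-mono l (λ s →
        ≤-trans (≤-reflexive (swap u (σ (suc s)) _)) (≤-trans (*-monoʳ-≤ (σ (suc s)) (ratio 0 (suc s))) (≤-reflexive (swap (σ (suc s)) v _)))))
        (≤-reflexive (∑-*ˡ l v f₀))))) (≤-reflexive (swap k v (∑ l f₀))))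

  x≤ : ∀ j → j ≤ J → 3 * g * x j ≤ 4 * a (suc j)
  x≤ j = At.x≤ j

  -- At most 3g/16 drops of at most 4a/(3g) each lose no more than a quarter.
  quarter : ∀ j t → j ≤ J → t ≤ b → 3 * a j ≤ 4 * a (j + t)
  quarter j t j≤J t≤b = quarter-arith g b (x j) (a j) (a (j + t)) (∑ t (λ s → x (j + s))) (telescope j t) drop
    (≤-trans (x≤ j j≤J) (*-monoʳ-≤ 4 (a↓ j))) b-upper
    where
    drop : ∑ t (λ s → x (j + s)) ≤ b * x j
    drop = ≤-trans (∑-mono t (λ s → antitone x↓ (m≤m+n j s))) (≤-trans (≤-reflexive (∑-const t (x j))) (*-monoˡ-≤ (x j) t≤b))

  quarter^ : ∀ q → q * b ≤ J → a 0 * 3 ^ q ≤ a (q * b) * 4 ^ q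
  quarter^ zero    _ = ≤-refl
  quarter^ (suc q) h = begin
    a 0 * (3 * 3 ^ q)  ≡⟨ trans (cong (a 0 *_) (*-comm 3 (3 ^ q))) (sym (*-assoc (a 0) (3 ^ q) 3)) ⟩
    a 0 * 3 ^ q * 3  ≤⟨ *-monoˡ-≤ 3 (quarter^ q qb≤J) ⟩
    a (q * b) * 4 ^ q * 3  ≡⟨ trans (*-comm (a (q * b) * 4 ^ q) 3) (sym (*-assoc 3 (a (q * b)) (4 ^ q))) ⟩
    3 * a (q * b) * 4 ^ q  ≤⟨ *-monoˡ-≤ (4 ^ q) (quarter (q * b) b qb≤J ≤-refl) ⟩
    4 * a (q * b + b) * 4 ^ q  ≡⟨ cong (λ t → 4 * a t * 4 ^ q) (+-comm (q * b) b) ⟩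
    4 * a (b + q * b) * 4 ^ q  ≡⟨ trans (cong (_* 4 ^ q) (*-comm 4 (a (b + q * b)))) (*-assoc (a (b + q * b)) 4 (4 ^ q)) ⟩
    a (b + q * b) * (4 * 4 ^ q)  ∎
    where
    open ≤-Reasoning
    qb≤J : q * b ≤ J
    qb≤J = ≤-trans (m≤n+m (q * b) b) h

  2g≤I : 2 * g ≤ I
  2g≤I = ≤-trans (*-monoˡ-≤ g (s≤s (s≤s (z≤n {19})))) L*g≥21g

  I≤J : I ≤ J
  I≤J = ≤-trans (m≤m+n I (6 * g)) (n≤1+n I₂)

  -- Write l + 1 = q b + t. Then a (l + 1) ≥ (3/4)^(q+1) u by `quarter`, while b ≥ 6 gives σ(l + 1)
  -- ≥ 1 + 6q; 2g < 13b confines q to the range of `powers`.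
  2u≤ : ∀ l → suc l ≤ 2 * g → 2 * u ≤ k * f₀ l
  2u≤ l l<2g = *-cancelʳ-≤ (2 * u) (k * f₀ l) (4 ^ suc q) {{m^n≢0 4 (suc q)}} (begin
    2 * u * 4 ^ suc q  ≡⟨ trans (cong (_* 4 ^ suc q) (*-comm 2 u)) (*-assoc u 2 (4 ^ suc q)) ⟩
    u * (2 * 4 ^ suc q)  ≤⟨ *-monoʳ-≤ u (powers q q<13) ⟩
    u * (3 ^ suc q * (3 * suc (6 * q)))  ≡⟨ *-assoc u (3 ^ suc q) _ ⟨
    u * 3 ^ suc q * (3 * suc (6 * q))  ≤⟨ *-mono-≤ u≤ (*-mono-≤ k≥3 σ-big) ⟩
    a (suc l) * 4 ^ suc q * (k * σ (suc l)) ≡⟨ lem (a (suc l)) (4 ^ suc q) k (σ (suc l)) ⟩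
    k * f₀ l * 4 ^ suc q  ∎)
    where
    open ≤-Reasoning
    instance
      b≢0 : NonZero b
      b≢0 = >-nonZero (≤-trans (s≤s z≤n) b≥6)
    q = suc l / b
    t = suc l % b
    eq : suc l ≡ t + q * b
    eq = m≡m%n+[m/n]*n (suc l) b
    qb≤ : q * b ≤ suc l
    qb≤ = m/n*n≤m (suc l) b
    q<13 : q < 13
    q<13 = *-cancelʳ-< b q 13 (≤-<-trans qb≤ (≤-<-trans l<2g b-lower))
    lem : ∀ a f k s → a * f * (k * s) ≡ k * (s * a) * f
    lem = solve-∀
    qb≤J : q * b ≤ J
    qb≤J = ≤-trans qb≤ (≤-trans l<2g (≤-trans 2g≤I I≤J))
    u≤ : u * 3 ^ suc q ≤ a (suc l) * 4 ^ suc q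
    u≤ = begin
      u * (3 * 3 ^ q)  ≡⟨ trans (cong (u *_) (*-comm 3 (3 ^ q))) (sym (*-assoc u (3 ^ q) 3)) ⟩
      u * 3 ^ q * 3  ≤⟨ *-monoˡ-≤ 3 (quarter^ q qb≤J) ⟩
      a (q * b) * 4 ^ q * 3  ≡⟨ trans (*-comm (a (q * b) * 4 ^ q) 3) (sym (*-assoc 3 (a (q * b)) (4 ^ q))) ⟩
      3 * a (q * b) * 4 ^ q  ≤⟨ *-monoˡ-≤ (4 ^ q) (quarter (q * b) t qb≤J (<⇒≤ (m%n<n (suc l) b))) ⟩
      4 * a (q * b + t) * 4 ^ q  ≡⟨ cong (λ s → 4 * a s * 4 ^ q) (trans (+-comm (q * b) t) (sym eq)) ⟩
      4 * a (suc l) * 4 ^ q  ≡⟨ trans (cong (_* 4 ^ q) (*-comm 4 (a (suc l)))) (*-assoc (a (suc l)) 4 (4 ^ q)) ⟩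
      a (suc l) * (4 * 4 ^ q)  ∎
    σ-big : suc (6 * q) ≤ σ (suc l)
    σ-big = σ-low l q (≤-trans (≤-reflexive (*-comm 6 q)) (≤-trans (*-monoʳ-≤ q b≥6) qb≤))

  tail-≤′ : ∀ i M₀ → M₀ ≤ J → i ≤ J → 20 * g ≤ i →
    5 * ∑ N (λ l → σ (suc (i + l)) * x (M₀ + l)) ≤ 12 * (i * a M₀)
  tail-≤′ zero    M₀ _    _   h = ⊥-elim (n≮0 (≤-trans (*-monoʳ-≤ 20 g≥8) h))
  tail-≤′ (suc i) M₀ M₀≤J i≤J h = tail-≤ i M₀ M₀≤J i≤J h

  20g≤I : 20 * g ≤ I
  20g≤I = ≤-trans (*-monoˡ-≤ g (n≤1+n 20)) L*g≥21g

  I≤I₂ : I ≤ I₂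
  I≤I₂ = m≤m+n I (6 * g)

  -- The ratio bound 1 + 4/(3g) is available only for j ≤ J. Past I₂ the increment x itself is kept
  -- as an error, collected in `T₂`.
  y : ℕ → ℕ
  y j with j ≤? I₂
  ... | yes _ = 0
  ... | no  _ = x j

  y-low : ∀ j → j ≤ I₂ → y j ≡ 0
  y-low j h with j ≤? I₂
  ... | yes _ = refl
  ... | no nh = contradiction h nh

  y≤x : ∀ j → y j ≤ x j
  y≤x j with j ≤? I₂
  ... | yes _ = z≤n
  ... | no  _ = ≤-refl

  y-split : ∀ j → 3 * g * a j ≤ (3 * g + 4) * a (suc j) + 3 * g * y j
  y-split j = split-arith g (a (suc j)) (a j) (x j) (y j) (a-split j) cases
    where
    cases : x j ≤ y j ⊎ 3 * g * x j ≤ 4 * a (suc j)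
    cases with j ≤? I₂
    ... | yes h = inj₂ (x≤ j (≤-trans h (n≤1+n I₂)))
    ... | no  _ = inj₁ ≤-refl

  T₂ : ℕ
  T₂ = ∑ N (λ s → σ (suc (I₂ + s)) * x (suc I₂ + s))

  S₁ : ℕ → ℕ
  S₁ l = ∑ N (λ s → f₁ (suc l + s))

  Tail₀-split : ∀ l → suc l ≤ I → 3 * g * Tail₀ l ≤ (3 * g + 4) * S₁ l + 3 * g * T₂
  Tail₀-split l l<I with m≤n⇒∃[o]m+o≡n (≤-trans l<I I≤I₂)
  ... | r , eq = begin
    3 * g * Tail₀ l  ≡⟨ ∑-*ˡ N (3 * g) _ ⟨
    ∑ N (λ s → 3 * g * f₀ (i + s))  ≤⟨ ∑-mono N (λ s → term (i + s)) ⟩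
    ∑ N (λ s → (3 * g + 4) * f₁ (i + s) + 3 * g * h (i + s))  ≡⟨ trans (∑-+ N _ _) (cong₂ _+_ (∑-*ˡ N (3 * g + 4) _) (∑-*ˡ N (3 * g) _)) ⟩
    (3 * g + 4) * S₁ l + 3 * g * ∑ N (λ s → h (i + s))  ≤⟨ +-monoʳ-≤ ((3 * g + 4) * S₁ l) (*-monoʳ-≤ (3 * g) h≤) ⟩
    (3 * g + 4) * S₁ l + 3 * g * T₂  ∎
    where
    open ≤-Reasoning
    i = suc l
    h : ℕ → ℕ
    h j = σ (suc j) * y (suc j)
    term : ∀ j → 3 * g * f₀ j ≤ (3 * g + 4) * f₁ j + 3 * g * h j
    term j = ≤-trans (≤-reflexive (swap (3 * g) (σ (suc j)) (a (suc j)))) (≤-trans (*-monoʳ-≤ (σ (suc j)) (y-split (suc j)))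
      (≤-reflexive (lem (σ (suc j)) (3 * g + 4) (3 * g) (a (2 + j)) (y (suc j)))))
      where
      swap : ∀ a b c → a * (b * c) ≡ b * (a * c)
      swap = solve-∀
      lem : ∀ s p q c z → s * (p * c + q * z) ≡ p * (s * c) + q * (s * z)
      lem = solve-∀
    h≤ : ∑ N (λ s → h (i + s)) ≤ T₂
    h≤ = begin
      ∑ N (λ s → h (i + s))  ≤⟨ ∑-prefix _ (m≤n+m N r) ⟩
      ∑ (r + N) (λ s → h (i + s))  ≡⟨ ∑-pad r N _ (λ s s<r → trans (cong (σ (suc (i + s)) *_) (y-low (suc (i + s)) (≤-trans (+-monoʳ-< i s<r) (≤-reflexive eq)))) (*-zeroʳ (σ (suc (i + s))))) ⟩
      ∑ N (λ s → h (i + (r + s)))  ≡⟨ ∑-cong N (λ s → cong h (trans (sym (+-assoc i r s)) (cong (_+ s) eq))) ⟩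
      ∑ N (λ s → h (I₂ + s))  ≤⟨ ∑-mono N (λ s → *-monoʳ-≤ (σ (suc (I₂ + s))) (y≤x (suc (I₂ + s)))) ⟩
      T₂  ∎

  -- Six stretches of length g between I and I₂ make T₂ small against I a (I + 1), and `i*a↑`
  -- carries this back to every i from g to I.
  T₂≤ : ∀ i → g ≤ i → i ≤ I → 60 * T₂ ≤ i * a (suc i)
  T₂≤ i g≤i i≤I with m≤n⇒∃[o]m+o≡n i≤I
  ... | r , eq = rest-arith T₂ I I₂ (a (suc I)) (a (suc I₂)) (i * a (suc i))
    (tail-≤′ I₂ (suc I₂) ≤-refl (n≤1+n I₂) (≤-trans 20g≤I I≤I₂)) (I₂-arith g I L*g≥21g) (decay^ 6 (suc I))
    (subst (λ m → m * a (suc m) ≤ i * a (suc i)) eq (i*a↑ r i g≤i))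

  far : ∀ l → 2 * g ≤ suc l → suc l ≤ I → β * Tail₀ l ≤ α * Tail₁ l
  far l 2g≤i i≤I = *-cancelˡ-≤ g (begin
    g * (β * Tail₀ l)  ≡⟨ swap g β (Tail₀ l) ⟩
    β * (g * Tail₀ l)  ≤⟨ *-monoʳ-≤ β main ⟩
    β * (suc g * Tail₁ l)  ≡⟨ trans (swap β (suc g) (Tail₁ l)) (sym (*-assoc (suc g) β (Tail₁ l))) ⟩
    suc g * β * Tail₁ l  ≤⟨ *-monoˡ-≤ (Tail₁ l) (αβ-arith g n′ v (x 0) x₀-lower) ⟩
    g * α * Tail₁ l  ≡⟨ *-assoc g α (Tail₁ l) ⟩
    g * (α * Tail₁ l)  ∎)
    where
    open ≤-Reasoning
    i = suc l
    w = a (suc i)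
    z : ℕ → ℕ
    z s = a (2 + (i + s))
    Z = ∑ N z
    open ShiftedSigma z (λ s → antitone a↓ (s≤s (s≤s (+-monoʳ-≤ i (n≤1+n s))))) N
      (λ s h → a-0 (2 + (i + s)) (≤-trans h (≤-trans (m≤n+m s i) (m≤n+m (i + s) 2)))) l
    swap : ∀ a b c → a * (b * c) ≡ b * (a * c)
    swap a b c = trans (sym (*-assoc a b c)) (trans (cong (_* c) (*-comm a b)) (*-assoc b a c))
    i≤J : i ≤ J
    i≤J = ≤-trans i≤I I≤J
    2+i≤J : 2 + i ≤ J
    2+i≤J = s≤s (≤-trans (≤-reflexive (sym (+-comm i 1))) (+-mono-≤ i≤I (≤-trans (≤-trans (s≤s z≤n) g≥8) (m≤n*m g 6))))
    Z≤ : Z ≤ g * w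
    Z≤ = ≤-trans (∑-mono N (λ s → a≤gx (suc (i + s)))) (≤-reflexive (trans (∑-*ˡ N g _) (cong (g *_) (∑x (suc i) N ≤-refl))))
    S₂ = ∑ N (λ s → σ (suc s) * z (suc s))
    bound : 60 * S₁ l ≤ 60 * ((∑quot i + i) * w) + 180 * Z + 99 * (i * Z) + 80 * S₂
    bound = ≤-trans shifted-σ-≤ (+-monoˡ-≤ (80 * S₂) (+-monoˡ-≤ (99 * (i * Z)) (+-monoˡ-≤ (180 * Z)
      (*-monoʳ-≤ 60 (*-monoʳ-≤ (∑quot i + i) (antitone a↓ (≤-trans (m≤m+n (suc i) 0) (n≤1+n (suc (i + 0)))))))) ))
    main : g * Tail₀ l ≤ suc g * Tail₁ l
    main = ≤-trans (far-arith k g i (∑quot i + i) n w (σ i) Z (Tail₀ l) (S₁ l) S₂ T₂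
      (Tail₀-split l i≤I) (T₂≤ i (≤-trans (m≤n*m g 2) 2g≤i) i≤I) bound Z≤
      (≤-trans (At.∑σa≤ (2 + i) 2+i≤J) (*-monoʳ-≤ n (a↓ (suc i)))) n-upper (quot-ok i i≤J) 2g≤i (σ-big l 2g≤i))
      (*-monoʳ-≤ (suc g) (≤-reflexive (sym (∑-tail-suc N l f₁ f₁-0))))
      where
      σ-big : ∀ l → 2 * g ≤ suc l → 2 + l ≤ σ (suc l)
      σ-big zero    h with ≤-trans (*-monoʳ-≤ 2 g≥8) h
      ... | s≤s ()
      σ-big (suc l) _ = σ≥ l

  tails : ∀ l → suc l ≤ I → β * Tail₀ l ≤ α * Tail₁ l
  tails l l<I with ≤-total (suc l) (2 * g)
  ... | inj₁ h = near l (2u≤ l h)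
  ... | inj₂ h = far l h l<I

  ∑σY : k * TailY 0 ≡ u * v
  ∑σY = +-cancelˡ-≡ (u * (n′ * v)) _ _ (begin
    u * (n′ * v) + k * TailY 0  ≡⟨ cong (λ t → u * t + k * TailY 0) log₁ ⟩
    u * (k * ∑ N f₁) + k * TailY 0  ≡⟨ lem₁ u k (∑ N f₁) (TailY 0) ⟩
    k * (u * ∑ N f₁ + TailY 0)  ≡⟨ cong (k *_) sums ⟨
    k * (v * ∑ N f₀)  ≡⟨ lem₂ k v (∑ N f₀) ⟩
    v * (k * ∑ N f₀)  ≡⟨ cong (v *_) log₀ ⟨
    v * (n * u)  ≡⟨ lem₃ v n′ u ⟩
    u * (n′ * v) + u * v  ∎)
    where
    open ≡-Reasoning
    lem₁ : ∀ u k s t → u * (k * s) + k * t ≡ k * (u * s + t)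
    lem₁ = solve-∀
    lem₂ : ∀ k v s → k * (v * s) ≡ v * (k * s)
    lem₂ = solve-∀
    lem₃ : ∀ v m u → v * (suc m * u) ≡ u * (m * v) + u * v
    lem₃ = solve-∀
    term : ∀ j → v * f₀ j ≡ u * f₁ j + fY j
    term j = trans (lem₂ v (σ (suc j)) (a (suc j))) (trans (cong (σ (suc j) *_) (Y-+ j))
      (trans (*-distribˡ-+ (σ (suc j)) (u * a (2 + j)) (Y j)) (cong (_+ fY j) (lem₂ (σ (suc j)) u (a (2 + j))))))
    sums : v * ∑ N f₀ ≡ u * ∑ N f₁ + TailY 0
    sums = trans (sym (∑-*ˡ N v f₀)) (trans (∑-cong N term) (trans (∑-+ N _ fY) (cong (_+ TailY 0) (∑-*ˡ N u f₁))))

  gY : ℕ → ℕ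
  gY j = σ (2 + j) * Y j

  near-sum : β * (k * ∑ I gY) ≤ α * (u * v)
  near-sum with m≤n⇒∃[o]m+o≡n {1} {I} (≤-trans (s≤s z≤n) (≤-trans (*-mono-≤ (m≤n+m 1 20) (≤-trans (s≤s z≤n) g≥8)) L*g≥21g))
  ... | r , eq = begin
    β * (k * ∑ I gY)  ≡⟨ swap β k (∑ I gY) ⟩
    k * (β * ∑ I gY)  ≡⟨ cong (k *_) (trans (cong (λ M → β * ∑ M gY) (sym eq)) (trans (sym (∑-*ˡ (suc r) β gY)) (∑-cong (suc r) (λ s → sym (*-assoc β (σ (2 + s)) (Y s)))))) ⟩
    k * ∑ (suc r) (λ s → β * σ (2 + s) * Y s)  ≤⟨ *-monoʳ-≤ k (Ab.conclusion r (λ s s≤r → tails s (≤-trans (s≤s s≤r) (≤-reflexive eq)))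
                                                            (λ s s≤r → a>0 (2 + s) (≤-trans (s≤s (s≤s s≤r)) 2+r≤n)) base) ⟩
    k * (α * TailY 0)  ≡⟨ swap k α (TailY 0) ⟩
    α * (k * TailY 0)  ≡⟨ cong (α *_) ∑σY ⟩
    α * (u * v)  ∎
    where
    open ≤-Reasoning
    swap : ∀ a b c → a * (b * c) ≡ b * (a * c)
    swap a b c = trans (sym (*-assoc a b c)) (trans (cong (_* c) (*-comm a b)) (*-assoc b a c))
    weighted-suc : ∀ c {h} (q w : ℕ → ℕ) l → (∀ j → N ≤ j → h j ≡ 0) → h l ≡ q l * w l →
      c * ∑ N (λ s → h (l + s)) ≡ c * q l * w l + c * ∑ N (λ s → h (suc l + s))
    weighted-suc c {h} q w l h0 eq = trans (cong (c *_) (∑-tail-suc N l h h0))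
      (trans (*-distribˡ-+ c (h l) _) (cong (_+ c * ∑ N (λ s → h (suc l + s))) (trans (cong (c *_) eq) (sym (*-assoc c (q l) (w l))))))
    module Ab = Abel (λ l → β * σ (2 + l)) (λ l → α * σ (suc l)) (λ l → a (2 + l)) Y
      (λ l → β * Tail₀ l) (λ l → α * Tail₁ l) (λ l → α * TailY l)
      (λ l → weighted-suc β {f₀} (λ m → σ (suc m)) (λ m → a (suc m)) (suc l) f₀-0 refl)
      (λ l → weighted-suc α {f₁} (λ m → σ (suc m)) (λ m → a (2 + m)) l f₁-0 refl)
      (λ l → weighted-suc α {fY} (λ m → σ (suc m)) Y l fY-0 refl)
      (λ l → subst (λ m → Y l * a (2 + m) ≤ Y m * a (2 + l)) (+-comm l 1) (Y-ratio l 1))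
    2+r≤n : 2 + r ≤ n
    2+r≤n = ≤-trans (s≤s (≤-trans (≤-reflexive eq) I≤J)) J<n
    -- Past the cap the tails of f₀ and f₁ are not compared; there Y / a still grows, so `TailY`
    -- dominates `Tail₁` term by term.
    base : Y r * (α * Tail₁ (suc r)) ≤ a (2 + r) * (α * TailY (suc r))
    base = ≤-trans (≤-reflexive (swap (Y r) α (Tail₁ (suc r)))) (≤-trans (*-monoʳ-≤ α (begin
      Y r * Tail₁ (suc r)  ≡⟨ ∑-*ˡ N (Y r) _ ⟨
      ∑ N (λ s → Y r * f₁ (suc r + s))  ≤⟨ ∑-mono N term ⟩
      ∑ N (λ s → a (2 + r) * fY (suc r + s))  ≡⟨ ∑-*ˡ N (a (2 + r)) _ ⟩
      a (2 + r) * TailY (suc r)  ∎)) (≤-reflexive (swap α (a (2 + r)) (TailY (suc r)))))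
      where
      term : ∀ s → Y r * f₁ (suc r + s) ≤ a (2 + r) * fY (suc r + s)
      term s = ≤-trans (≤-reflexive (swap (Y r) (σ (2 + (r + s))) (a (3 + (r + s)))))
        (≤-trans (*-monoʳ-≤ (σ (2 + (r + s))) (≤-trans (subst (λ m → Y r * a (2 + m) ≤ Y m * a (2 + r)) (+-suc r s) (Y-ratio r (suc s))) (≤-reflexive (*-comm (Y (suc (r + s))) (a (2 + r))))))
          (≤-reflexive (swap (σ (2 + (r + s))) (a (2 + r)) (Y (suc (r + s))))))

  -- u ≥ v gives Y j ≤ v x (j + 1). Then `tail-≤` bounds the sum by (12/5) (I + 1) a (I + 1), and L
  -- stretches of `decay` give a I ≤ (5/12)^L u.
  far-sum : n * (k * ∑ N (λ s → gY (I + s))) < u * v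
  far-sum = begin-strict
    n * (k * ∑ N (λ s → gY (I + s)))  ≤⟨ *-monoʳ-≤ n (*-monoʳ-≤ k Y≤) ⟩
    n * (k * (v * FX))  ≡⟨ lem₁ n k v FX ⟩
    n * k * FX * v  <⟨ *-monoˡ-< v nkFX<u ⟩
    u * v  ∎
    where
    open ≤-Reasoning
    FX = ∑ N (λ s → σ (suc (suc I + s)) * x (suc I + s))
    lem₁ : ∀ n k v f → n * (k * (v * f)) ≡ n * k * f * v
    lem₁ = solve-∀
    Yj≤ : ∀ j → Y j ≤ v * x (suc j)
    Yj≤ j = m≤n+o⇒m∸n≤o (v * a (suc j)) (u * a (2 + j)) (≤-trans (≤-reflexive (trans (cong (v *_) (a-split (suc j))) (*-distribˡ-+ v (a (2 + j)) (x (suc j)))))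
      (+-monoˡ-≤ (v * x (suc j)) (*-monoˡ-≤ (a (2 + j)) (a↓ 0))))
    Y≤ : ∑ N (λ s → gY (I + s)) ≤ v * FX
    Y≤ = ≤-trans (∑-mono N (λ s → ≤-trans (*-monoʳ-≤ (σ (2 + (I + s))) (Yj≤ (I + s))) (≤-reflexive (lem₂ (σ (2 + (I + s))) v _)))) (≤-reflexive (∑-*ˡ N v _))
      where
      lem₂ : ∀ s v y → s * (v * y) ≡ v * (s * y)
      lem₂ = solve-∀
    1+I≤J : suc I ≤ J
    1+I≤J = s≤s I≤I₂
    nkFX<u : n * k * FX < u
    nkFX<u = *-cancelʳ-< (5 * 12 ^ L) (n * k * FX) u (begin-strict
      n * k * FX * (5 * 12 ^ L)  ≡⟨ lem₃ (n * k) FX (12 ^ L) ⟩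
      n * k * (12 ^ L * (5 * FX))  ≤⟨ *-monoʳ-≤ (n * k) (*-monoʳ-≤ (12 ^ L) (tail-≤′ (suc I) (suc I) 1+I≤J 1+I≤J (≤-trans 20g≤I (n≤1+n I)))) ⟩
      n * k * (12 ^ L * (12 * (suc I * a (suc I))))  ≤⟨ *-monoʳ-≤ (n * k) (*-monoʳ-≤ (12 ^ L) (*-monoʳ-≤ 12 (*-monoʳ-≤ (suc I) (a↓ I)))) ⟩
      n * k * (12 ^ L * (12 * (suc I * a I)))  ≡⟨ lem₄ (n * k) (12 ^ L) (suc I) (a I) ⟩
      n * k * (12 * suc I) * (a I * 12 ^ L)  ≤⟨ *-monoʳ-≤ (n * k * (12 * suc I)) (decay^ L 0) ⟩
      n * k * (12 * suc I) * (u * 5 ^ L)  ≡⟨ lem₅ (n * k * (12 * suc I)) u (5 ^ L) ⟩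
      u * (n * k * (12 * suc I) * 5 ^ L)  <⟨ *-monoʳ-< u far-ok ⟩
      u * (5 * 12 ^ L)  ∎)
      where
      lem₃ : ∀ m f p → m * f * (5 * p) ≡ m * (p * (5 * f))
      lem₃ = solve-∀
      lem₄ : ∀ m p i c → m * (p * (12 * (i * c))) ≡ m * (12 * i) * (c * p)
      lem₄ = solve-∀
      lem₅ : ∀ m u p → m * (u * p) ≡ u * (m * p)
      lem₅ = solve-∀

  -- The recurrence for n + 1 times v, with v a (s + 1) = u a (s + 2) + Y s. As σ(1) = 1, the first
  -- term u v completes the u-part to u times the recurrence for n.
  next : v * (suc n * P (suc n)) ≡ n * (u * u) + (k * ∑ I gY + k * ∑ N (λ s → gY (I + s)))
  next = begin
    v * (suc n * P (suc n))  ≡⟨ cong (v *_) (P-log (suc n)) ⟩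
    v * (k * ∑ N h)  ≡⟨ cong (λ t → v * (k * t)) (∑-tail-suc N 0 h (λ j N≤j → σ*0 j (a-0 j N≤j))) ⟩
    v * (k * (1 * u + ∑ N (λ s → h (suc s))))  ≡⟨ lem₁ v k u (∑ N (λ s → h (suc s))) ⟩
    k * (u * v + v * ∑ N (λ s → h (suc s)))  ≡⟨ cong (λ t → k * (u * v + t)) sums ⟩
    k * (u * v + (u * ∑ N (λ s → f₀ (suc s)) + ∑ N gY)) ≡⟨ lem₂ k u v (∑ N (λ s → f₀ (suc s))) (∑ N gY) ⟩
    u * (k * (1 * v + ∑ N (λ s → f₀ (suc s)))) + k * ∑ N gY ≡⟨ cong₂ (λ s t → u * (k * s) + k * t) (sym (∑-tail-suc N 0 f₀ f₀-0)) (∑-tail N I gY gY-0) ⟩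
    u * (k * ∑ N f₀) + k * (∑ I gY + ∑ N (λ s → gY (I + s))) ≡⟨ cong₂ _+_ (cong (u *_) (sym log₀)) (*-distribˡ-+ k _ _) ⟩
    u * (n * u) + (k * ∑ I gY + k * ∑ N (λ s → gY (I + s))) ≡⟨ cong (_+ (k * ∑ I gY + k * ∑ N (λ s → gY (I + s)))) (lem₃ u n′) ⟩
    n * (u * u) + (k * ∑ I gY + k * ∑ N (λ s → gY (I + s))) ∎
    where
    open ≡-Reasoning
    h : ℕ → ℕ
    h j = σ (suc j) * a j
    gY-0 : ∀ j → N ≤ j → gY j ≡ 0
    gY-0 j N≤j = trans (cong (σ (2 + j) *_) (trans (cong (_∸ u * a (2 + j)) (trans (cong (v *_) (a-0 (suc j) (≤-trans N≤j (n≤1+n j)))) (*-zeroʳ v))) (0∸n≡0 (u * a (2 + j))))) (*-zeroʳ (σ (2 + j)))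
    lem₁ : ∀ v k u s → v * (k * (1 * u + s)) ≡ k * (u * v + v * s)
    lem₁ = solve-∀
    lem₂ : ∀ k u v s t → k * (u * v + (u * s + t)) ≡ u * (k * (1 * v + s)) + k * t
    lem₂ = solve-∀
    lem₃ : ∀ u m → u * (suc m * u) ≡ suc m * (u * u)
    lem₃ = solve-∀
    sums : v * ∑ N (λ s → h (suc s)) ≡ u * ∑ N (λ s → f₀ (suc s)) + ∑ N gY
    sums = trans (sym (∑-*ˡ N v _)) (trans (∑-cong N term) (trans (∑-+ N _ gY) (cong (_+ ∑ N gY) (∑-*ˡ N u _))))
      where
      lem₄ : ∀ v s c → v * (s * c) ≡ s * (v * c)
      lem₄ = solve-∀
      term : ∀ s → v * h (suc s) ≡ u * f₀ (suc s) + gY s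
      term s = trans (lem₄ v (σ (2 + s)) (a (suc s))) (trans (cong (σ (2 + s) *_) (Y-+ s))
        (trans (*-distribˡ-+ (σ (2 + s)) (u * a (2 + s)) (Y s)) (cong (_+ gY s) (lem₄ (σ (2 + s)) u (a (2 + s))))))

  step : P n′ * P (suc n) < P n * P n
  step = final-arith n′ u v (x 0) (k * ∑ I gY) (k * ∑ N (λ s → gY (I + s))) (P (suc n)) (a-split 0) near-sum far-sum next

-- The parameters of the induction step for large n

-- Divide by n g². Bounding n/g² by 5k/4 in the leading term and 1/n by 1/(3g²) in the last leaves a
-- polynomial in 1/g with nonnegative coefficients, so the numerical case at G settles all g ≥ G.
margin-arith : ∀ k g n G A c K → G ≤ g → 0 < G → 4 * n ≤ 5 * (k * (g * g)) → 3 * (g * g) ≤ n →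
  165 * (k * k * (A * A)) * (G * G) + 132 * (k * A * (c + c + K)) * G + 44 * (k * c * (c + K)) ≤ 80 * (K * K) * (G * G) →
  33 * (k * ((n * A + g * c) * (n * A + g * c + K * g))) ≤ 20 * (n * (K * K * (g * g)))
margin-arith k g n G A c K G≤g G>0 h₁ h₂ h = *-cancelˡ-≤ (4 * (G * G)) {{m*n≢0 4 (G * G) {{_}} {{m*n≢0 G G {{G≢0}} {{G≢0}}}}}} (begin
  4 * (G * G) * (33 * (k * ((n * A + g * c) * (n * A + g * c + K * g))))  ≡⟨ l₁ G k n A g c K ⟩
  G * G * (33 * (k * A * A * n) * (4 * n) + q * g * n + r * (3 * (g * g)))
    ≤⟨ *-monoʳ-≤ (G * G) (+-mono-≤ (+-monoˡ-≤ (q * g * n) (*-monoʳ-≤ (33 * (k * A * A * n)) h₁)) (*-monoʳ-≤ r h₂)) ⟩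
  G * G * (33 * (k * A * A * n) * (5 * (k * (g * g))) + q * g * n + r * n) ≡⟨ l₂ G k n A g q r ⟩
  n * (165 * (k * k * (A * A)) * (G * G) * (g * g) + q * G * (g * G) + r * (G * G))
    ≤⟨ *-monoʳ-≤ n (+-mono-≤ (+-monoʳ-≤ (165 * (k * k * (A * A)) * (G * G) * (g * g)) (*-monoʳ-≤ (q * G) (*-monoʳ-≤ g G≤g))) (*-monoʳ-≤ r (*-mono-≤ G≤g G≤g))) ⟩
  n * (165 * (k * k * (A * A)) * (G * G) * (g * g) + q * G * (g * g) + r * (g * g)) ≡⟨ l₃ n (165 * (k * k * (A * A)) * (G * G)) (q * G) r (g * g) ⟩
  n * (g * g) * (165 * (k * k * (A * A)) * (G * G) + q * G + r)  ≤⟨ *-monoʳ-≤ (n * (g * g)) h ⟩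
  n * (g * g) * (80 * (K * K) * (G * G))  ≡⟨ l₄ n g K G ⟩
  4 * (G * G) * (20 * (n * (K * K * (g * g))))  ∎)
  where
  open ≤-Reasoning
  G≢0 : NonZero G
  G≢0 = >-nonZero G>0
  q = 132 * (k * A * (c + c + K))
  r = 44 * (k * c * (c + K))
  l₁ : ∀ G k n A g c K → 4 * (G * G) * (33 * (k * ((n * A + g * c) * (n * A + g * c + K * g)))) ≡
    G * G * (33 * (k * A * A * n) * (4 * n) + 132 * (k * A * (c + c + K)) * g * n + 44 * (k * c * (c + K)) * (3 * (g * g)))
  l₁ = solve-∀
  l₂ : ∀ G k n A g q r → G * G * (33 * (k * A * A * n) * (5 * (k * (g * g))) + q * g * n + r * n) ≡
    n * (165 * (k * k * (A * A)) * (G * G) * (g * g) + q * G * (g * G) + r * (G * G))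
  l₂ = solve-∀
  l₃ : ∀ n p q r s → n * (p * s + q * s + r * s) ≡ n * s * (p + q + r)
  l₃ = solve-∀
  l₄ : ∀ n g K G → n * (g * g) * (80 * (K * K) * (G * G)) ≡ 4 * (G * G) * (20 * (n * (K * K * (g * g))))
  l₄ = solve-∀

-- The last hypothesis of `margin-arith` for the constants of `Margin`, boxed in a record in the
-- same way.
record Margin₀ (k G : ℕ) : Set where
  constructor margin₀
  field
    holds : 165 * (k * k * (705600 * 705600)) * (G * G) +
      132 * (k * 705600 * ((k * 839971 + 1411200) + (k * 839971 + 1411200) + k * 1077749)) * G +
      44 * (k * (k * 839971 + 1411200) * ((k * 839971 + 1411200) + k * 1077749)) ≤
      80 * (k * 1077749 * (k * 1077749)) * (G * G)

margin-mono : ∀ k g n G → G ≤ g → 0 < G → 4 * n ≤ 5 * (k * (g * g)) → 3 * (g * g) ≤ n → Margin₀ k G → Margin k g n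
margin-mono k g n G G≤g G>0 h₁ h₂ (margin₀ h) =
  margin (margin-arith k g n G 705600 (k * 839971 + 1411200) (k * 1077749) G≤g G>0 h₁ h₂ h)

least : ∀ (f : ℕ → ℕ) m → f 0 < m → ∀ b → m ≤ f b → ∃[ h ] f h < m × m ≤ f (suc h)
least f m f0<m zero    m≤f = contradiction m≤f (<⇒≱ f0<m)
least f m f0<m (suc b) m≤f with m ≤? f b
... | yes m≤fb = least f m f0<m b m≤fb
... | no  m≰fb = b , ≰⇒> m≰fb , m≤f

mersenne-arith : ∀ t → 12 ≤ t → 125 * (suc t * suc t) + 810 * suc t + 1077 ≤ 2 * (125 * (t * t) + 810 * t + 1077)
mersenne-arith t h = subst (λ t → 125 * (suc t * suc t) + 810 * suc t + 1077 ≤ 2 * (125 * (t * t) + 810 * t + 1077))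
  (m+[n∸m]≡n h) (≤-slack (125 * (s * s) + 3560 * s + 24862) (lem s))
  where
  s = t ∸ 12
  lem : ∀ s → 125 * ((13 + s) * (13 + s)) + 810 * (13 + s) + 1077 + (125 * (s * s) + 3560 * s + 24862) ≡
    2 * (125 * ((12 + s) * (12 + s)) + 810 * (12 + s) + 1077)
  lem = solve-∀

-- The quadratic bounds 24 J in `quot-bound`. From t = 12 on it at most doubles in each step, while
-- 2^t - 1 more than doubles.
mersenne-lower : ∀ {t} → 12 ≤′ t → 125 * (t * t) + 810 * t + 1077 ≤ 24 * mersenne t
mersenne-lower ≤′-refl       = ≤ᵇ⇒≤ _ _ _
mersenne-lower (≤′-step {t} h) = ≤-trans (mersenne-arith t (≤′⇒≤ h))
  (≤-trans (*-monoʳ-≤ 2 (mersenne-lower h)) (≤-slack 24 (lem (mersenne t))))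
  where
  lem : ∀ M → 2 * (24 * M) + 24 ≡ 24 * (M + suc M)
  lem = solve-∀

2g/5≥13 : ∀ g → 33 ≤ g → 13 ≤ 2 * g / 5
2g/5≥13 g 33≤g = ≤-trans (≤ᵇ⇒≤ 13 (66 / 5) _) (/-monoˡ-≤ 5 (*-monoʳ-≤ 2 33≤g))

-- With t + 1 = ⌊2g/5⌋ the bound t i + i is small enough, and it applies because J is at most
-- quadratic in g while 2^t is exponential.
quot-bound : ∀ g J → 33 ≤ g → 6 * J ≤ 5 * (g * g) + 36 * g + 6 →
  ∀ i → i ≤ J → 5 * (∑quot i + i) ≤ 2 * (g * i)
quot-bound g J 33≤g J≤ i i≤J = begin
  5 * (∑quot i + i)  ≤⟨ *-monoʳ-≤ 5 (+-monoˡ-≤ i (∑quot-≤ t i (≤-trans i≤J J≤M))) ⟩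
  5 * (t * i + i)  ≡⟨ lem₁ t i ⟩
  suc t * 5 * i  ≡⟨ cong (λ q → q * 5 * i) eq ⟩
  2 * g / 5 * 5 * i  ≤⟨ *-monoˡ-≤ i (m/n*n≤m (2 * g) 5) ⟩
  2 * g * i  ≡⟨ *-assoc 2 g i ⟩
  2 * (g * i)  ∎
  where
  open ≤-Reasoning
  t = 2 * g / 5 ∸ 1
  eq : suc t ≡ 2 * g / 5
  eq = m+[n∸m]≡n (≤-trans (s≤s z≤n) (2g/5≥13 g 33≤g))
  lem₁ : ∀ t i → 5 * (t * i + i) ≡ suc t * 5 * i
  lem₁ = solve-∀
  2g≤ : 2 * g ≤ 5 * t + 9
  2g≤ = begin
    2 * g  ≡⟨ m≡m%n+[m/n]*n (2 * g) 5 ⟩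
    2 * g % 5 + 2 * g / 5 * 5  ≤⟨ +-mono-≤ (s≤s⁻¹ (m%n<n (2 * g) 5)) (≤-reflexive (cong (_* 5) (sym eq))) ⟩
    4 + suc t * 5  ≡⟨ lem t ⟩
    5 * t + 9  ∎
    where
    lem : ∀ t → 4 + suc t * 5 ≡ 5 * t + 9
    lem = solve-∀
  J≤M : J ≤ mersenne t
  J≤M = *-cancelˡ-≤ 24 (begin
    24 * J  ≡⟨ *-assoc 4 6 J ⟩
    4 * (6 * J)  ≤⟨ *-monoʳ-≤ 4 J≤ ⟩
    4 * (5 * (g * g) + 36 * g + 6)  ≡⟨ l₁ g ⟩
    5 * (2 * g * (2 * g)) + 72 * (2 * g) + 24  ≤⟨ +-monoˡ-≤ 24 (+-mono-≤ (*-monoʳ-≤ 5 (*-mono-≤ 2g≤ 2g≤)) (*-monoʳ-≤ 72 2g≤)) ⟩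
    5 * ((5 * t + 9) * (5 * t + 9)) + 72 * (5 * t + 9) + 24 ≡⟨ l₂ t ⟩
    125 * (t * t) + 810 * t + 1077  ≤⟨ mersenne-lower (≤⇒≤′ (s≤s⁻¹ (≤-trans (2g/5≥13 g 33≤g) (≤-reflexive (sym eq))))) ⟩
    24 * mersenne t  ∎)
    where
    l₁ : ∀ g → 4 * (5 * (g * g) + 36 * g + 6) ≡ 5 * (2 * g * (2 * g)) + 72 * (2 * g) + 24
    l₁ = solve-∀
    l₂ : ∀ t → 5 * ((5 * t + 9) * (5 * t + 9)) + 72 * (5 * t + 9) + 24 ≡ 125 * (t * t) + 810 * t + 1077
    l₂ = solve-∀

-- With k g ≤ 6L + 5, the polynomial factor 12 n k (L g + 1) of the far terms is at most 5 times
-- this.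
farPoly : ℕ → ℕ
farPoly L = (6 * L + 5) * (6 * L + 5) * (L * (6 * L + 5) + 3)

-- From L = 21 on each linear factor grows by at most 21/20 and the quadratic one by at most 11/10,
-- and (21/20)² (11/10) < 12/5.
farPoly-suc : ∀ L → 21 ≤ L → 5 * farPoly (suc L) ≤ 12 * farPoly L
farPoly-suc L h = *-cancelʳ-≤ (5 * farPoly (suc L)) (12 * farPoly L) 4000 (begin
  5 * farPoly (suc L) * 4000  ≡⟨ l₁ (6 * suc L + 5) (suc L * (6 * suc L + 5) + 3) ⟩
  5 * ((6 * suc L + 5) * 20 * ((6 * suc L + 5) * 20) * ((suc L * (6 * suc L + 5) + 3) * 10))
    ≤⟨ *-monoʳ-≤ 5 (*-mono-≤ (*-mono-≤ linear linear) quadratic) ⟩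
  5 * ((6 * L + 5) * 21 * ((6 * L + 5) * 21) * ((L * (6 * L + 5) + 3) * 11)) ≡⟨ l₂ (6 * L + 5) (L * (6 * L + 5) + 3) ⟩
  farPoly L * 24255  ≤⟨ *-monoʳ-≤ (farPoly L) (≤ᵇ⇒≤ 24255 48000 _) ⟩
  farPoly L * 48000  ≡⟨ trans (sym (*-assoc (farPoly L) 12 4000)) (cong (_* 4000) (*-comm (farPoly L) 12)) ⟩
  12 * farPoly L * 4000  ∎)
  where
  open ≤-Reasoning
  l₁ : ∀ m p → 5 * (m * m * p) * 4000 ≡ 5 * (m * 20 * (m * 20) * (p * 10))
  l₁ = solve-∀
  l₂ : ∀ m p → 5 * (m * 21 * (m * 21) * (p * 11)) ≡ m * m * p * 24255
  l₂ = solve-∀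
  linear : (6 * suc L + 5) * 20 ≤ (6 * L + 5) * 21
  linear = ≤-cert 11 (*-monoʳ-≤ 6 h) (l L)
    where
    l : ∀ L → (6 * suc L + 5) * 20 + 6 * L + 11 ≡ (6 * L + 5) * 21 + 6 * 21
    l = solve-∀
  quadratic : (suc L * (6 * suc L + 5) + 3) * 10 ≤ (L * (6 * L + 5) + 3) * 11
  quadratic = ≤-cert 124 (+-mono-≤ (*-monoʳ-≤ (6 * L) h) (*-monoʳ-≤ 11 h)) (l L)
    where
    l : ∀ L → (suc L * (6 * suc L + 5) + 3) * 10 + (6 * L * L + 11 * L) + 124 ≡ (L * (6 * L + 5) + 3) * 11 + (6 * L * 21 + 11 * 21)
    l = solve-∀

power-bound : ∀ {L} → 21 ≤′ L → farPoly L * 5 ^ L < 12 ^ L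
power-bound ≤′-refl = ≤ᵇ⇒≤ _ _ _
power-bound (≤′-step {L} h) = begin-strict
  farPoly (suc L) * (5 * 5 ^ L)  ≡⟨ trans (sym (*-assoc (farPoly (suc L)) 5 (5 ^ L))) (cong (_* 5 ^ L) (*-comm (farPoly (suc L)) 5)) ⟩
  5 * farPoly (suc L) * 5 ^ L  ≤⟨ *-monoˡ-≤ (5 ^ L) (farPoly-suc L (≤′⇒≤ h)) ⟩
  12 * farPoly L * 5 ^ L  ≡⟨ *-assoc 12 (farPoly L) (5 ^ L) ⟩
  12 * (farPoly L * 5 ^ L)  <⟨ *-monoʳ-< 12 (power-bound h) ⟩
  12 * 12 ^ L  ∎
  where open ≤-Reasoning

far-bound : ∀ k n g L → 21 ≤ L → 3 ≤ k → k * g ≤ 6 * L + 5 → 4 * n ≤ 5 * (k * (g * g)) →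
  n * k * (12 * suc (L * g)) * 5 ^ L < 5 * 12 ^ L
far-bound k n g L 21≤L 3≤k kg≤ n≤ = begin-strict
  n * k * (12 * suc (L * g)) * 5 ^ L  ≡⟨ cong (_* 5 ^ L) (l₁ n k (L * g)) ⟩
  4 * n * k * (3 * (L * g) + 3) * 5 ^ L  ≤⟨ *-monoˡ-≤ (5 ^ L) (*-mono-≤ (*-monoˡ-≤ k n≤) (+-monoˡ-≤ 3 3Lg≤)) ⟩
  5 * (k * (g * g)) * k * (L * M + 3) * 5 ^ L  ≡⟨ cong (λ t → t * (L * M + 3) * 5 ^ L) (l₂ k g) ⟩
  5 * (k * g * (k * g)) * (L * M + 3) * 5 ^ L  ≤⟨ *-monoˡ-≤ (5 ^ L) (*-monoˡ-≤ (L * M + 3) (*-monoʳ-≤ 5 (*-mono-≤ kg≤ kg≤))) ⟩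
  5 * (M * M) * (L * M + 3) * 5 ^ L  ≡⟨ l₃ (M * M) (L * M + 3) (5 ^ L) ⟩
  5 * (M * M * (L * M + 3) * 5 ^ L)  <⟨ *-monoʳ-< 5 (power-bound (≤⇒≤′ 21≤L)) ⟩
  5 * 12 ^ L  ∎
  where
  open ≤-Reasoning
  M = 6 * L + 5
  l₁ : ∀ n k I → n * k * (12 * suc I) ≡ 4 * n * k * (3 * I + 3)
  l₁ = solve-∀
  l₂ : ∀ k g → 5 * (k * (g * g)) * k ≡ 5 * (k * g * (k * g))
  l₂ = solve-∀
  l₃ : ∀ m p e → 5 * m * p * e ≡ 5 * (m * p * e)
  l₃ = solve-∀
  3Lg≤ : 3 * (L * g) ≤ L * M
  3Lg≤ = ≤-trans (≤-reflexive (l₄ L g)) (*-monoʳ-≤ L (≤-trans (*-monoˡ-≤ g 3≤k) kg≤))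
    where
    l₄ : ∀ L g → 3 * (L * g) ≡ L * (3 * g)
    l₄ = solve-∀

threshold : ℕ
threshold = 6500

quadratic-mono : ∀ A B C G h → G ≤ h → 0 < G → B * G + C ≤ A * (G * G) → B * h + C ≤ A * (h * h)
quadratic-mono A B C G h G≤h G>0 le = *-cancelˡ-≤ (G * G) {{m*n≢0 G G {{>-nonZero G>0}} {{>-nonZero G>0}}}} (begin
  G * G * (B * h + C)  ≡⟨ l₁ G B h C ⟩
  B * G * (h * G) + C * (G * G)  ≤⟨ +-mono-≤ (*-monoʳ-≤ (B * G) (*-monoʳ-≤ h G≤h)) (*-monoʳ-≤ C (*-mono-≤ G≤h G≤h)) ⟩
  B * G * (h * h) + C * (h * h)  ≡⟨ *-distribʳ-+ (h * h) (B * G) C ⟨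
  (B * G + C) * (h * h)  ≤⟨ *-monoˡ-≤ (h * h) le ⟩
  A * (G * G) * (h * h)  ≡⟨ l₂ A (G * G) (h * h) ⟩
  G * G * (A * (h * h))  ∎)
  where
  open ≤-Reasoning
  l₁ : ∀ G B h C → G * G * (B * h + C) ≡ B * G * (h * G) + C * (G * G)
  l₁ = solve-∀
  l₂ : ∀ A p q → A * p * q ≡ p * (A * q)
  l₂ = solve-∀

U-lem : ∀ k h → 594 * (k * (suc h * (3 * suc h + 4))) + 320 * (k * (suc h * suc h) + 36 * suc h + 6) + 298 * k * (h * h) + 0 ≡
  480 * (5 * (k * (h * h)) + 1) + ((6580 * k + 11520) * h + (4478 * k + 12960))
U-lem = solve-∀

-- The conditions on n reduce to numerical inequalities at the smallest scale G = G₀ + 1. Since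
-- 26004 = 4 · 6501, `G-least` rules out scales below G; 126 ≤ k G yields L ≥ 21.
module Large (k : ℕ) (k≥3 : 3 ≤ k) (k≤5 : k ≤ 5) (P : ℕ → ℕ) (convexP : Convex P) (P>0 : ∀ m → 0 < P m)
  (P-log : ∀ m → m * P m ≡ k * ∑ m (λ j → σ (suc j) * rev P m (suc j)))
  (G₀ : ℕ) (33≤G : 33 ≤ suc G₀) (126≤kG : 126 ≤ k * suc G₀)
  (G-least : 5 * (k * (G₀ * G₀)) < 26004)
  (J-small : (8 * k + 144) * G₀ + (4 * k + 186) ≤ 26 * k * (G₀ * G₀))
  (U-small : (6580 * k + 11520) * G₀ + (4478 * k + 12960) ≤ 298 * k * (G₀ * G₀))
  (margin-G : Margin₀ k (suc G₀))
  where

  G : ℕ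
  G = suc G₀

  -- g is the least scale with 4n ≤ 5 k g². Then I = L g is about k g² / 6, that is 2n/15, and b is
  -- the longest stretch allowed in `quarter`.
  module Scale (n′ : ℕ) (e : ℕ) (n-lower : 5 * (k * ((G₀ + e) * (G₀ + e))) < 4 * suc n′)
    (n-upper : 4 * suc n′ ≤ 5 * (k * ((G + e) * (G + e)))) where

    n = suc n′
    open ≤-Reasoning
    g = G + e
    L = k * g / 6
    b = 3 * g / 16
    J = suc (L * g + 6 * g)
    G≤g : G ≤ g
    G≤g = m≤m+n G e
    33≤g : 33 ≤ g
    33≤g = ≤-trans 33≤G G≤g
    6L≤ : 6 * L ≤ k * g
    6L≤ = ≤-trans (≤-reflexive (*-comm 6 L)) (m/n*n≤m (k * g) 6)
    kg≤ : k * g ≤ 6 * L + 5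
    kg≤ = begin
      k * g  ≡⟨ m≡m%n+[m/n]*n (k * g) 6 ⟩
      k * g % 6 + L * 6  ≤⟨ +-monoˡ-≤ (L * 6) (s≤s⁻¹ (m%n<n (k * g) 6)) ⟩
      5 + L * 6  ≡⟨ trans (+-comm 5 (L * 6)) (cong (_+ 5) (*-comm L 6)) ⟩
      6 * L + 5  ∎
    L≥21 : 21 ≤ L
    L≥21 = ≤-trans (≤ᵇ⇒≤ 21 (126 / 6) _) (/-monoˡ-≤ 6 (≤-trans 126≤kG (*-monoʳ-≤ k G≤g)))
    G₀>0 : 0 < G₀
    G₀>0 = ≤-trans (s≤s z≤n) (s≤s⁻¹ 33≤G)
    6J≤ : 6 * J ≤ k * (g * g) + 36 * g + 6
    6J≤ = ≤-cert 0 (*-monoˡ-≤ g 6L≤) (lem L g k)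
      where
      lem : ∀ L g k → 6 * suc (L * g + 6 * g) + k * g * g + 0 ≡ k * (g * g) + 36 * g + 6 + 6 * L * g
      lem = solve-∀
    6J≤5 : 6 * J ≤ 5 * (g * g) + 36 * g + 6
    6J≤5 = ≤-trans 6J≤ (+-monoˡ-≤ 6 (+-monoˡ-≤ (36 * g) (*-monoˡ-≤ (g * g) k≤5)))
    h = G₀ + e
    J-poly : 4 * (k * (g * g)) + 144 * g + 48 ≤ 30 * (k * (h * h)) + 6
    J-poly = ≤-cert 0 (quadratic-mono (26 * k) (8 * k + 144) (4 * k + 186) G₀ h (m≤m+n G₀ e) G₀>0 J-small) (lem k h)
      where
      lem : ∀ k h → 4 * (k * (suc h * suc h)) + 144 * suc h + 48 + 26 * k * (h * h) + 0 ≡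
        30 * (k * (h * h)) + 6 + ((8 * k + 144) * h + (4 * k + 186))
      lem = solve-∀
    U-poly : 594 * (k * (g * (3 * g + 4))) + 320 * (k * (g * g) + 36 * g + 6) ≤ 480 * (5 * (k * (h * h)) + 1)
    U-poly = ≤-cert 0 (quadratic-mono (298 * k) (6580 * k + 11520) (4478 * k + 12960) G₀ h (m≤m+n G₀ e) G₀>0 U-small) (U-lem k h)
    J<n : J < n
    J<n = *-cancelˡ-≤ 24 (≤-cert 0 (+-mono-≤ (*-monoʳ-≤ 4 6J≤) (+-mono-≤ J-poly (*-monoʳ-≤ 6 n-lower)))
      (lem J n (k * (g * g)) g (k * ((G₀ + e) * (G₀ + e)))))
      where
      lem : ∀ J n X g W → 24 * suc J + (4 * (X + 36 * g + 6) + (30 * W + 6 + 6 * (4 * n))) + 0 ≡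
        24 * n + (4 * (6 * J) + (4 * X + 144 * g + 48 + 6 * (1 + 5 * W)))
      lem = solve-∀
    upper-ok : 99 * (k * (g * (3 * g + 4))) + 320 * J ≤ 320 * n
    upper-ok = *-cancelˡ-≤ 6 (≤-cert 0 (+-mono-≤ (*-monoʳ-≤ 320 6J≤) (+-mono-≤ U-poly (*-monoʳ-≤ 480 n-lower)))
      (lem (k * (g * (3 * g + 4))) J n (k * (g * g) + 36 * g + 6) (k * ((G₀ + e) * (G₀ + e)))))
      where
      lem : ∀ X J n R W → 6 * (99 * X + 320 * J) + (320 * R + (480 * (5 * W + 1) + 480 * (4 * n))) + 0 ≡
        6 * (320 * n) + (320 * (6 * J) + (594 * X + 320 * R + 480 * (1 + 5 * W)))
      lem = solve-∀
    3g²≤n : 3 * (g * g) ≤ n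
    3g²≤n = *-cancelˡ-≤ 4 (≤-trans (small (G₀ + e) (≤-trans (≤ᵇ⇒≤ 10 32 _) (s≤s⁻¹ 33≤g)))
      (≤-trans (*-monoʳ-≤ 5 (*-monoˡ-≤ ((G₀ + e) * (G₀ + e)) k≥3)) (<⇒≤ n-lower)))
      where
      small : ∀ h → 10 ≤ h → 4 * (3 * (suc h * suc h)) ≤ 5 * (3 * (h * h))
      small h 10≤h with m≤n⇒∃[o]m+o≡n 10≤h
      ... | o , refl = ≤-slack (3 * (o * o) + 36 * o + 48) (lem o)
        where
        lem : ∀ o → 4 * (3 * ((11 + o) * (11 + o))) + (3 * (o * o) + 36 * o + 48) ≡ 5 * (3 * ((10 + o) * (10 + o)))
        lem = solve-∀
    margin-g : Margin k g n
    margin-g = margin-mono k g n G G≤g (s≤s z≤n) n-upper 3g²≤n margin-G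
    b-upper : 16 * b ≤ 3 * g
    b-upper = ≤-trans (≤-reflexive (*-comm 16 b)) (m/n*n≤m (3 * g) 16)
    b≥6 : 6 ≤ b
    b≥6 = ≤-trans (≤ᵇ⇒≤ 6 (99 / 16) _) (/-monoˡ-≤ 16 (*-monoʳ-≤ 3 33≤g))
    b-low : 3 * g ≤ 16 * b + 15
    b-low = begin
      3 * g  ≡⟨ m≡m%n+[m/n]*n (3 * g) 16 ⟩
      3 * g % 16 + b * 16  ≤⟨ +-monoˡ-≤ (b * 16) (s≤s⁻¹ (m%n<n (3 * g) 16)) ⟩
      15 + b * 16  ≡⟨ trans (+-comm 15 (b * 16)) (cong (_+ 15) (*-comm b 16)) ⟩
      16 * b + 15  ∎
    b-lower : 2 * g < 13 * b
    b-lower = *-cancelˡ-≤ 16 (≤-cert 20 (+-mono-≤ (*-monoʳ-≤ 13 b-low) (*-monoʳ-≤ 7 33≤g)) (lem g b))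
      where
      lem : ∀ g b → 16 * suc (2 * g) + (13 * (16 * b + 15) + 7 * g) + 20 ≡ 16 * (13 * b) + (13 * (3 * g) + 7 * 33)
      lem = solve-∀

  large : ∀ n′ → threshold ≤ n′ →
    (∀ m → 2 + m ≤ suc n′ → P m * P (2 + m) ≤ P (suc m) * P (suc m)) →
    P n′ * P (2 + n′) < P (suc n′) * P (suc n′)
  large n′ n′≥ lc = Step.step k k≥3 P convexP P>0 P-log n′ lc g L b L≥21 (≤-trans (≤ᵇ⇒≤ 8 33 _) 33≤g) n-upper J<n upper-ok
    margin-g (quot-bound g J 33≤g 6J≤5) b-upper b≥6 b-lower (far-bound k (suc n′) g L L≥21 k≥3 kg≤ n-upper)
    where
    f : ℕ → ℕ
    f h = 5 * (k * (h * h))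
    bracket : ∃[ h ] f h < 4 * suc n′ × 4 * suc n′ ≤ f (suc h)
    bracket = least f (4 * suc n′) (subst (_< 4 * suc n′) (sym (cong (5 *_) (*-zeroʳ k))) (s≤s z≤n)) (suc n′)
      (≤-trans (*-monoˡ-≤ (suc n′) (n≤1+n 4)) (*-monoʳ-≤ 5 (≤-trans (m≤m*n (suc n′) (suc n′)) (m≤n*m (suc n′ * suc n′) k {{>-nonZero (≤-trans (s≤s z≤n) k≥3)}}))))
    h = proj₁ bracket
    f-mono : ∀ {i j} → i ≤ j → f i ≤ f j
    f-mono i≤j = *-monoʳ-≤ 5 (*-monoʳ-≤ k (*-mono-≤ i≤j i≤j))
    G₀≤h : G₀ ≤ h
    G₀≤h = ≮⇒≥ (λ h<G₀ → <⇒≱ G-least (≤-trans (*-monoʳ-≤ 4 (s≤s n′≥)) (≤-trans (proj₂ (proj₂ bracket)) (f-mono h<G₀))))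
    excess : ∃[ e ] G₀ + e ≡ h
    excess = m≤n⇒∃[o]m+o≡n G₀≤h
    e = proj₁ excess
    n-upper : 4 * suc n′ ≤ f (suc (G₀ + e))
    n-upper = subst (λ i → 4 * suc n′ ≤ f (suc i)) (sym (proj₂ excess)) (proj₂ (proj₂ bracket))
    open Scale n′ e (subst (λ i → f i < 4 * suc n′) (sym (proj₂ excess)) (proj₁ (proj₂ bracket))) n-upper

-- Small n

δ : ℕ → ℕ → ℕ
δ m n = if m ≡ᵇ n then 1 else 0

δ-refl : ∀ m → δ m m ≡ 1
δ-refl zero    = refl
δ-refl (suc m) = δ-refl m

δ-≢ : ∀ {m n} → m ≢ n → δ m n ≡ 0
δ-≢ {m} {n} m≢n with m ≡ᵇ n in eq
... | true  = contradiction (≡ᵇ⇒≡ m n (subst T (sym eq) tt)) m≢n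
... | false = refl

∑-δ : ∀ M j (f : ℕ → ℕ) → j < M → ∑ M (λ l → f l * δ l j) ≡ f j
∑-δ (suc M) j f j<M with m<1+n⇒m<n∨m≡n j<M
... | inj₁ j<M′ = trans (cong₂ _+_ (∑-δ M j f j<M′) (trans (cong (f M *_) (δ-≢ (λ M≡j → <-irrefl (sym M≡j) j<M′))) (*-zeroʳ (f M)))) (+-identityʳ (f j))
... | inj₂ refl = cong₂ _+_ (∑-zero< M (λ l l<M → trans (cong (f l *_) (δ-≢ (λ l≡M → <-irrefl l≡M l<M))) (*-zeroʳ (f l)))) (trans (cong (f M *_) (δ-refl M)) (*-identityʳ (f M)))

δ-suc*suc : ∀ M d j → j < M → ∑ M (λ e → suc d * δ (suc d * suc e) (suc j)) ≡ divTerm d j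
δ-suc*suc M d j j<M = trans (sym (∑-divTerm M d (λ x → δ x (suc j)) (λ x M<x → δ-≢ (λ x≡ → <-irrefl (sym x≡) (≤-<-trans j<M M<x)))))
  (∑-δ M j (divTerm d) j<M)

-- Both factors of a factorisation for d < e, one for d = e, none for d > e: each pair of divisors
-- is counted at its smaller member.
select : ℕ → ℕ → ℕ → ℕ → ℕ
select u v d e = if d <ᵇ e then u + v else if d ≡ᵇ e then u else 0

select-split : ∀ u v d e → select u v d e ≡ (if d <ᵇ suc e then u else 0) + (if d <ᵇ e then v else 0)
select-split u v zero    zero    = sym (+-identityʳ u)
select-split u v zero    (suc e) = refl
select-split u v (suc d) zero    = refl
select-split u v (suc d) (suc e) = select-split u v d e

select-> : ∀ u v d e → e < d → select u v d e ≡ 0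
select-> u v (suc d) zero    _         = refl
select-> u v (suc d) (suc e) (s≤s e<d) = select-> u v d e e<d

either : ∀ u d e → (if d <ᵇ suc e then u else 0) + (if e <ᵇ d then u else 0) ≡ u
either u zero    e       = +-identityʳ u
either u (suc d) zero    = refl
either u (suc d) (suc e) = either u d e

-- The contribution of the divisors suc d and suc j / suc d of suc j, when suc d is the smaller one.
pairTerm : ℕ → ℕ → ℕ
pairTerm d j = if suc j % suc d ≡ᵇ 0 then select (suc d) (suc j / suc d) (suc d) (suc j / suc d) else 0

pairTerm-δ : ∀ M d j → j < M → ∑ M (λ e → select (suc d) (suc e) d e * δ (suc d * suc e) (suc j)) ≡ pairTerm d j
pairTerm-δ M d j j<M with suc j % suc d in eq
... | suc r = ∑-zero< M (λ e _ → trans (cong (select (suc d) (suc e) d e *_) (δ-≢ {suc d * suc e} {suc j} (λ de≡j → 1+n≢0 (trans (sym eq)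
  (trans (cong (_% suc d) (trans (sym de≡j) (*-comm (suc d) (suc e)))) (m*n%n≡0 (suc e) (suc d)))))))
  (*-zeroʳ (select (suc d) (suc e) d e)))
... | zero with suc j / suc d in eq′
...   | zero  = contradiction (trans (m≡m%n+[m/n]*n (suc j) (suc d)) (cong₂ (λ r q → r + q * suc d) eq eq′)) 1+n≢0
...   | suc q = trans (∑-cong M (λ e → cong (select (suc d) (suc e) d e *_) (δ-inj e)))
    (∑-δ M q (λ e → select (suc d) (suc e) d e) (≤-trans (≤-trans (m≤m*n (suc q) (suc d)) (≤-reflexive (sym j≡))) j<M))
  where
  j≡ : suc j ≡ suc q * suc d
  j≡ = trans (m≡m%n+[m/n]*n (suc j) (suc d)) (cong₂ (λ r q → r + q * suc d) eq eq′)
  δ-inj : ∀ e → δ (suc d * suc e) (suc j) ≡ δ e q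
  δ-inj e with e ≟ q
  ... | yes refl = trans (cong (δ (suc d * suc e)) (trans j≡ (*-comm (suc e) (suc d)))) (trans (δ-refl (suc d * suc e)) (sym (δ-refl e)))
  ... | no e≢q = trans (δ-≢ (λ de≡j → e≢q (suc-injective (*-cancelˡ-≡ (suc e) (suc q) (suc d) (trans de≡j (trans j≡ (*-comm (suc q) (suc d)))))))) (sym (δ-≢ e≢q))

-- The sum over factorisations is split at d ≤ e and d > e; transposing the second half moves the
-- larger divisor of a pair to the smaller one.
σ-pairs : ∀ M j → j < M → σ (suc j) ≡ ∑ M (λ d → pairTerm d j)
σ-pairs M j j<M = begin
  σ (suc j)  ≡⟨ σ-∑ M j j<M ⟩
  ∑ M (λ d → divTerm d j)  ≡⟨ ∑-cong M (λ d → δ-suc*suc M d j j<M) ⟨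
  ∑ M (λ d → ∑ M (λ e → suc d * Δ d e))  ≡⟨ ∑-cong M (λ d → ∑-cong M (λ e → cong (_* Δ d e) (either (suc d) d e))) ⟨
  ∑ M (λ d → ∑ M (λ e → (low d e + high e d) * Δ d e))  ≡⟨ distribute (λ d e → low d e) (λ d e → high e d) ⟩
  ∑ M (λ d → ∑ M (λ e → low d e * Δ d e)) + ∑ M (λ d → ∑ M (λ e → high e d * Δ d e))
    ≡⟨ cong (∑ M (λ d → ∑ M (λ e → low d e * Δ d e)) +_) (trans (∑-swap M M _) (∑-cong M (λ d → ∑-cong M (λ e → cong (λ m → high d e * δ m (suc j)) (*-comm (suc e) (suc d)))))) ⟩
  ∑ M (λ d → ∑ M (λ e → low d e * Δ d e)) + ∑ M (λ d → ∑ M (λ e → high d e * Δ d e)) ≡⟨ distribute low high ⟨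
  ∑ M (λ d → ∑ M (λ e → (low d e + high d e) * Δ d e))  ≡⟨ ∑-cong M (λ d → ∑-cong M (λ e → cong (_* Δ d e) (select-split (suc d) (suc e) d e))) ⟨
  ∑ M (λ d → ∑ M (λ e → select (suc d) (suc e) d e * Δ d e))  ≡⟨ ∑-cong M (λ d → pairTerm-δ M d j j<M) ⟩
  ∑ M (λ d → pairTerm d j)  ∎
  where
  open ≡-Reasoning
  Δ low high : ℕ → ℕ → ℕ
  Δ d e = δ (suc d * suc e) (suc j)
  low d e = if d <ᵇ suc e then suc d else 0
  high d e = if d <ᵇ e then suc e else 0
  distribute : ∀ (f g : ℕ → ℕ → ℕ) → ∑ M (λ d → ∑ M (λ e → (f d e + g d e) * Δ d e)) ≡
    ∑ M (λ d → ∑ M (λ e → f d e * Δ d e)) + ∑ M (λ d → ∑ M (λ e → g d e * Δ d e))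
  distribute f g = trans (∑-cong M (λ d → trans (∑-cong M (λ e → *-distribʳ-+ (Δ d e) (f d e) (g d e))) (∑-+ M _ _))) (∑-+ M _ _)

-- Below 82² the smaller divisor of a pair is at most 81, so 81 trial divisions give σ.
σ′ : ℕ → ℕ
σ′ j = ∑ 81 (λ d → pairTerm d j)

pairTerm-big : ∀ d j → 81 ≤ d → suc j < 82 * 82 → pairTerm d j ≡ 0
pairTerm-big d j 81≤d j< with suc j % suc d
... | suc _ = refl
... | zero  = select-> (suc d) q (suc d) q (≤-trans (*-cancelʳ-< 82 q 82 (≤-<-trans (≤-trans (*-monoʳ-≤ q (s≤s 81≤d)) (m/n*n≤m (suc j) (suc d))) j<)) (s≤s 81≤d))
  where q = suc j / suc d

σ≡σ′ : ∀ j → suc j < 82 * 82 → σ (suc j) ≡ σ′ j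
σ≡σ′ j j< = trans (σ-pairs (81 + suc j) j (m≤n+m (suc j) 81)) (∑-extend (λ d → pairTerm d j) (m≤m+n 81 (suc j)) (λ d 81≤d → pairTerm-big d j 81≤d j<))

-- Evaluation of the recurrence on lists

σs : ℕ → ℕ → List ℕ
σs zero    m = []
σs (suc f) m = σ′ m ∷ σs f (suc m)

-- Stops at the shorter list, so one list of σ values serves every n.
dot : List ℕ → List ℕ → ℕ
dot (x ∷ xs) (y ∷ ys) = x * y + dot xs ys
dot _        _        = 0

dot-[] : ∀ xs → dot xs [] ≡ 0
dot-[] []       = refl
dot-[] (_ ∷ _) = refl

revList : (ℕ → ℕ) → ℕ → List ℕ
revTail : (ℕ → ℕ) → ℕ → List ℕ
revList P n = P n ∷ revTail P n
revTail P zero    = []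
revTail P (suc n) = revList P n

dot-revList : ∀ P n f m → n < f → m + f < 82 * 82 → dot (σs f m) (revList P n) ≡ ∑ (suc n) (λ j → σ (suc (m + j)) * rev P n j)
dot-revList P n (suc f) m n<f m+f< = trans (cong₂ (λ s t → s * P n + t) σ′≡ (tail n n<f))
  (sym (∑-head n (λ j → σ (suc (m + j)) * rev P n j)))
  where
  σ′≡ : σ′ m ≡ σ (suc (m + 0))
  σ′≡ = sym (trans (cong (λ i → σ (suc i)) (+-identityʳ m))
    (σ≡σ′ m (≤-<-trans (≤-trans (≤-reflexive (+-comm 1 m)) (+-monoʳ-≤ m (s≤s z≤n))) m+f<)))
  tail : ∀ n → n < suc f → dot (σs f (suc m)) (revTail P n) ≡ ∑ n (λ j → σ (suc (m + suc j)) * rev P n (suc j))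
  tail zero    _         = dot-[] (σs f (suc m))
  tail (suc n) (s≤s n<f) = trans (dot-revList P n f (suc m) n<f (subst (_< 82 * 82) (+-suc m f) m+f<))
    (∑-cong (suc n) (λ j → cong (λ i → σ (suc i) * rev P n j) (sym (+-suc m j))))

σ≤ : ∀ j → σ (suc j) ≤ suc j * suc j
σ≤ j = ≤-trans (∑-mono< (suc j) (λ d d≤j → ≤-trans (divTerm≤ d) d≤j)) (≤-reflexive (∑-const (suc j) (suc j)))
  where
  divTerm≤ : ∀ d → divTerm d j ≤ suc d
  divTerm≤ d with suc j % suc d ≡ᵇ 0
  ... | true  = ≤-refl
  ... | false = z≤n

Strict : (ℕ → ℕ) → ℕ → Set
Strict P m = P m * P (2 + m) < P (suc m) * P (suc m)

-- The three recurrences are evaluated together, on the numbers p₃ + B (p₄ + B p₅) with B large.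
module Packed (B : ℕ) {{B≢0 : NonZero B}} where

  pack : ℕ → ℕ → ℕ → ℕ
  pack a b c = a + B * (b + B * c)

  -- Bounds the σ-weighted sum: n + 1 terms with σ(j) ≤ j² ≤ (n + 1)². Below B it rules out carries
  -- between the packed sums.
  cube : ℕ → ℕ → ℕ
  cube n y = suc n * (suc n * suc n * y)

  -- The first two comparisons certify that the lower two digits do not overflow; the others are the
  -- strict inequality at n for k = 3, 4, 5.
  test : (n y₃ z₃ y₄ z₄ y₅ z₅ x₃ x₄ x₅ : ℕ) → Bool
  test n y₃ z₃ y₄ z₄ y₅ z₅ x₃ x₄ x₅ = (cube n y₃ <ᵇ B) ∧ ((cube n y₄ <ᵇ B) ∧
    ((x₃ * z₃ <ᵇ y₃ * y₃) ∧ ((x₄ * z₄ <ᵇ y₄ * y₄) ∧ (x₅ * z₅ <ᵇ y₅ * y₅))))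

  -- The quantities to be shared in the evaluation are arguments of advance and branch.
  check   : ℕ → List ℕ → (n y₃ z₃ y₄ z₄ y₅ z₅ : ℕ) → List ℕ → Bool
  advance : ℕ → List ℕ → (n y₃ z₃ y₄ z₄ y₅ z₅ : ℕ) → List ℕ → ℕ → Bool
  branch  : ℕ → List ℕ → (n y₃ z₃ y₄ z₄ y₅ z₅ : ℕ) → List ℕ → (x₃ x₄ x₅ : ℕ) → Bool
  check zero    ss n y₃ z₃ y₄ z₄ y₅ z₅ ps = true
  check (suc f) ss n y₃ z₃ y₄ z₄ y₅ z₅ ps = advance f ss n y₃ z₃ y₄ z₄ y₅ z₅ ps (dot ss ps)
  advance f ss n y₃ z₃ y₄ z₄ y₅ z₅ ps w =
    branch f ss n y₃ z₃ y₄ z₄ y₅ z₅ ps (3 * (w % B) / suc n) (4 * (w / B % B) / suc n) (5 * (w / B / B) / suc n)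
  branch f ss n y₃ z₃ y₄ z₄ y₅ z₅ ps x₃ x₄ x₅ =
    if test n y₃ z₃ y₄ z₄ y₅ z₅ x₃ x₄ x₅ then check f ss (suc n) x₃ y₃ x₄ y₄ x₅ y₅ (pack x₃ x₄ x₅ ∷ ps) else false

  digit : ∀ a r → a < B → (a + B * r) % B ≡ a
  digit a r a<B = trans (cong (λ t → (a + t) % B) (*-comm B r)) (trans ([m+kn]%n≡m%n a r B) (m<n⇒m%n≡m a<B))

  rest : ∀ a r → a < B → (a + B * r) / B ≡ r
  rest a r a<B = trans (cong (λ t → (a + t) / B) (*-comm B r)) (trans (+-distrib-/-∣ʳ a (n∣m*n r))
    (cong₂ _+_ (m<n⇒m/n≡0 a<B) (m*n/n≡m r B)))

  <ᵇ-∧ : ∀ {m n b} → (m <ᵇ n) ∧ b ≡ true → m < n × b ≡ true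
  <ᵇ-∧ {m} {n} eq with m <ᵇ n in lt
  ... | true = <ᵇ⇒< m n (subst T (sym lt) tt) , eq

  rev-pack : ∀ f g h n j → rev (λ m → pack (f m) (g m) (h m)) n j ≡ pack (rev f n j) (rev g n j) (rev h n j)
  rev-pack f g h n       zero    = refl
  rev-pack f g h zero    (suc j) = sym (trans (cong (B *_) (*-zeroʳ B)) (*-zeroʳ B))
  rev-pack f g h (suc n) (suc j) = rev-pack f g h n j

  ∑-pack : ∀ N (s f g h : ℕ → ℕ) → ∑ N (λ j → s j * pack (f j) (g j) (h j)) ≡
    pack (∑ N (λ j → s j * f j)) (∑ N (λ j → s j * g j)) (∑ N (λ j → s j * h j))
  ∑-pack zero    s f g h = sym (trans (cong (B *_) (*-zeroʳ B)) (*-zeroʳ B))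
  ∑-pack (suc N) s f g h = trans (cong (_+ s N * pack (f N) (g N) (h N)) (∑-pack N s f g h))
    (lem B (∑ N (λ j → s j * f j)) (∑ N (λ j → s j * g j)) (∑ N (λ j → s j * h j)) (s N) (f N) (g N) (h N))
    where
    lem : ∀ B F G H s f g h → F + B * (G + B * H) + s * (f + B * (g + B * h)) ≡ F + s * f + B * (G + s * g + B * (H + s * h))
    lem = solve-∀

  module Sound (P₃ P₄ P₅ : ℕ → ℕ) (P₃↑ : Convex P₃) (P₄↑ : Convex P₄)
    (log₃ : ∀ m → m * P₃ m ≡ 3 * ∑ m (λ j → σ (suc j) * rev P₃ m (suc j)))
    (log₄ : ∀ m → m * P₄ m ≡ 4 * ∑ m (λ j → σ (suc j) * rev P₄ m (suc j)))
    (log₅ : ∀ m → m * P₅ m ≡ 5 * ∑ m (λ j → σ (suc j) * rev P₅ m (suc j))) where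

    Q : ℕ → ℕ
    Q m = pack (P₃ m) (P₄ m) (P₅ m)

    S : (ℕ → ℕ) → ℕ → ℕ
    S P n = ∑ (suc n) (λ j → σ (suc j) * rev P n j)

    S≤cube : ∀ {P} → Convex P → ∀ n → S P n ≤ cube n (P n)
    S≤cube {P} P↑ n = ≤-trans (∑-mono< (suc n) (λ j j≤n → *-mono-≤ (≤-trans (σ≤ j) (*-mono-≤ j≤n j≤n)) (antitone rev↓ (z≤n {j}))))
      (≤-reflexive (∑-const (suc n) (suc n * suc n * P n)))
      where
      rev↓ : Antitone (rev P n)
      rev↓ j = ≤-trans (m≤m+n _ _) (≤-reflexive (sym (Convex.rev-P P↑ n j)))

    next≡ : ∀ k P → (∀ m → m * P m ≡ k * ∑ m (λ j → σ (suc j) * rev P m (suc j))) → ∀ n {s} → s ≡ S P n → k * s / suc n ≡ P (suc n)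
    next≡ k P P-log n refl = trans (cong (_/ suc n) (trans (sym (P-log (suc n))) (*-comm (suc n) (P (suc n))))) (m*n/n≡m (P (suc n)) (suc n))

    run : ℕ → ℕ → ℕ → Bool
    run f F n = check f (σs F 0) n (P₃ n) (P₃ (n ∸ 1)) (P₄ n) (P₄ (n ∸ 1)) (P₅ n) (P₅ (n ∸ 1)) (revList Q n)

    one-step : ∀ f F n → suc n < F → F < 82 * 82 → run (suc f) F (suc n) ≡ true →
      (Strict P₃ n × Strict P₄ n × Strict P₅ n) × run f F (2 + n) ≡ true
    one-step f F n n<F F< ok = from-branch _ _ _ (λ lt → next≡ 3 P₃ log₃ (suc n) (low≡ lt)) (λ lt lt′ → next≡ 4 P₄ log₄ (suc n) (mid≡ lt lt′))
      (λ lt lt′ → next≡ 5 P₅ log₅ (suc n) (high≡ lt lt′)) ok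
      where
      w = dot (σs F 0) (revList Q (suc n))
      w≡ : w ≡ pack (S P₃ (suc n)) (S P₄ (suc n)) (S P₅ (suc n))
      w≡ = trans (dot-revList Q (suc n) F 0 n<F F<)
        (trans (∑-cong (2 + n) (λ j → cong (σ (suc j) *_) (rev-pack P₃ P₄ P₅ (suc n) j)))
          (∑-pack (2 + n) (λ j → σ (suc j)) (rev P₃ (suc n)) (rev P₄ (suc n)) (rev P₅ (suc n))))
      low≡ : cube (suc n) (P₃ (suc n)) < B → w % B ≡ S P₃ (suc n)
      low≡ lt = trans (cong (_% B) w≡) (digit (S P₃ (suc n)) _ (≤-<-trans (S≤cube P₃↑ (suc n)) lt))
      w/B≡ : cube (suc n) (P₃ (suc n)) < B → w / B ≡ S P₄ (suc n) + B * S P₅ (suc n)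
      w/B≡ lt = trans (cong (_/ B) w≡) (rest (S P₃ (suc n)) _ (≤-<-trans (S≤cube P₃↑ (suc n)) lt))
      mid≡ : cube (suc n) (P₃ (suc n)) < B → cube (suc n) (P₄ (suc n)) < B → w / B % B ≡ S P₄ (suc n)
      mid≡ lt lt′ = trans (cong (_% B) (w/B≡ lt)) (digit (S P₄ (suc n)) _ (≤-<-trans (S≤cube P₄↑ (suc n)) lt′))
      high≡ : cube (suc n) (P₃ (suc n)) < B → cube (suc n) (P₄ (suc n)) < B → w / B / B ≡ S P₅ (suc n)
      high≡ lt lt′ = trans (cong (_/ B) (w/B≡ lt)) (rest (S P₄ (suc n)) _ (≤-<-trans (S≤cube P₄↑ (suc n)) lt′))
      split : ∀ t {c} → (if t then c else false) ≡ true → t ≡ true × c ≡ true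
      split true eq = refl , eq
      swap : ∀ {a b c} → a * b < c → b * a < c
      swap {a} {b} h = ≤-<-trans (≤-reflexive (*-comm b a)) h
      -- The new values are variables here and become P (n + 2) only after the test has supplied the
      -- digit bounds.
      from-branch : ∀ x₃ x₄ x₅ → (cube (suc n) (P₃ (suc n)) < B → x₃ ≡ P₃ (2 + n)) →
        (cube (suc n) (P₃ (suc n)) < B → cube (suc n) (P₄ (suc n)) < B → x₄ ≡ P₄ (2 + n)) →
        (cube (suc n) (P₃ (suc n)) < B → cube (suc n) (P₄ (suc n)) < B → x₅ ≡ P₅ (2 + n)) →
        branch f (σs F 0) (suc n) (P₃ (suc n)) (P₃ n) (P₄ (suc n)) (P₄ n) (P₅ (suc n)) (P₅ n) (revList Q (suc n)) x₃ x₄ x₅ ≡ true →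
        (Strict P₃ n × Strict P₄ n × Strict P₅ n) × run f F (2 + n) ≡ true
      from-branch x₃ x₄ x₅ h₃ h₄ h₅ eq
        with split (test (suc n) (P₃ (suc n)) (P₃ n) (P₄ (suc n)) (P₄ n) (P₅ (suc n)) (P₅ n) x₃ x₄ x₅) eq
      ... | t , continue with <ᵇ-∧ {cube (suc n) (P₃ (suc n))} t
      ... | lt , t₁ with <ᵇ-∧ {cube (suc n) (P₄ (suc n))} t₁
      ... | lt′ , t₂ with h₃ lt | h₄ lt lt′ | h₅ lt lt′
      ... | refl | refl | refl with <ᵇ-∧ {P₃ (2 + n) * P₃ n} t₂
      ... | s₃ , t₃ with <ᵇ-∧ {P₄ (2 + n) * P₄ n} t₃
      ... | s₄ , t₄ = (swap {P₃ (2 + n)} s₃ , swap {P₄ (2 + n)} s₄ , swap {P₅ (2 + n)} (<ᵇ⇒< (P₅ (2 + n) * P₅ n) _ (subst T (sym t₄) tt))) , continue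

    sound : ∀ f F n → f + suc n < F → F < 82 * 82 → run f F (suc n) ≡ true →
      ∀ i → i < f → Strict P₃ (n + i) × Strict P₄ (n + i) × Strict P₅ (n + i)
    sound (suc f) F n f+n<F F< ok zero    _         = subst (λ m → Strict P₃ m × Strict P₄ m × Strict P₅ m) (sym (+-identityʳ n))
      (proj₁ (one-step f F n (≤-trans (s≤s (m≤n+m (suc n) f)) (<⇒≤ f+n<F)) F< ok))
    sound (suc f) F n f+n<F F< ok (suc i) (s≤s i<f) = subst (λ m → Strict P₃ m × Strict P₄ m × Strict P₅ m) (sym (+-suc n i))
      (sound f F (suc n) (subst (_< F) (sym (+-suc f (suc n))) f+n<F) F<
        (proj₂ (one-step f F n (≤-trans (s≤s (m≤n+m (suc n) f)) (<⇒≤ f+n<F)) F< ok)) i i<f)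

-- Starts at n = 2 from literal values of p₃, p₄, p₅ at 0, 1, 2, so that the evaluation works on
-- numerals only.
verify : (B : ℕ) {{_ : NonZero B}} → ℕ → List ℕ → Bool
verify B f ss = Packed.check B f ss 2 9 3 14 4 20 5 (pack 9 14 20 ∷ pack 3 4 5 ∷ pack 1 1 1 ∷ [])
  where open Packed B

-- Convolutions of log-concave sequences

LogConcave : (ℕ → ℕ) → Set
LogConcave P = ∀ m → P m * P (2 + m) ≤ P (suc m) * P (suc m)

rearrange : ∀ p q r s → q ≤ p → s ≤ r → p * s + q * r ≤ p * r + q * s
rearrange p q r s q≤p s≤r = subst (λ p → p * s + q * r ≤ p * r + q * s) (m+[n∸m]≡n q≤p)
  (subst (λ r → (q + (p ∸ q)) * s + q * r ≤ (q + (p ∸ q)) * r + q * s) (m+[n∸m]≡n s≤r)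
    (≤-slack ((p ∸ q) * (r ∸ s)) (lem q (p ∸ q) s (r ∸ s))))
  where
  lem : ∀ q o s t → (q + o) * s + q * (s + t) + o * t ≡ (q + o) * (s + t) + q * s
  lem = solve-∀

rearrange-< : ∀ p q r s → q < p → s < r → p * s + q * r < p * r + q * s
rearrange-< p q r s q<p s<r = subst (λ p → p * s + q * r < p * r + q * s) (m+[n∸m]≡n q<p)
  (subst (λ r → (suc q + (p ∸ suc q)) * s + q * r < (suc q + (p ∸ suc q)) * r + q * s) (m+[n∸m]≡n s<r)
    (≤-slack ((p ∸ suc q) + (r ∸ suc s) + (p ∸ suc q) * (r ∸ suc s)) (lem q (p ∸ suc q) s (r ∸ suc s))))
  where
  lem : ∀ q o s t → suc ((suc q + o) * s + q * (suc s + t)) + (o + t + o * t) ≡ (suc q + o) * (suc s + t) + q * s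
  lem = solve-∀

-- Cauchy–Binet: the difference of the two sides is ∑_{i < j} (xᵢ yⱼ − xⱼ yᵢ) (uᵢ wⱼ − uⱼ wᵢ).
module CauchyBinet (x y u w : ℕ → ℕ)
  (xy : ∀ i j → i < j → x j * y i ≤ x i * y j) (uw : ∀ i j → i < j → u j * w i ≤ u i * w j) where

  private
    ⟨_,_⟩ : (ℕ → ℕ) → (ℕ → ℕ) → ℕ → ℕ
    ⟨ f , g ⟩ N = ∑ N (λ i → f i * g i)

    lhs rhs : ℕ → ℕ → ℕ
    lhs N i = x i * w i * (y N * u N) + x N * w N * (y i * u i)
    rhs N i = x i * u i * (y N * w N) + x N * u N * (y i * w i)

    lhs≡ : ∀ N i → lhs N i ≡ x i * y N * (u N * w i) + x N * y i * (u i * w N)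
    lhs≡ N i = lem (x i) (w i) (y N) (u N) (x N) (w N) (y i) (u i)
      where
      lem : ∀ x w Y U X W y u → x * w * (Y * U) + X * W * (y * u) ≡ x * Y * (U * w) + X * y * (u * W)
      lem = solve-∀

    rhs≡ : ∀ N i → rhs N i ≡ x i * y N * (u i * w N) + x N * y i * (u N * w i)
    rhs≡ N i = lem (x i) (w i) (y N) (u N) (x N) (w N) (y i) (u i)
      where
      lem : ∀ x w Y U X W y u → x * u * (Y * W) + X * U * (y * w) ≡ x * Y * (u * W) + X * y * (U * w)
      lem = solve-∀

    lhs≤rhs : ∀ N i → i < N → lhs N i ≤ rhs N i
    lhs≤rhs N i i<N = ≤-trans (≤-reflexive (lhs≡ N i)) (≤-trans
      (rearrange (x i * y N) (x N * y i) (u i * w N) (u N * w i) (xy i N i<N) (uw i N i<N)) (≤-reflexive (sym (rhs≡ N i))))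

    cross : ∀ N (a b c d : ℕ → ℕ) A B → ∑ N (λ i → a i * b i * A + B * (c i * d i)) ≡ ⟨ a , b ⟩ N * A + B * ⟨ c , d ⟩ N
    cross N a b c d A B = trans (∑-+ N _ _) (cong₂ _+_ (∑-*ʳ N A _) (∑-*ˡ N B _))

    expand : ∀ a b c d → (a + b) * (c + d) ≡ a * c + (a * d + b * c) + b * d
    expand = solve-∀

    corner : ∀ N → x N * w N * (y N * u N) ≡ x N * u N * (y N * w N)
    corner N = lem (x N) (w N) (y N) (u N)
      where
      lem : ∀ x w y u → x * w * (y * u) ≡ x * u * (y * w)
      lem = solve-∀

  weak : ∀ N → ⟨ x , w ⟩ N * ⟨ y , u ⟩ N ≤ ⟨ x , u ⟩ N * ⟨ y , w ⟩ N
  weak zero    = z≤n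
  weak (suc N) = begin
    ⟨ x , w ⟩ (suc N) * ⟨ y , u ⟩ (suc N)  ≡⟨ expand (⟨ x , w ⟩ N) (x N * w N) (⟨ y , u ⟩ N) (y N * u N) ⟩
    ⟨ x , w ⟩ N * ⟨ y , u ⟩ N + (⟨ x , w ⟩ N * (y N * u N) + x N * w N * ⟨ y , u ⟩ N) + x N * w N * (y N * u N)
      ≤⟨ +-mono-≤ (+-mono-≤ (weak N) middle) (≤-reflexive (corner N)) ⟩
    ⟨ x , u ⟩ N * ⟨ y , w ⟩ N + (⟨ x , u ⟩ N * (y N * w N) + x N * u N * ⟨ y , w ⟩ N) + x N * u N * (y N * w N)
      ≡⟨ expand (⟨ x , u ⟩ N) (x N * u N) (⟨ y , w ⟩ N) (y N * w N) ⟨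
    ⟨ x , u ⟩ (suc N) * ⟨ y , w ⟩ (suc N) ∎
    where
    open ≤-Reasoning
    middle : ⟨ x , w ⟩ N * (y N * u N) + x N * w N * ⟨ y , u ⟩ N ≤ ⟨ x , u ⟩ N * (y N * w N) + x N * u N * ⟨ y , w ⟩ N
    middle = ≤-trans (≤-reflexive (sym (cross N x w y u (y N * u N) (x N * w N))))
      (≤-trans (∑-mono< N (lhs≤rhs N)) (≤-reflexive (cross N x u y w (y N * w N) (x N * u N))))

  -- One strict term of the sum over pairs is enough; the pair of the first and the last index
  -- provides it.
  strict : ∀ N → x (suc N) * y 0 < x 0 * y (suc N) → u (suc N) * w 0 < u 0 * w (suc N) →
    ⟨ x , w ⟩ (2 + N) * ⟨ y , u ⟩ (2 + N) < ⟨ x , u ⟩ (2 + N) * ⟨ y , w ⟩ (2 + N)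
  strict M xy₀ uw₀ = begin-strict
    ⟨ x , w ⟩ (suc N) * ⟨ y , u ⟩ (suc N)  ≡⟨ expand (⟨ x , w ⟩ N) (x N * w N) (⟨ y , u ⟩ N) (y N * u N) ⟩
    ⟨ x , w ⟩ N * ⟨ y , u ⟩ N + (⟨ x , w ⟩ N * (y N * u N) + x N * w N * ⟨ y , u ⟩ N) + x N * w N * (y N * u N)
      <⟨ +-mono-<-≤ (+-mono-≤-< (weak N) middle) (≤-reflexive (corner N)) ⟩
    ⟨ x , u ⟩ N * ⟨ y , w ⟩ N + (⟨ x , u ⟩ N * (y N * w N) + x N * u N * ⟨ y , w ⟩ N) + x N * u N * (y N * w N)
      ≡⟨ expand (⟨ x , u ⟩ N) (x N * u N) (⟨ y , w ⟩ N) (y N * w N) ⟨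
    ⟨ x , u ⟩ (suc N) * ⟨ y , w ⟩ (suc N) ∎
    where
    open ≤-Reasoning
    N = suc M
    first : lhs N 0 < rhs N 0
    first = ≤-<-trans (≤-reflexive (lhs≡ N 0)) (<-≤-trans
      (rearrange-< (x 0 * y N) (x N * y 0) (u 0 * w N) (u N * w 0) xy₀ uw₀) (≤-reflexive (sym (rhs≡ N 0))))
    middle : ⟨ x , w ⟩ N * (y N * u N) + x N * w N * ⟨ y , u ⟩ N < ⟨ x , u ⟩ N * (y N * w N) + x N * u N * ⟨ y , w ⟩ N
    middle = begin-strict
      ⟨ x , w ⟩ N * (y N * u N) + x N * w N * ⟨ y , u ⟩ N  ≡⟨ cross N x w y u (y N * u N) (x N * w N) ⟨
      ∑ N (lhs N)  ≡⟨ ∑-head M (lhs N) ⟩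
      lhs N 0 + ∑ M (λ i → lhs N (suc i))  <⟨ +-mono-<-≤ first (∑-mono< M (λ i i<M → lhs≤rhs N (suc i) (s≤s i<M))) ⟩
      rhs N 0 + ∑ M (λ i → rhs N (suc i))  ≡⟨ ∑-head M (rhs N) ⟨
      ∑ N (rhs N)  ≡⟨ cross N x u y w (y N * w N) (x N * u N) ⟩
      ⟨ x , u ⟩ N * (y N * w N) + x N * u N * ⟨ y , w ⟩ N  ∎

conv-logconcave : ∀ a b → (∀ m → 0 < a m) → (∀ m → 0 < b m) → LogConcave a → LogConcave b →
  ∀ m → conv a b m * conv a b (2 + m) < conv a b (suc m) * conv a b (suc m)
conv-logconcave a b a>0 b>0 lc-a lc-b m = subst₂ _<_ left right (CB.strict n xy₀ uw₀)
  where
  n = suc m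
  y : ℕ → ℕ
  y zero    = 0
  y (suc i) = a i
  u w : ℕ → ℕ
  u = rev b n
  w = rev b (suc n)
  module B = Ratio b b>0 (suc n) (λ k _ → lc-b k)
  xy : ∀ i j → i < j → a j * y i ≤ a i * y j
  xy zero    j       _         = ≤-trans (≤-reflexive (*-zeroʳ (a j))) z≤n
  xy (suc i) (suc j) (s≤s i<j) = subst (λ j → a (suc j) * a i ≤ a (suc i) * a j) (m+[n∸m]≡n (<⇒≤ i<j))
    (≤-trans (Ratio.ratio-P a a>0 (suc (i + (j ∸ i))) (λ k _ → lc-a k) i (j ∸ i) ≤-refl) (≤-reflexive (*-comm (a (i + (j ∸ i))) (a (suc i)))))
  uw : ∀ i j → i < j → u j * w i ≤ u i * w j
  uw i j i<j = subst (λ j → u j * w i ≤ u i * w j) (m+[n∸m]≡n (<⇒≤ i<j))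
    (≤-trans (≤-reflexive (*-comm (u (i + (j ∸ i))) (w i))) (B.ratio i (j ∸ i)))
  module CB = CauchyBinet a y u w xy uw
  xy₀ : a (suc n) * 0 < a 0 * a n
  xy₀ = subst (_< a 0 * a n) (sym (*-zeroʳ (a (suc n)))) (*-mono-< (a>0 0) (a>0 n))
  uw₀ : u (suc n) * w 0 < u 0 * w (suc n)
  uw₀ = subst (_< b n * w (suc n)) (sym (cong (_* w 0) (rev-> b n (suc n) ≤-refl)))
    (*-mono-< (b>0 n) (subst (0 <_) (sym (trans (rev-∸ b n n ≤-refl) (cong b (n∸n≡0 n)))) (b>0 0)))
  left : ∑ (2 + n) (λ i → a i * w i) * ∑ (2 + n) (λ i → y i * u i) ≡ conv a b m * conv a b (2 + m)
  left = trans (cong₂ _*_ (sym (conv-∑ a b (suc n)))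
    (trans (∑-head (suc n) (λ i → y i * u i)) (sym (conv-∑-ext a b m (≤-trans (n≤1+n n) ≤-refl)))))
    (*-comm (conv a b (2 + m)) (conv a b m))
  right : ∑ (2 + n) (λ i → a i * u i) * ∑ (2 + n) (λ i → y i * w i) ≡ conv a b (suc m) * conv a b (suc m)
  right = cong₂ _*_ (sym (conv-∑-ext a b n (n≤1+n (suc n))))
    (trans (∑-head (suc n) (λ i → y i * w i)) (sym (conv-∑ a b n)))

-- The sequences p_k and the final case distinction

pk>0 : ∀ k m → 0 < pk (2 + k) m
pk>0 k zero    = subst (0 <_) (sym (pk-0 (2 + k))) (s≤s z≤n)
pk>0 k (suc m) = ≤-trans (pk>0 k m) (≤-trans (m≤m+n _ _) (≤-reflexive (sym (Convex.P-suc (pk-convex k) m))))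

pk-recurrence : ∀ k m → m * pk k m ≡ k * ∑ m (λ j → σ (suc j) * rev (pk k) m (suc j))
pk-recurrence k m = trans (pk-log k m) (cong (k *_) (conv-σ (pk k) m))

conv-unit : ∀ g n → conv (pk 0) g n ≡ g n
conv-unit g n = trans (conv-∑ (pk 0) g n) (trans (∑-head n _)
  (trans (cong₂ _+_ (+-identityʳ (g n)) (∑-zero< n (λ _ _ → refl))) (+-identityʳ (g n))))

pk-3+ : ∀ k n → pk (3 + k) n ≡ conv (pk 3) (pk k) n
pk-3+ k n = sym (peel 2 (peel 1 (peel 0 (conv-unit (pk k)))) n)
  where
  peel : ∀ j {g} → (∀ n → conv (pk j) (pk k) n ≡ g n) → ∀ n → conv (pk (suc j)) (pk k) n ≡ conv p g n
  peel j h n = trans (conv-assoc p (pk j) (pk k) n) (conv-cong {p} n (λ _ → refl) h)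

below : ∀ B {{_ : NonZero B}} f F → F < 82 * 82 → f + 2 < F → verify B f (σs F 0) ≡ true →
  ∀ i → i < f → Strict (pk 3) (1 + i) × Strict (pk 4) (1 + i) × Strict (pk 5) (1 + i)
below B f F F< f< ok = Packed.Sound.sound B (pk 3) (pk 4) (pk 5) (pk-convex 1) (pk-convex 2)
  (pk-recurrence 3) (pk-recurrence 4) (pk-recurrence 5) f F 1 f< F< ok

-- Only the weak inequality is asked at the first place: for k = 3 it is the equality 1 · 9 = 3².
module Base (P : ℕ → ℕ) (start : P 0 * P 2 ≤ P 1 * P 1) (below : ∀ i → i < threshold → Strict P (1 + i))
  (large : ∀ m → threshold ≤ m → (∀ j → 2 + j ≤ suc m → P j * P (2 + j) ≤ P (suc j) * P (suc j)) → Strict P m) where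

  private
    go : ∀ m → Acc _<_ m → Strict P (suc m)
    go m (acc rs) with threshold ≤? m
    ... | no  h = below m (≰⇒> h)
    ... | yes h = large (suc m) (m≤n⇒m≤1+n h) previous
      where
      previous : ∀ j → 2 + j ≤ 2 + m → P j * P (2 + j) ≤ P (suc j) * P (suc j)
      previous zero    _   = start
      previous (suc j) j<m = <⇒≤ (go j (rs (s≤s⁻¹ (s≤s⁻¹ j<m))))

  strict : ∀ m → Strict P (suc m)
  strict m = go m (<-wellFounded m)

  weak : LogConcave P
  weak zero    = start
  weak (suc m) = <⇒≤ (strict m)

-- 41, and 36 and 32 for k = 4 and 5, are the largest G₀ with 5 k G₀² < 26004.
large₃ : ∀ m → threshold ≤ m → (∀ j → 2 + j ≤ suc m → pk 3 j * pk 3 (2 + j) ≤ pk 3 (suc j) * pk 3 (suc j)) →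
  Strict (pk 3) m
large₃ = Large.large 3 (≤ᵇ⇒≤ _ _ _) (≤ᵇ⇒≤ _ _ _) (pk 3) (pk-convex 1) (pk>0 1) (pk-recurrence 3)
  41 (≤ᵇ⇒≤ _ _ _) (≤ᵇ⇒≤ _ _ _) (≤ᵇ⇒≤ _ _ _) (≤ᵇ⇒≤ _ _ _) (≤ᵇ⇒≤ _ _ _) (margin₀ (≤ᵇ⇒≤ _ _ _))

large₄ : ∀ m → threshold ≤ m → (∀ j → 2 + j ≤ suc m → pk 4 j * pk 4 (2 + j) ≤ pk 4 (suc j) * pk 4 (suc j)) →
  Strict (pk 4) m
large₄ = Large.large 4 (≤ᵇ⇒≤ _ _ _) (≤ᵇ⇒≤ _ _ _) (pk 4) (pk-convex 2) (pk>0 2) (pk-recurrence 4)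
  36 (≤ᵇ⇒≤ _ _ _) (≤ᵇ⇒≤ _ _ _) (≤ᵇ⇒≤ _ _ _) (≤ᵇ⇒≤ _ _ _) (≤ᵇ⇒≤ _ _ _) (margin₀ (≤ᵇ⇒≤ _ _ _))

large₅ : ∀ m → threshold ≤ m → (∀ j → 2 + j ≤ suc m → pk 5 j * pk 5 (2 + j) ≤ pk 5 (suc j) * pk 5 (suc j)) →
  Strict (pk 5) m
large₅ = Large.large 5 (≤ᵇ⇒≤ _ _ _) (≤ᵇ⇒≤ _ _ _) (pk 5) (pk-convex 3) (pk>0 3) (pk-recurrence 5)
  32 (≤ᵇ⇒≤ _ _ _) (≤ᵇ⇒≤ _ _ _) (≤ᵇ⇒≤ _ _ _) (≤ᵇ⇒≤ _ _ _) (≤ᵇ⇒≤ _ _ _) (margin₀ (≤ᵇ⇒≤ _ _ _))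

-- Large enough for (n + 1)³ p₄(n) over the whole range, which the computation itself confirms
-- through `test`.
base : ℕ
base = 2 ^ 700

instance
  base≢0 : NonZero base
  base≢0 = m^n≢0 2 700

checked : verify base threshold (σs 6510 0) ≡ true
checked = refl

small : ∀ i → i < threshold → Strict (pk 3) (1 + i) × Strict (pk 4) (1 + i) × Strict (pk 5) (1 + i)
small = below base threshold 6510 (≤ᵇ⇒≤ _ _ _) (≤ᵇ⇒≤ _ _ _) checked

module B₃ = Base (pk 3) (≤ᵇ⇒≤ _ _ _) (λ i i< → proj₁ (small i i<)) large₃
module B₄ = Base (pk 4) (≤ᵇ⇒≤ _ _ _) (λ i i< → proj₁ (proj₂ (small i i<))) large₄
module B₅ = Base (pk 5) (≤ᵇ⇒≤ _ _ _) (λ i i< → proj₂ (proj₂ (small i i<))) large₅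

pk-logconcave : ∀ j → LogConcave (pk (3 + j))

pk-strict : ∀ j m → Strict (pk (6 + j)) m
pk-strict j m = subst₂ _<_ (cong₂ _*_ (sym (pk-3+ (3 + j) m)) (sym (pk-3+ (3 + j) (2 + m))))
  (cong₂ _*_ (sym (pk-3+ (3 + j) (suc m))) (sym (pk-3+ (3 + j) (suc m))))
  (conv-logconcave (pk 3) (pk (3 + j)) (pk>0 1) (pk>0 (1 + j)) B₃.weak (pk-logconcave j) m)

pk-logconcave 0                   m = B₃.weak m
pk-logconcave 1                   m = B₄.weak m
pk-logconcave 2                   m = B₅.weak m
pk-logconcave (suc (suc (suc j))) m = <⇒≤ (pk-strict j m)

theorem1p1 : (k n : ℕ) → 3 ≤ k → 1 ≤ n → ¬ (k ≡ 3 × n ≡ 1) →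
    pk k (n ∸ 1) * pk k (suc n) < pk k n * pk k n
theorem1p1 3 1             _ _ except = contradiction (refl , refl) except
theorem1p1 3 (suc (suc m)) _ _ _      = B₃.strict m
theorem1p1 4 1             _ _ _      = ≤ᵇ⇒≤ _ _ _
theorem1p1 4 (suc (suc m)) _ _ _      = B₄.strict m
theorem1p1 5 1             _ _ _      = ≤ᵇ⇒≤ _ _ _
theorem1p1 5 (suc (suc m)) _ _ _      = B₅.strict m
theorem1p1 (suc (suc (suc (suc (suc (suc j)))))) (suc m) _ _ _ = pk-strict j m
theorem1p1 0 _    () _ _
theorem1p1 1 _    (s≤s ()) _ _
theorem1p1 2 _    (s≤s (s≤s ())) _ _
theorem1p1 k zero _ () _
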